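{- Let $t$ be a positive integer. (1) For all $n\ge k\ge1$, $S_t(n,k)$ equals the number of ordered $t$-tuples $(\pi_1,\ldots,\pi_t)$ of set partitions of $[n]$ into $k$ blocks such that the sets of block minima of $\pi_1,\ldots,\pi_t$ coincide. (2) For all $n\ge k\ge1$, $s_t(n,k)$ equals the number of ordered $t$-tuples $(\sigma_1,\ldots,\sigma_t)$ of permutations of $[n]$ each having $k$ cycles such that the sets of cycle minima of $\sigma_1,\ldots,\sigma_t$ coincide. (3) For $n\ge0$ and every positive integer $m$, $B_{\mathbf{t}n}(m)=S_t(n+m,m)$ and $b_{\mathbf{t}n}(m)=s_t(m,m-n)$. (4) For positive integers $n,k$, $$S_t(n+k,k)=\sum_{1\le i_1\le\cdots\le i_n\le k} i_1^t\cdots i_n^t,\qquad s_t(n,n-k)=\sum_{1\le i_1<\cdots<i_k<n} i_1^t\cdots i_k^t.$$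
   Context: For a positive integer $t$, the numbers $S_t(n,k)$, $s_t(n,k)$ ($0\le k\le n$) are defined by $x^n=\sum_{k=0}^n S_t(n,k)\prod_{i=0}^{k-1}(x-i^t)$ and $\prod_{i=0}^{n-1}(x+i^t)=\sum_{k=0}^n s_t(n,k)x^k$ (and are $0$ for $k>n$ or negative arguments). $\mathbf{t}n$ denotes the $nt$-tuple consisting of $n$ consecutive blocks $(1,1,\ldots,1,2)$, each block having $t$ entries ($t-1$ ones followed by a $2$). Stirling polynomials: for a tuple $\mathbf{k}=(k_1,\ldots,k_N)$ of positive integers, $K=\sum k_i$, a Stirling permutation of $\{1^{k_1},\ldots,N^{k_N}\}$ is a word $\sigma(1)\cdots\sigma(K)$ with each $i$ appearing $k_i$ times such that $\sigma(i)=\sigma(j)$, $i<s<j$ imply $\sigma(s)\ge\sigma(i)$; index $i$ is a descent if $i<K$ and $\sigma(i)>\sigma(i+1)$, or $i=K$; $A_{\mathbf{k},i}$ counts those with exactly $i$ descents; $\sum_{m\ge0}B_{\mathbf{k}}(m)x^m=\frac{\sum_{i=1}^{N}A_{\mathbf{k},i}x^i}{(1-x)^{K+1}}$, $\sum_{m\ge0}b_{\mathbf{k}}(m)x^m=\frac{\sum_{i=K-N+1}^{K}A_{\mathbf{k},K+1-i}x^i}{(1-x)^{K+1}}$; for the empty tuple $B_\emptyset=b_\emptyset=1$. -}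

module Defs where

open import Data.Nat as ℕ using (ℕ; zero; suc; _+_; _*_; _∸_; _≤ᵇ_)
open import Data.Nat.Combinatorics using (_C_)
open import Data.Nat.ListAction using (sum; product)
open import Data.Integer as ℤ using (ℤ; +_; -[1+_])
open import Data.Bool using (Bool; true; false; if_then_else_)
import Data.Bool.Properties as BoolP
open import Data.Fin as F using (Fin; toℕ)
import Data.Fin.Properties as FP
open import Data.List using (List; []; _∷_; [_]; map; concatMap; concat; filter; length; lookup; allFin; applyUpTo; upTo; replicate; foldr; _++_)
open import Data.Product using (Σ; ∃; _×_; _,_)
open import Data.Sum using (_⊎_)
open import Relation.Binary.PropositionalEquality using (_≡_)
open import Relation.Nullary using (Dec)
open import Relation.Nullary.Decidable using (_×-dec_; _⊎-dec_; _→-dec_)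
open import Relation.Unary using (Pred; Decidable)
open import Level using (0ℓ)

-- all functions Fin n → A whose values are taken from the list `as`
-- (each function listed exactly once when `as` has no duplicates)
funs : {A : Set} → List A → (n : ℕ) → List (Fin n → A)
funs as zero    = [ (λ ()) ]
funs as (suc n) =
  concatMap (λ a → map (λ f → λ { F.zero → a ; (F.suc i) → f i }) (funs as n)) as

countL : {A : Set} {P : Pred A 0ℓ} → Decidable P → List A → ℕ
countL P? xs = length (filter P? xs)

countFin : {n : ℕ} {P : Pred (Fin n) 0ℓ} → Decidable P → ℕ
countFin {n} P? = countL P? (allFin n)

sumℤ : List ℤ → ℤ
sumℤ = foldr ℤ._+_ (+ 0)

prodℤ : List ℤ → ℤ
prodℤ = foldr ℤ._*_ (+ 1)

-- S_t : defined (as in the paper) by the identity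
--   x^n = Σ_{k=0}^n S_t(n,k) ∏_{i=0}^{k-1} (x - i^t),
-- read as a polynomial identity, i.e. valid at every integer x,
-- together with S_t(n,k) = 0 for k > n.

IsGenStirling2 : (t : ℕ) → (ℕ → ℕ → ℤ) → Set
IsGenStirling2 t S =
  (∀ (n : ℕ) (x : ℤ) →
     x ℤ.^ n ≡ sumℤ (map (λ k → S n k ℤ.* prodℤ (map (λ i → x ℤ.- + (i ℕ.^ t)) (upTo k)))
                         (upTo (suc n))))
  × (∀ n k → n ℕ.< k → S n k ≡ + 0)

-- s_t : coefficients of ∏_{i=0}^{n-1} (x + i^t).
-- Polynomials with ℕ coefficients as coefficient lists, lowest degree first.

addP : List ℕ → List ℕ → List ℕ
addP []       q        = q
addP (a ∷ p)  []       = a ∷ p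
addP (a ∷ p)  (b ∷ q)  = (a + b) ∷ addP p q

mulLin : ℕ → List ℕ → List ℕ
mulLin c p = addP (map (c *_) p) (0 ∷ p)

risingPoly : ℕ → ℕ → List ℕ
risingPoly t zero    = [ 1 ]
risingPoly t (suc n) = mulLin (n ℕ.^ t) (risingPoly t n)

coeff : List ℕ → ℕ → ℕ
coeff []      k       = 0
coeff (a ∷ p) zero    = a
coeff (a ∷ p) (suc k) = coeff p k

s : ℕ → ℕ → ℕ → ℕ
s t n k = coeff (risingPoly t n) k

sℤ : ℕ → ℕ → ℤ → ℕ
sℤ t n (+ k)      = s t n k
sℤ t n -[1+ _ ]   = 0

-- Set partitions of [n] = Fin n, represented by their equivalence relation
-- (Boolean-valued relation on Fin n).

Rel : ℕ → Set
Rel n = Fin n → Fin n → Bool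

IsEquivRel : {n : ℕ} → Rel n → Set
IsEquivRel R =
  (∀ i → R i i ≡ true)
  × (∀ i j → R i j ≡ true → R j i ≡ true)
  × (∀ i j l → R i j ≡ true → R j l ≡ true → R i l ≡ true)

BlockMin : {n : ℕ} → Rel n → Fin n → Set
BlockMin R i = ∀ j → j F.< i → R j i ≡ false

isEquivRel? : {n : ℕ} (R : Rel n) → Dec (IsEquivRel R)
isEquivRel? R =
  FP.all? (λ i → R i i BoolP.≟ true)
  ×-dec FP.all? (λ i → FP.all? (λ j → (R i j BoolP.≟ true) →-dec (R j i BoolP.≟ true)))
  ×-dec FP.all? (λ i → FP.all? (λ j → FP.all? (λ l →
          (R i j BoolP.≟ true) →-dec ((R j l BoolP.≟ true) →-dec (R i l BoolP.≟ true)))))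

blockMin? : {n : ℕ} (R : Rel n) → Decidable (BlockMin R)
blockMin? R i = FP.all? (λ j → (j FP.<? i) →-dec (R j i BoolP.≟ false))

numBlocks : {n : ℕ} → Rel n → ℕ
numBlocks R = countFin (blockMin? R)

PartitionTuple : (t n k : ℕ) → Pred (Fin t → Rel n) 0ℓ
PartitionTuple t n k π =
  (∀ a → IsEquivRel (π a) × numBlocks (π a) ≡ k)
  × (∀ a b i → (BlockMin (π a) i → BlockMin (π b) i) × (BlockMin (π b) i → BlockMin (π a) i))

partitionTuple? : (t n k : ℕ) → Decidable (PartitionTuple t n k)
partitionTuple? t n k π =
  FP.all? (λ a → isEquivRel? (π a) ×-dec (numBlocks (π a) ℕ.≟ k))
  ×-dec FP.all? (λ a → FP.all? (λ b → FP.all? (λ i →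
          (blockMin? (π a) i →-dec blockMin? (π b) i) ×-dec (blockMin? (π b) i →-dec blockMin? (π a) i))))

allRels : (n : ℕ) → List (Rel n)
allRels n = map (λ f i j → f i j) (funs (funs (true ∷ false ∷ []) n) n)

numPartitionTuples : (t n k : ℕ) → ℕ
numPartitionTuples t n k = countL (partitionTuple? t n k) (funs (allRels n) t)

IsPerm : {n : ℕ} → (Fin n → Fin n) → Set
IsPerm {n} σ = (∀ i j → σ i ≡ σ j → i ≡ j) × (∀ j → ∃ λ i → σ i ≡ j)

iter : {n : ℕ} → (Fin n → Fin n) → ℕ → Fin n → Fin n
iter σ zero    i = i
iter σ (suc m) i = σ (iter σ m i)

-- i is the minimum of its cycle: i ≤ σ^m(i) for all m
-- (m ranging over 0..n-1, which covers the whole orbit)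
CycleMin : {n : ℕ} → (Fin n → Fin n) → Fin n → Set
CycleMin {n} σ i = ∀ (m : Fin n) → i F.≤ iter σ (toℕ m) i

isPerm? : {n : ℕ} (σ : Fin n → Fin n) → Dec (IsPerm σ)
isPerm? σ =
  FP.all? (λ i → FP.all? (λ j → (σ i FP.≟ σ j) →-dec (i FP.≟ j)))
  ×-dec FP.all? (λ j → FP.any? (λ i → σ i FP.≟ j))

cycleMin? : {n : ℕ} (σ : Fin n → Fin n) → Decidable (CycleMin σ)
cycleMin? σ i = FP.all? (λ m → i FP.≤? iter σ (toℕ m) i)

numCycles : {n : ℕ} → (Fin n → Fin n) → ℕ
numCycles σ = countFin (cycleMin? σ)

PermTuple : (t n k : ℕ) → Pred (Fin t → Fin n → Fin n) 0ℓ
PermTuple t n k σ =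
  (∀ a → IsPerm (σ a) × numCycles (σ a) ≡ k)
  × (∀ a b i → (CycleMin (σ a) i → CycleMin (σ b) i) × (CycleMin (σ b) i → CycleMin (σ a) i))

permTuple? : (t n k : ℕ) → Decidable (PermTuple t n k)
permTuple? t n k σ =
  FP.all? (λ a → isPerm? (σ a) ×-dec (numCycles (σ a) ℕ.≟ k))
  ×-dec FP.all? (λ a → FP.all? (λ b → FP.all? (λ i →
          (cycleMin? (σ a) i →-dec cycleMin? (σ b) i) ×-dec (cycleMin? (σ b) i →-dec cycleMin? (σ a) i))))

numPermTuples : (t n k : ℕ) → ℕ
numPermTuples t n k = countL (permTuple? t n k) (funs (funs (allFin n) n) t)

-- Stirling permutations and Stirling polynomials.
-- A tuple k = (k_1,…,k_N) is a list of length N; K = sum.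
-- A word σ(1)…σ(K) over {1,…,N} is a function Fin K → Fin N
-- (position p ↦ letter; letter j : Fin N stands for j+1, position p for p+1).

Word : List ℕ → Set
Word ks = Fin (sum ks) → Fin (length ks)

IsStirlingPerm : (ks : List ℕ) → Word ks → Set
IsStirlingPerm ks w =
  (∀ (j : Fin (length ks)) → countFin (λ p → w p FP.≟ j) ≡ lookup ks j)
  × (∀ i r j → i F.< r → r F.< j → w i ≡ w j → w i F.≤ w r)

isStirlingPerm? : (ks : List ℕ) → Decidable (IsStirlingPerm ks)
isStirlingPerm? ks w =
  FP.all? (λ j → countFin (λ p → w p FP.≟ j) ℕ.≟ lookup ks j)
  ×-dec FP.all? (λ i → FP.all? (λ r → FP.all? (λ j →
          (i FP.<? r) →-dec ((r FP.<? j) →-dec ((w i FP.≟ w j) →-dec (w i FP.≤? w r))))))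

Descent : (ks : List ℕ) → Word ks → Fin (sum ks) → Set
Descent ks w p =
  (suc (toℕ p) ≡ sum ks) ⊎ (∃ λ q → (toℕ q ≡ suc (toℕ p)) × (w q F.< w p))

descent? : (ks : List ℕ) (w : Word ks) → Decidable (Descent ks w)
descent? ks w p =
  (suc (toℕ p) ℕ.≟ sum ks) ⊎-dec FP.any? (λ q → (toℕ q ℕ.≟ suc (toℕ p)) ×-dec (w q FP.<? w p))

numDescents : (ks : List ℕ) → Word ks → ℕ
numDescents ks w = countFin (descent? ks w)

A : List ℕ → ℕ → ℕ
A ks i = countL (λ w → isStirlingPerm? ks w ×-dec (numDescents ks w ℕ.≟ i))
                (funs (allFin (length ks)) (sum ks))

-- coefficient of x^m in x^i / (1-x)^{K+1}
coefX : (K i m : ℕ) → ℕ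
coefX K i m = if i ≤ᵇ m then (m ∸ i + K) C K else 0

-- B_k(m): coefficient of x^m in (Σ_{i=1}^N A_{k,i} x^i) / (1-x)^{K+1}; B_∅ = 1
B : List ℕ → ℕ → ℕ
B []         m = 1
B ks@(_ ∷ _) m =
  sum (map (λ i → A ks i * coefX (sum ks) i m) (applyUpTo suc (length ks)))

-- b_k(m): coefficient of x^m in (Σ_{i=K-N+1}^{K} A_{k,K+1-i} x^i) / (1-x)^{K+1}; b_∅ = 1
b : List ℕ → ℕ → ℕ
b []         m = 1
b ks@(_ ∷ _) m =
  sum (map (λ i → A ks (sum ks + 1 ∸ i) * coefX (sum ks) i m)
           (applyUpTo (λ d → sum ks ∸ length ks + 1 + d) (length ks)))

tn : ℕ → ℕ → List ℕ
tn t n = concat (replicate n (replicate (t ∸ 1) 1 ++ [ 2 ]))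

-- Σ_{1 ≤ i_1 ≤ … ≤ i_n ≤ k} i_1^t ⋯ i_n^t ; f : Fin n → Fin k encodes i_j = f j + 1
WeakIncr : {n k : ℕ} → Pred (Fin n → Fin k) 0ℓ
WeakIncr f = ∀ a c → a F.≤ c → f a F.≤ f c

weakIncr? : {n k : ℕ} → Decidable (WeakIncr {n} {k})
weakIncr? f = FP.all? (λ a → FP.all? (λ c → (a FP.≤? c) →-dec (f a FP.≤? f c)))

weakSum : (t n k : ℕ) → ℕ
weakSum t n k =
  sum (map (λ f → product (map (λ j → suc (toℕ (f j)) ℕ.^ t) (allFin n)))
           (filter weakIncr? (funs (allFin k) n)))

-- Σ_{1 ≤ i_1 < … < i_k < n} i_1^t ⋯ i_k^t ; f : Fin k → Fin n encodes i_j = f j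
StrictIncrPos : {k n : ℕ} → Pred (Fin k → Fin n) 0ℓ
StrictIncrPos f = (∀ a → 1 ℕ.≤ toℕ (f a)) × (∀ a c → a F.< c → f a F.< f c)

strictIncrPos? : {k n : ℕ} → Decidable (StrictIncrPos {k} {n})
strictIncrPos? f =
  FP.all? (λ a → 1 ℕ.≤? toℕ (f a))
  ×-dec FP.all? (λ a → FP.all? (λ c → (a FP.<? c) →-dec (f a FP.<? f c)))

strictSum : (t n k : ℕ) → ℕ
strictSum t n k =
  sum (map (λ f → product (map (λ j → toℕ (f j) ℕ.^ t) (allFin k)))
           (filter strictIncrPos? (funs (allFin n) k)))

{-# OPTIONS --safe #-}

-- All quantities are symmetric polynomials of t-th powers: S_t(n,k) is the complete
-- homogeneous polynomial of degree n − k in 1ᵗ, …, kᵗ and s_t(n,n−k) the elementary one of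
-- degree k in 1ᵗ, …, (n−1)ᵗ.  For S_t this follows from the uniqueness of the defining
-- expansion, checked by evaluating at x = 0ᵗ, 1ᵗ, 2ᵗ, ….
-- A tuple of partitions (permutations) is counted according to the common set M of minima;
-- the t entries are then independent.  A partition with minima M sends every i ∉ M to one of the
-- smaller elements of M, and a permutation is built by inserting 1, 2, … in turn, where
-- i ∉ M is placed next to one of the smaller elements.
-- A Stirling permutation is built by inserting the copies of its largest letter as one block:
-- at a descent this keeps the number of descents, elsewhere it adds one.  On generating functions
-- this is x d/dx followed by a power of 1/(1−x), so that appending a 1 to the tuple multiplies
-- B(m) and b(m) by m, and appending a 2 gives B′(m) − B′(m−1) = m B(m) and b′(m+1) − b′(m) = m b(m).

module Submission where

open import Defs
open import Data.Nat as ℕ using (ℕ; zero; suc; _+_; _*_; _∸_; _≤_; _<_; z≤n; s≤s; _^_)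
import Data.Nat.Properties as ℕP
open import Data.Nat.Combinatorics using (_C_; nC1≡n; nCn≡1; nCk≡nC[n∸k]; nCk+nC[k+1]≡[n+1]C[k+1]; k>n⇒nCk≡0)
open import Data.Nat.DivMod using (_%_; _/_; m≡m%n+[m/n]*n; m%n<n)
open import Data.Nat.ListAction using (sum; product)
open import Data.Nat.ListAction.Properties using (sum-++)
open import Data.Nat.Tactic.RingSolver using (solve-∀)
open import Data.Integer as ℤ using (ℤ; -[1+_]; _-_)
import Data.Integer.Properties as ℤP
import Data.Integer.Tactic.RingSolver as ℤSolver
open import Data.Bool using (Bool; true; false; if_then_else_)
import Data.Bool.Properties as BoolP
open import Data.Fin as F using (Fin; zero; suc; toℕ; fromℕ; inject₁)
import Data.Fin.Properties as FP
open import Data.Fin.Relation.Unary.Top using (view; ‵fromℕ; ‵inject₁; view-fromℕ; view-inject₁)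
open import Data.List using (List; []; _∷_; [_]; map; concatMap; filter; length; lookup; allFin; tabulate; applyUpTo; upTo; replicate; _++_; cartesianProduct)
import Data.List.Properties as ListP
open import Data.List.Relation.Unary.All as All using (All; []; _∷_)
import Data.List.Relation.Unary.All.Properties as AllP
import Data.Vec.Functional as VF
open import Data.Product using (∃; ∃₂; _×_; _,_; proj₁; proj₂)
open import Data.Sum using (_⊎_; inj₁; inj₂; [_,_]′)
open import Data.Empty using (⊥)
open import Data.Unit using (⊤; tt)
open import Function using (_∘_; id)
open import Relation.Binary.Definitions using () renaming (Decidable to Decidable₂)
open import Relation.Binary.PropositionalEquality using (_≡_; _≢_; _≗_; refl; sym; trans; cong; cong₂; subst; subst₂; module ≡-Reasoning)
open import Relation.Nullary using (Dec; yes; no; does; ¬_; contradiction)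
open import Relation.Nullary.Decidable using (_×-dec_; _⊎-dec_; _→-dec_; ¬?)
open import Relation.Unary using (Decidable)
open ≡-Reasoning

-- The objects to be counted are functions, and without function extensionality two of them are only
-- ever known to agree pointwise. Lists of functions are therefore not compared through membership
-- or `≡`: every count is a sum of indicators, `Once` expresses by such a sum that a list hits each
-- class of a relation exactly once, and a bijection becomes an exchange of two sums. For the same
-- reason insertion into a permutation is described by a relation between functions. The symmetric
-- polynomials carry an offset `c` because two kinds of recursion meet. Reading a set or an
-- increasing sequence from its small end, or cancelling the first factor x - cᵗ, removes the first
-- variable and leaves the same problem from c + 1 on; the recurrences of `s`, `B` and `b` remove
-- the last variable. Both forms are proved, and their agreement is what connects the four
-- statements. For Stirling permutations the weight attached to the number of descents is left
-- arbitrary, so that one insertion identity serves `B`, `b` and their differences.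

private variable
  X Y P Q : Set
  n : ℕ

-- Finite sums, products and counting by indicators

ind : Dec P → ℕ
ind d = if does d then 1 else 0

∑ : List X → (X → ℕ) → ℕ
∑ xs f = sum (map f xs)

∏ : (Fin n → ℕ) → ℕ
∏ {zero}  f = 1
∏ {suc n} f = f zero * ∏ (f ∘ suc)

ind-cong : (P? : Dec P) (Q? : Dec Q) → (P → Q) → (Q → P) → ind P? ≡ ind Q?
ind-cong (yes p) (yes q) f g = refl
ind-cong (yes p) (no ¬q) f g = contradiction (f p) ¬q
ind-cong (no ¬p) (yes q) f g = contradiction (g q) ¬p
ind-cong (no ¬p) (no ¬q) f g = refl

ind-yes : (P? : Dec P) → P → ind P? ≡ 1
ind-yes (yes _) p = refl
ind-yes (no ¬p) p = contradiction p ¬p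

ind-no : (P? : Dec P) → ¬ P → ind P? ≡ 0
ind-no (yes p) ¬p = contradiction p ¬p
ind-no (no _)  ¬p = refl

ind≤1 : (P? : Dec P) → ind P? ≤ 1
ind≤1 (yes _) = s≤s z≤n
ind≤1 (no _)  = z≤n

ind-× : (P? : Dec P) (Q? : Dec Q) → ind (P? ×-dec Q?) ≡ ind P? * ind Q?
ind-× (yes _) (yes _) = refl
ind-× (yes _) (no _)  = refl
ind-× (no _)  _       = refl

ind-*-cong : (P? : Dec P) {x y : ℕ} → (P → x ≡ y) → ind P? * x ≡ ind P? * y
ind-*-cong (yes p) h = cong (_+ 0) (h p)
ind-*-cong (no _)  h = refl

∏-cong : {f g : Fin n → ℕ} → f ≗ g → ∏ f ≡ ∏ g
∏-cong {zero}  f≗g = refl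
∏-cong {suc n} f≗g = cong₂ _*_ (f≗g zero) (∏-cong (f≗g ∘ suc))

∏-const : ∀ n (c : ℕ) → ∏ {n} (λ _ → c) ≡ c ^ n
∏-const zero    c = refl
∏-const (suc n) c = cong (c *_) (∏-const n c)

^-distribʳ-* : ∀ t a b → (a * b) ^ t ≡ a ^ t * b ^ t
^-distribʳ-* zero    a b = refl
^-distribʳ-* (suc t) a b = trans (cong (a * b *_) (^-distribʳ-* t a b)) (interchange a b (a ^ t) (b ^ t))
  where
  interchange : ∀ a b c d → (a * b) * (c * d) ≡ (a * c) * (b * d)
  interchange = solve-∀

∏-^ : (f : Fin n → ℕ) (t : ℕ) → ∏ f ^ t ≡ ∏ (λ i → f i ^ t)
∏-^ {zero}  f t = ℕP.^-zeroˡ t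
∏-^ {suc n} f t = trans (^-distribʳ-* t (f zero) (∏ (f ∘ suc))) (cong (f zero ^ t *_) (∏-^ (f ∘ suc) t))

∏-last : (f : Fin (suc n) → ℕ) → ∏ f ≡ ∏ (f ∘ inject₁) * f (fromℕ n)
∏-last {zero}  f = ℕP.*-comm (f zero) 1
∏-last {suc n} f = trans (cong (f zero *_) (∏-last (f ∘ suc))) (sym (ℕP.*-assoc (f zero) _ _))

ind-all : {P : Fin n → Set} (P? : ∀ i → Dec (P i)) → ind (FP.all? P?) ≡ ∏ (λ i → ind (P? i))
ind-all {zero}  P? = ind-yes (FP.all? P?) λ ()
ind-all {suc n} P? = begin
  ind (FP.all? P?)
    ≡⟨ ind-cong (FP.all? P?) (P? zero ×-dec FP.all? (P? ∘ suc))
         (λ p → p zero , p ∘ suc) (λ { (p , q) → λ { zero → p ; (suc i) → q i } }) ⟩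
  ind (P? zero ×-dec FP.all? (P? ∘ suc))  ≡⟨ ind-× (P? zero) (FP.all? (P? ∘ suc)) ⟩
  ind (P? zero) * ind (FP.all? (P? ∘ suc)) ≡⟨ cong (ind (P? zero) *_) (ind-all (P? ∘ suc)) ⟩
  ∏ (λ i → ind (P? i)) ∎

∑-cong : {f g : X → ℕ} → f ≗ g → ∀ xs → ∑ xs f ≡ ∑ xs g
∑-cong f≗g xs = cong sum (ListP.map-cong f≗g xs)

∑-cong-All : {f g : X → ℕ} {xs : List X} → All (λ x → f x ≡ g x) xs → ∑ xs f ≡ ∑ xs g
∑-cong-All []       = refl
∑-cong-All (e ∷ es) = cong₂ _+_ e (∑-cong-All es)

∑-map : (h : X → Y) (xs : List X) (f : Y → ℕ) → ∑ (map h xs) f ≡ ∑ xs (f ∘ h)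
∑-map h xs f = cong sum (sym (ListP.map-∘ xs))

∑-++ : (xs ys : List X) (f : X → ℕ) → ∑ (xs ++ ys) f ≡ ∑ xs f + ∑ ys f
∑-++ xs ys f = trans (cong sum (ListP.map-++ f xs ys)) (sum-++ (map f xs) (map f ys))

∑-concatMap : (h : X → List Y) (xs : List X) (f : Y → ℕ) → ∑ (concatMap h xs) f ≡ ∑ xs (λ x → ∑ (h x) f)
∑-concatMap h []       f = refl
∑-concatMap h (x ∷ xs) f = trans (∑-++ (h x) (concatMap h xs) f) (cong (_ +_) (∑-concatMap h xs f))

∑-cartesianProduct : (xs : List X) (ys : List Y) (f : X × Y → ℕ) →
  ∑ (cartesianProduct xs ys) f ≡ ∑ xs (λ x → ∑ ys (λ y → f (x , y)))
∑-cartesianProduct []       ys f = refl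
∑-cartesianProduct (x ∷ xs) ys f = trans (∑-++ (map (x ,_) ys) _ f)
  (cong₂ _+_ (∑-map (x ,_) ys f) (∑-cartesianProduct xs ys f))

∑-zero : (xs : List X) → ∑ xs (λ _ → 0) ≡ 0
∑-zero []       = refl
∑-zero (x ∷ xs) = ∑-zero xs

∑-+ : (xs : List X) (f g : X → ℕ) → ∑ xs (λ x → f x + g x) ≡ ∑ xs f + ∑ xs g
∑-+ []       f g = refl
∑-+ (x ∷ xs) f g = trans (cong (f x + g x +_) (∑-+ xs f g)) (interchange (f x) (g x) _ _)
  where
  interchange : ∀ a b c d → (a + b) + (c + d) ≡ (a + c) + (b + d)
  interchange = solve-∀

∑-*ˡ : (c : ℕ) (xs : List X) (f : X → ℕ) → ∑ xs (λ x → c * f x) ≡ c * ∑ xs f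
∑-*ˡ c []       f = sym (ℕP.*-zeroʳ c)
∑-*ˡ c (x ∷ xs) f = trans (cong (c * f x +_) (∑-*ˡ c xs f)) (sym (ℕP.*-distribˡ-+ c (f x) _))

∑-*ʳ : (c : ℕ) (xs : List X) (f : X → ℕ) → ∑ xs (λ x → f x * c) ≡ ∑ xs f * c
∑-*ʳ c xs f = trans (∑-cong (λ x → ℕP.*-comm (f x) c) xs) (trans (∑-*ˡ c xs f) (ℕP.*-comm c _))

∑-swap : (xs : List X) (ys : List Y) (f : X → Y → ℕ) →
  ∑ xs (λ x → ∑ ys (f x)) ≡ ∑ ys (λ y → ∑ xs (λ x → f x y))
∑-swap []       ys f = sym (∑-zero ys)
∑-swap (x ∷ xs) ys f = trans (cong (∑ ys (f x) +_) (∑-swap xs ys f)) (sym (∑-+ ys (f x) _))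

countL-∑ : {P : X → Set} (P? : Decidable P) (xs : List X) → countL P? xs ≡ ∑ xs (λ x → ind (P? x))
countL-∑ P? []       = refl
countL-∑ P? (x ∷ xs) with P? x
... | yes _ = cong suc (countL-∑ P? xs)
... | no  _ = countL-∑ P? xs

∑-filter : {P : X → Set} (P? : Decidable P) (xs : List X) (f : X → ℕ) →
  ∑ (filter P? xs) f ≡ ∑ xs (λ x → ind (P? x) * f x)
∑-filter P? []       f = refl
∑-filter P? (x ∷ xs) f with P? x
... | yes _ = cong₂ _+_ (sym (ℕP.+-identityʳ (f x))) (∑-filter P? xs f)
... | no  _ = ∑-filter P? xs f

∑-allFin-suc : (f : Fin (suc n) → ℕ) → ∑ (allFin (suc n)) f ≡ f zero + ∑ (allFin n) (f ∘ suc)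
∑-allFin-suc {n} f = cong (λ l → f zero + sum l)
  (trans (ListP.map-tabulate suc f) (sym (ListP.map-tabulate id (f ∘ suc))))

-- `funs` builds its entries by a pattern-matching lambda that agrees with `a VF.∷ f` only
-- pointwise, hence the assumption that `G` respects pointwise equality.
∑-funs-suc : (as : List X) (G : (Fin (suc n) → X) → ℕ) → (∀ {f g} → f ≗ g → G f ≡ G g) →
  ∑ (funs as (suc n)) G ≡ ∑ as (λ a → ∑ (funs as n) (λ f → G (a VF.∷ f)))
∑-funs-suc {n = n} as G ext = trans (∑-concatMap _ as G) (∑-cong (λ a →
  trans (∑-map _ (funs as n) G) (∑-cong (λ f → ext λ { zero → refl ; (suc i) → refl }) (funs as n))) as)

-- The distributive law: expanding a product of sums chooses one summand from each factor. Through
-- it a tuple of independent objects yields a power, and independent choices of block minima yield a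
-- product.
∑-funs-∏ : (as : List X) (w : Fin n → X → ℕ) →
  ∑ (funs as n) (λ f → ∏ (λ i → w i (f i))) ≡ ∏ (λ i → ∑ as (w i))
∑-funs-∏ {n = zero}  as w = refl
∑-funs-∏ {n = suc n} as w = begin
  ∑ (funs as (suc n)) (λ f → ∏ (λ i → w i (f i)))
    ≡⟨ ∑-funs-suc as _ (λ f≗g → ∏-cong (λ i → cong (w i) (f≗g i))) ⟩
  ∑ as (λ a → ∑ (funs as n) (λ f → w zero a * ∏ (λ i → w (suc i) (f i))))
    ≡⟨ ∑-cong (λ a → ∑-*ˡ (w zero a) (funs as n) _) as ⟩
  ∑ as (λ a → w zero a * ∑ (funs as n) (λ f → ∏ (λ i → w (suc i) (f i))))
    ≡⟨ ∑-*ʳ _ as (w zero) ⟩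
  ∑ as (w zero) * ∑ (funs as n) (λ f → ∏ (λ i → w (suc i) (f i)))
    ≡⟨ cong (∑ as (w zero) *_) (∑-funs-∏ as (w ∘ suc)) ⟩
  ∏ (λ i → ∑ as (w i)) ∎

-- Existence and uniqueness of an entry related to `z` in a single equation; being a sum, it can be
-- used directly as a factor 1 in a double count.
Once : {_~_ : X → X → Set} → Decidable₂ _~_ → List X → Set
Once _~?_ xs = ∀ z → ∑ xs (λ x → ind (x ~? z)) ≡ 1

once-allFin : ∀ n → Once FP._≟_ (allFin n)
once-allFin (suc n) zero    = trans (∑-allFin-suc {n} (λ x → ind (x FP.≟ zero)))
  (cong suc (∑-zero (allFin n)))
once-allFin (suc n) (suc z) = trans (∑-allFin-suc (λ x → ind (x FP.≟ suc z))) (trans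
  (∑-cong (λ x → ind-cong (suc x FP.≟ suc z) (x FP.≟ z) FP.suc-injective (cong suc)) (allFin n))
  (once-allFin n z))

once-bool : Once BoolP._≟_ (true ∷ false ∷ [])
once-bool true  = refl
once-bool false = refl

once-funs : {_~_ : X → X → Set} (_~?_ : Decidable₂ _~_) (as : List X) → Once _~?_ as → ∀ n →
  Once {X = Fin n → X} (λ f g → FP.all? (λ i → f i ~? g i)) (funs as n)
once-funs _~?_ as once n z = begin
  ∑ (funs as n) (λ f → ind (FP.all? (λ i → f i ~? z i)))
    ≡⟨ ∑-cong (λ f → ind-all (λ i → f i ~? z i)) (funs as n) ⟩
  ∑ (funs as n) (λ f → ∏ (λ i → ind (f i ~? z i)))
    ≡⟨ ∑-funs-∏ as (λ i a → ind (a ~? z i)) ⟩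
  ∏ (λ i → ∑ as (λ a → ind (a ~? z i)))
    ≡⟨ ∏-cong (λ i → once (z i)) ⟩
  ∏ {n} (λ i → 1) ≡⟨ trans (∏-const n 1) (ℕP.^-zeroˡ n) ⟩
  1 ∎

once-× : {_~_ : X → X → Set} (_~?_ : Decidable₂ _~_) {_≈_ : Y → Y → Set} (_≈?_ : Decidable₂ _≈_) →
  (xs : List X) (ys : List Y) → Once _~?_ xs → Once _≈?_ ys →
  Once {X = X × Y} (λ p q → (proj₁ p ~? proj₁ q) ×-dec (proj₂ p ≈? proj₂ q)) (cartesianProduct xs ys)
once-× _~?_ _≈?_ xs ys oncex oncey (z , w) = begin
  ∑ (cartesianProduct xs ys) F
    ≡⟨ ∑-cartesianProduct xs ys F ⟩
  ∑ xs (λ x → ∑ ys (λ y → F (x , y)))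
    ≡⟨ ∑-cong (λ x → ∑-cong (λ y → ind-× (x ~? z) (y ≈? w)) ys) xs ⟩
  ∑ xs (λ x → ∑ ys (λ y → ind (x ~? z) * ind (y ≈? w)))
    ≡⟨ ∑-cong (λ x → trans (∑-*ˡ (ind (x ~? z)) ys _) (trans (cong (ind (x ~? z) *_) (oncey w)) (ℕP.*-identityʳ _))) xs ⟩
  ∑ xs (λ x → ind (x ~? z))
    ≡⟨ oncex z ⟩
  1 ∎
  where
  F : _ → ℕ
  F p = ind ((proj₁ p ~? z) ×-dec (proj₂ p ≈? w))

-- Double counting of the pairs (x , y) with ψ y ~ x.
∑-bijection : {_~_ : X → X → Set} (_~?_ : Decidable₂ _~_) {_≈_ : Y → Y → Set} (_≈?_ : Decidable₂ _≈_)
  (xs : List X) (ys : List Y) → Once _~?_ xs → Once _≈?_ ys →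
  {P : X → Set} (P? : Decidable P) {Q : Y → Set} (Q? : Decidable Q) (ψ : Y → X) →
  (∀ {x y} → ψ y ~ x → x ~ ψ y) → (∀ {x y} → x ~ ψ y → ψ y ~ x) →
  (∀ {x y} → Q y → x ~ ψ y → P x) →
  (∀ {x} → P x → ∃ λ y₀ → ∀ y → (Q y → ψ y ~ x → y ≈ y₀) × (y ≈ y₀ → Q y × ψ y ~ x)) →
  ∑ xs (λ x → ind (P? x)) ≡ ∑ ys (λ y → ind (Q? y))
∑-bijection _~?_ _≈?_ xs ys oncex oncey P? Q? ψ sy sy′ Q⇒P inv = begin
  ∑ xs (λ x → ind (P? x))
    ≡⟨ ∑-cong left xs ⟩
  ∑ xs (λ x → ∑ ys (λ y → ind (Q? y) * ind (x ~? ψ y)))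
    ≡⟨ ∑-swap xs ys _ ⟩
  ∑ ys (λ y → ∑ xs (λ x → ind (Q? y) * ind (x ~? ψ y)))
    ≡⟨ ∑-cong (λ y → trans (∑-*ˡ (ind (Q? y)) xs _) (trans (cong (ind (Q? y) *_) (oncex (ψ y))) (ℕP.*-identityʳ _))) ys ⟩
  ∑ ys (λ y → ind (Q? y)) ∎
  where
  left : ∀ x → ind (P? x) ≡ ∑ ys (λ y → ind (Q? y) * ind (x ~? ψ y))
  left x with P? x
  -- Up to `≈` exactly one `y` satisfies both conditions, and `oncey` says that it occurs once in
  -- `ys`.
  ... | yes p = sym (trans (∑-cong (λ y → trans (sym (ind-× (Q? y) (x ~? ψ y)))
                  (ind-cong (Q? y ×-dec (x ~? ψ y)) (y ≈? proj₁ (inv p))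
                    (λ { (q , e) → proj₁ (proj₂ (inv p) y) q (sy′ e) })
                    (λ e → let (q , e′) = proj₂ (proj₂ (inv p) y) e in q , sy e′))) ys)
                (oncey (proj₁ (inv p))))
  ... | no ¬p = sym (trans (∑-cong (λ y → trans (sym (ind-× (Q? y) (x ~? ψ y)))
                  (ind-no (Q? y ×-dec (x ~? ψ y)) (λ { (q , e) → ¬p (Q⇒P q e) }))) ys)
                (∑-zero ys))

-- Symmetric polynomials of t-th powers

-- hom t c n k is the complete homogeneous symmetric polynomial of degree n − k in
-- cᵗ, (c+1)ᵗ, …, (c+k)ᵗ; elem t c n k and elemDeg t c n j are the elementary ones of
-- degrees n − k and j in cᵗ, (c+1)ᵗ, …, (c+n−1)ᵗ.
hom : (t c n k : ℕ) → ℕ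
hom t c zero    zero    = 1
hom t c zero    (suc k) = 0
hom t c (suc n) zero    = c ^ t * hom t c n zero
hom t c (suc n) (suc k) = hom t (suc c) n k + c ^ t * hom t c n (suc k)

elem : (t c n k : ℕ) → ℕ
elem t c zero    zero    = 1
elem t c zero    (suc k) = 0
elem t c (suc n) zero    = c ^ t * elem t (suc c) n zero
elem t c (suc n) (suc k) = elem t (suc c) n k + c ^ t * elem t (suc c) n (suc k)

elemDeg : (t c n j : ℕ) → ℕ
elemDeg t c n       zero    = 1
elemDeg t c zero    (suc j) = 0
elemDeg t c (suc n) (suc j) = elemDeg t (suc c) n (suc j) + c ^ t * elemDeg t (suc c) n j

private
  exchange₁ : ∀ x y a b d → y * a + x * (b + y * d) ≡ x * b + y * (a + x * d)
  exchange₁ = solve-∀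

  exchange₂ : ∀ x y a b d e → (a + y * b) + x * (d + y * e) ≡ (a + x * d) + y * (b + x * e)
  exchange₂ = solve-∀

-- The definition splits off the first variable, this identity the last one. Induction goes through
-- because splitting off both gives the same terms in either order (`exchange₂`). This form matches
-- the recurrence of `B` in its argument; `elem-last` and `elemDeg-last` do the same for `s` and
-- `b`.
hom-last : ∀ t c n k → hom t c (suc n) (suc k) ≡ hom t c n k + (c + suc k) ^ t * hom t c n (suc k)
hom-last t c zero zero = cong suc (trans (ℕP.*-zeroʳ (c ^ t)) (sym (ℕP.*-zeroʳ ((c + 1) ^ t))))
hom-last t c zero (suc k) = trans (ℕP.*-zeroʳ (c ^ t)) (sym (ℕP.*-zeroʳ ((c + suc (suc k)) ^ t)))
hom-last t c (suc n) zero rewrite ℕP.+-comm c 1 = trans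
  (cong (λ z → suc c ^ t * hom t (suc c) n 0 + c ^ t * z)
    (trans (hom-last t c n 0) (cong (λ z → hom t c n 0 + z ^ t * hom t c n 1) (ℕP.+-comm c 1))))
  (exchange₁ (c ^ t) (suc c ^ t) (hom t (suc c) n 0) (hom t c n 0) (hom t c n 1))
hom-last t c (suc n) (suc k) rewrite ℕP.+-suc c (suc k) = trans
  (cong₂ (λ y z → y + c ^ t * z) (hom-last t (suc c) n k)
    (trans (hom-last t c n (suc k)) (cong (λ z → hom t c n (suc k) + z ^ t * hom t c n (suc (suc k))) (ℕP.+-suc c (suc k)))))
  (exchange₂ (c ^ t) (suc (c + suc k) ^ t) (hom t (suc c) n k) (hom t (suc c) n (suc k)) (hom t c n (suc k)) (hom t c n (suc (suc k))))

elem-last₀ : ∀ t c n → elem t c (suc n) 0 ≡ (c + n) ^ t * elem t c n 0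
elem-last₀ t c zero    rewrite ℕP.+-identityʳ c = refl
elem-last₀ t c (suc n) rewrite elem-last₀ t (suc c) n | ℕP.+-suc c n =
  exchange (c ^ t) (suc (c + n) ^ t) (elem t (suc c) n 0)
  where
  exchange : ∀ x y a → x * (y * a) ≡ y * (x * a)
  exchange = solve-∀

elem-last : ∀ t c n k → elem t c (suc n) (suc k) ≡ elem t c n k + (c + n) ^ t * elem t c n (suc k)
elem-last t c zero k rewrite ℕP.+-identityʳ c with k
... | zero  = refl
... | suc _ = refl
elem-last t c (suc n) zero
  rewrite elem-last₀ t (suc c) n | elem-last t (suc c) n zero | ℕP.+-suc c n =
  exchange₁ (c ^ t) (suc (c + n) ^ t) (elem t (suc c) n 0) (elem t (suc c) n 0) (elem t (suc c) n 1)
elem-last t c (suc n) (suc k)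
  rewrite elem-last t (suc c) n k | elem-last t (suc c) n (suc k) | ℕP.+-suc c n =
  exchange₂ (c ^ t) (suc (c + n) ^ t) (elem t (suc c) n k) (elem t (suc c) n (suc k)) (elem t (suc c) n (suc k)) (elem t (suc c) n (suc (suc k)))

elemDeg-last : ∀ t c n j → elemDeg t c (suc n) (suc j) ≡ elemDeg t c n (suc j) + (c + n) ^ t * elemDeg t c n j
elemDeg-last t c zero zero rewrite ℕP.+-identityʳ c = refl
elemDeg-last t c zero (suc j) rewrite ℕP.+-identityʳ c = refl
elemDeg-last t c (suc n) zero
  rewrite elemDeg-last t (suc c) n zero | ℕP.+-suc c n =
  exchange (elemDeg t (suc c) n 1) (c ^ t) (suc (c + n) ^ t)
  where
  exchange : ∀ a x y → (a + y * 1) + x * 1 ≡ (a + x * 1) + y * 1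
  exchange = solve-∀
elemDeg-last t c (suc n) (suc j)
  rewrite elemDeg-last t (suc c) n (suc j) | elemDeg-last t (suc c) n j | ℕP.+-suc c n =
  exchange₂ (c ^ t) (suc (c + n) ^ t) (elemDeg t (suc c) n (suc (suc j))) (elemDeg t (suc c) n (suc j)) (elemDeg t (suc c) n (suc j)) (elemDeg t (suc c) n j)

coeff-addP : ∀ p q k → coeff (addP p q) k ≡ coeff p k + coeff q k
coeff-addP []      q       k       = refl
coeff-addP (a ∷ p) []      k       = sym (ℕP.+-identityʳ _)
coeff-addP (a ∷ p) (b ∷ q) zero    = refl
coeff-addP (a ∷ p) (b ∷ q) (suc k) = coeff-addP p q k

coeff-scale : ∀ c p k → coeff (map (c *_) p) k ≡ c * coeff p k
coeff-scale c []      k       = sym (ℕP.*-zeroʳ c)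
coeff-scale c (a ∷ p) zero    = refl
coeff-scale c (a ∷ p) (suc k) = coeff-scale c p k

coeff-mulLin : ∀ c p k → coeff (mulLin c p) k ≡ c * coeff p k + coeff (0 ∷ p) k
coeff-mulLin c p k = trans (coeff-addP (map (c *_) p) (0 ∷ p) k) (cong (_+ coeff (0 ∷ p) k) (coeff-scale c p k))

s-zero : ∀ t n → s t (suc n) 0 ≡ n ^ t * s t n 0
s-zero t n = trans (coeff-mulLin (n ^ t) (risingPoly t n) 0) (ℕP.+-identityʳ _)

s-suc : ∀ t n k → s t (suc n) (suc k) ≡ s t n k + n ^ t * s t n (suc k)
s-suc t n k = trans (coeff-mulLin (n ^ t) (risingPoly t n) (suc k)) (ℕP.+-comm (n ^ t * s t n (suc k)) _)

s-elem : ∀ t n k → s t n k ≡ elem t 0 n k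
s-elem t zero    zero    = refl
s-elem t zero    (suc k) = refl
s-elem t (suc n) zero    = trans (s-zero t n) (trans (cong (n ^ t *_) (s-elem t n 0)) (sym (elem-last₀ t 0 n)))
s-elem t (suc n) (suc k) = trans (s-suc t n k)
  (trans (cong₂ (λ a b → a + n ^ t * b) (s-elem t n k) (s-elem t n (suc k))) (sym (elem-last t 0 n k)))

0^ : ∀ t → 1 ≤ t → 0 ^ t ≡ 0
0^ (suc t) _ = refl

-- Since t ≥ 1 the variable 0ᵗ is 0 and drops out. This reconciles expansions whose nodes start at 0
-- with sums whose indices start at 1.
hom-shift : ∀ t → 1 ≤ t → ∀ n k → hom t 0 (suc n) (suc k) ≡ hom t 1 n k
hom-shift t 1≤t n k = trans (cong (λ z → hom t 1 n k + z * hom t 0 n (suc k)) (0^ t 1≤t)) (ℕP.+-identityʳ _)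

elemDeg-shift : ∀ t → 1 ≤ t → ∀ n j → elemDeg t 0 (suc n) j ≡ elemDeg t 1 n j
elemDeg-shift t 1≤t n zero    = refl
elemDeg-shift t 1≤t n (suc j) = trans (cong (λ z → elemDeg t 1 n (suc j) + z * elemDeg t 1 n j) (0^ t 1≤t)) (ℕP.+-identityʳ _)

hom-below : ∀ t c {n k} → n < k → hom t c n k ≡ 0
hom-below t c {zero}  {suc k} _         = refl
hom-below t c {suc n} {suc k} (s≤s n<k) = trans
  (cong₂ (λ a b → a + c ^ t * b) (hom-below t (suc c) n<k) (hom-below t c (ℕP.m<n⇒m<1+n n<k)))
  (ℕP.*-zeroʳ (c ^ t))

hom-diag : ∀ t c n → hom t c n n ≡ 1
hom-diag t c zero    = refl
hom-diag t c (suc n) = trans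
  (cong₂ (λ a b → a + c ^ t * b) (hom-diag t (suc c) n) (hom-below t c (ℕP.n<1+n n)))
  (cong suc (ℕP.*-zeroʳ (c ^ t)))

-- Tuples with a common special set

bools : List Bool
bools = true ∷ false ∷ []

size : (Fin n → Bool) → ℕ
size {zero}  M = 0
size {suc n} M = (if M zero then 1 else 0) + size (M ∘ suc)

below : (Fin n → Bool) → Fin n → ℕ
below M zero    = 0
below M (suc i) = (if M zero then 1 else 0) + below (M ∘ suc) i

size-cong : {M N : Fin n → Bool} → M ≗ N → size M ≡ size N
size-cong {zero}  M≗N = refl
size-cong {suc n} M≗N = cong₂ (λ b m → (if b then 1 else 0) + m) (M≗N zero) (size-cong (M≗N ∘ suc))

below-cong : {M N : Fin n → Bool} → M ≗ N → below M ≗ below N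
below-cong M≗N zero    = refl
below-cong M≗N (suc i) = cong₂ (λ b m → (if b then 1 else 0) + m) (M≗N zero) (below-cong (M≗N ∘ suc) i)

size-count : {P : Fin n → Set} (P? : Decidable P) (M : Fin n → Bool) → (∀ i → M i ≡ does (P? i)) →
  countFin P? ≡ size M
size-count {n} P? M M≗P = trans (countL-∑ P? (allFin n)) (go P? M M≗P)
  where
  go : ∀ {n} {P : Fin n → Set} (P? : Decidable P) (M : Fin n → Bool) → (∀ i → M i ≡ does (P? i)) →
    ∑ (allFin n) (λ i → ind (P? i)) ≡ size M
  go {zero}  P? M M≗P = refl
  go {suc n} P? M M≗P = trans (∑-allFin-suc (λ i → ind (P? i)))
    (cong₂ (λ b m → (if b then 1 else 0) + m) (sym (M≗P zero)) (go (P? ∘ suc) (M ∘ suc) (M≗P ∘ suc)))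

-- Here `c` counts the members of the set that were already passed. If the first position belongs to
-- `M`, the offset rises by one; if not, it contributes cᵗ and the offset stays. These are the two
-- terms in the recursion of `hom`.
∑-subsets-below : ∀ t c n k →
  ∑ (funs bools n) (λ M → ind (size M ℕ.≟ k) * ∏ (λ i → (if M i then 1 else (c + below M i)) ^ t)) ≡ hom t c n k
∑-subsets-below t c zero    zero    = refl
∑-subsets-below t c zero    (suc k) = refl
∑-subsets-below t c (suc n) k = begin
  ∑ (funs bools (suc n)) (G k)
    ≡⟨ ∑-funs-suc bools (G k) (λ M≗N → cong₂ (λ a b → ind (a ℕ.≟ k) * b) (size-cong M≗N)
         (∏-cong (λ i → cong₂ (λ b m → (if b then 1 else (c + m)) ^ t) (M≗N i) (below-cong M≗N i)))) ⟩
  ∑ (funs bools n) (λ M → G k (true VF.∷ M)) + (∑ (funs bools n) (λ M → G k (false VF.∷ M)) + 0)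
    ≡⟨ cong (∑ (funs bools n) (λ M → G k (true VF.∷ M)) +_) (trans (ℕP.+-identityʳ _) (falsePart k)) ⟩
  ∑ (funs bools n) (λ M → G k (true VF.∷ M)) + c ^ t * hom t c n k
    ≡⟨ truePart k ⟩
  hom t c (suc n) k ∎
  where
  W : ∀ {n} → ℕ → (Fin n → Bool) → Fin n → ℕ
  W c M i = (if M i then 1 else (c + below M i)) ^ t
  G : ℕ → (Fin (suc n) → Bool) → ℕ
  G k M = ind (size M ℕ.≟ k) * ∏ (W c M)
  exch : ∀ a b d → a * (b * d) ≡ b * (a * d)
  exch = solve-∀
  falsePart : ∀ k → ∑ (funs bools n) (λ M → G k (false VF.∷ M)) ≡ c ^ t * hom t c n k
  falsePart k = begin
    ∑ (funs bools n) (λ M → ind (size M ℕ.≟ k) * ((c + 0) ^ t * ∏ (W c M)))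
      ≡⟨ ∑-cong (λ M → trans (exch (ind (size M ℕ.≟ k)) ((c + 0) ^ t) _) (cong (λ z → z ^ t * (ind (size M ℕ.≟ k) * ∏ (W c M))) (ℕP.+-identityʳ c))) (funs bools n) ⟩
    ∑ (funs bools n) (λ M → c ^ t * (ind (size M ℕ.≟ k) * ∏ (W c M)))
      ≡⟨ ∑-*ˡ (c ^ t) (funs bools n) _ ⟩
    c ^ t * ∑ (funs bools n) (λ M → ind (size M ℕ.≟ k) * ∏ (W c M))
      ≡⟨ cong (c ^ t *_) (∑-subsets-below t c n k) ⟩
    c ^ t * hom t c n k ∎
  truePart : ∀ k → ∑ (funs bools n) (λ M → G k (true VF.∷ M)) + c ^ t * hom t c n k ≡ hom t c (suc n) k
  truePart zero    = cong (_+ c ^ t * hom t c n 0) (∑-zero (funs bools n))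
  truePart (suc k) = cong (_+ c ^ t * hom t c n (suc k)) (trans
    (∑-cong (λ M → cong (ind (size M ℕ.≟ k) *_) (trans (cong₂ _*_ (ℕP.^-zeroˡ t)
      (∏-cong (λ i → cong (λ z → (if M i then 1 else z) ^ t) (ℕP.+-suc c (below M i))))) (ℕP.*-identityˡ _))) (funs bools n))
    (∑-subsets-below t (suc c) n k))

-- In contrast to `∑-subsets-below` the offset rises at every position, so each variable occurs at
-- most once, namely when its position lies outside `M`: an elementary polynomial of degree n - k.
∑-subsets-index : ∀ t c n k →
  ∑ (funs bools n) (λ M → ind (size M ℕ.≟ k) * ∏ (λ i → (if M i then 1 else (c + toℕ i)) ^ t)) ≡ elem t c n k
∑-subsets-index t c zero    zero    = refl
∑-subsets-index t c zero    (suc k) = refl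
∑-subsets-index t c (suc n) k = begin
  ∑ (funs bools (suc n)) (G k)
    ≡⟨ ∑-funs-suc bools (G k) (λ M≗N → cong₂ (λ a b → ind (a ℕ.≟ k) * b) (size-cong M≗N)
         (∏-cong (λ i → cong (λ b → (if b then 1 else (c + toℕ i)) ^ t) (M≗N i)))) ⟩
  ∑ (funs bools n) (λ M → G k (true VF.∷ M)) + (∑ (funs bools n) (λ M → G k (false VF.∷ M)) + 0)
    ≡⟨ cong (∑ (funs bools n) (λ M → G k (true VF.∷ M)) +_) (trans (ℕP.+-identityʳ _) (falsePart k)) ⟩
  ∑ (funs bools n) (λ M → G k (true VF.∷ M)) + c ^ t * elem t (suc c) n k
    ≡⟨ truePart k ⟩
  elem t c (suc n) k ∎
  where
  W : ∀ {n} → ℕ → (Fin n → Bool) → Fin n → ℕ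
  W c M i = (if M i then 1 else (c + toℕ i)) ^ t
  G : ℕ → (Fin (suc n) → Bool) → ℕ
  G k M = ind (size M ℕ.≟ k) * ∏ (W c M)
  exch : ∀ a b d → a * (b * d) ≡ b * (a * d)
  exch = solve-∀
  shift : (M : Fin n → Bool) → ∏ (λ i → (if M i then 1 else (c + suc (toℕ i))) ^ t) ≡ ∏ (W (suc c) M)
  shift M = ∏-cong (λ i → cong (λ z → (if M i then 1 else z) ^ t) (ℕP.+-suc c (toℕ i)))
  falsePart : ∀ k → ∑ (funs bools n) (λ M → G k (false VF.∷ M)) ≡ c ^ t * elem t (suc c) n k
  falsePart k = begin
    ∑ (funs bools n) (λ M → G k (false VF.∷ M))
      ≡⟨ ∑-cong (λ M → trans (exch (ind (size M ℕ.≟ k)) ((c + 0) ^ t) _)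
           (cong₂ (λ z w → z ^ t * (ind (size M ℕ.≟ k) * w)) (ℕP.+-identityʳ c) (shift M))) (funs bools n) ⟩
    ∑ (funs bools n) (λ M → c ^ t * (ind (size M ℕ.≟ k) * ∏ (W (suc c) M)))
      ≡⟨ ∑-*ˡ (c ^ t) (funs bools n) _ ⟩
    c ^ t * ∑ (funs bools n) (λ M → ind (size M ℕ.≟ k) * ∏ (W (suc c) M))
      ≡⟨ cong (c ^ t *_) (∑-subsets-index t (suc c) n k) ⟩
    c ^ t * elem t (suc c) n k ∎
  truePart : ∀ k → ∑ (funs bools n) (λ M → G k (true VF.∷ M)) + c ^ t * elem t (suc c) n k ≡ elem t c (suc n) k
  truePart zero    = cong (_+ c ^ t * elem t (suc c) n 0) (∑-zero (funs bools n))
  truePart (suc k) = cong (_+ c ^ t * elem t (suc c) n (suc k)) (trans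
    (∑-cong (λ M → cong (ind (size M ℕ.≟ k) *_) (trans (cong₂ _*_ (ℕP.^-zeroˡ t) (shift M)) (ℕP.*-identityˡ _))) (funs bools n))
    (∑-subsets-index t (suc c) n k))

IsIndicator : (Fin n → Set) → (Fin n → Bool) → Set
IsIndicator P M = ∀ i → (P i → M i ≡ true) × (M i ≡ true → P i)

isIndicator? : {P : Fin n → Set} → Decidable P → Decidable (IsIndicator P)
isIndicator? P? M = FP.all? λ i → (P? i →-dec (M i BoolP.≟ true)) ×-dec ((M i BoolP.≟ true) →-dec P? i)

indicator⇒does : {P : Fin n → Set} (P? : Decidable P) {M : Fin n → Bool} → IsIndicator P M → ∀ i → M i ≡ does (P? i)
indicator⇒does P? {M} h i with P? i | M i in eq
... | yes p | true  = refl
... | yes p | false = trans (sym eq) (proj₁ (h i) p)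
... | no ¬p | true  = contradiction (proj₂ (h i) eq) ¬p
... | no ¬p | false = refl

does⇒indicator : {P : Fin n → Set} (P? : Decidable P) {M : Fin n → Bool} → (∀ i → M i ≡ does (P? i)) → IsIndicator P M
does⇒indicator P? h i rewrite h i with P? i
... | yes p = (λ _ → refl) , (λ _ → p)
... | no ¬p = (λ p → contradiction p ¬p) , (λ ())

-- A tuple with a common special set M is a choice of t independent objects with special set M.
count-tuples : (t k : ℕ) (xs : List X) {E : X → Set} (E? : Decidable E) {S : X → Fin n → Set} (S? : ∀ x → Decidable (S x)) →
  (T? : Decidable {A = Fin (suc t) → X} (λ π → (∀ a → E (π a) × countFin (S? (π a)) ≡ k)
          × (∀ a b i → (S (π a) i → S (π b) i) × (S (π b) i → S (π a) i)))) →
  countL T? (funs xs (suc t))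
    ≡ ∑ (funs bools n) (λ M → ind (size M ℕ.≟ k) * ∑ xs (λ x → ind (E? x ×-dec isIndicator? (S? x) M)) ^ suc t)
count-tuples {n = n} t k xs {E} E? {S} S? T? = begin
  countL T? (funs xs (suc t))
    ≡⟨ countL-∑ T? (funs xs (suc t)) ⟩
  ∑ (funs xs (suc t)) (λ π → ind (T? π))
    ≡⟨ ∑-cong expand (funs xs (suc t)) ⟩
  ∑ (funs xs (suc t)) (λ π → ∑ (funs bools n) (λ M → ind (size M ℕ.≟ k) * ∏ (λ a → ind (F? M (π a)))))
    ≡⟨ ∑-swap (funs xs (suc t)) (funs bools n) _ ⟩
  ∑ (funs bools n) (λ M → ∑ (funs xs (suc t)) (λ π → ind (size M ℕ.≟ k) * ∏ (λ a → ind (F? M (π a)))))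
    ≡⟨ ∑-cong (λ M → trans (∑-*ˡ (ind (size M ℕ.≟ k)) (funs xs (suc t)) _)
         (cong (ind (size M ℕ.≟ k) *_) (trans (∑-funs-∏ {n = suc t} xs (λ _ x → ind (F? M x))) (∏-const (suc t) (∑ xs (λ x → ind (F? M x))))))) (funs bools n) ⟩
  ∑ (funs bools n) (λ M → ind (size M ℕ.≟ k) * ∑ xs (λ x → ind (F? M x)) ^ suc t) ∎
  where
  F? : (M : Fin n → Bool) → Decidable (λ x → E x × IsIndicator (S x) M)
  F? M x = E? x ×-dec isIndicator? (S? x) M
  expand : ∀ π → ind (T? π) ≡ ∑ (funs bools n) (λ M → ind (size M ℕ.≟ k) * ∏ (λ a → ind (F? M (π a))))
  expand π = sym (begin
    ∑ (funs bools n) (λ M → ind (size M ℕ.≟ k) * ∏ (λ a → ind (F? M (π a))))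
      ≡⟨ ∑-cong (λ M → trans (cong (ind (size M ℕ.≟ k) *_) (sym (ind-all (F? M ∘ π))))
           (sym (ind-× (size M ℕ.≟ k) (FP.all? (F? M ∘ π))))) (funs bools n) ⟩
    ∑ (funs bools n) (λ M → ind ((size M ℕ.≟ k) ×-dec FP.all? (F? M ∘ π)))
      -- The tuple has length `suc t`, so it has a first entry, whose special set determines `M`.
      -- Hence the sum over `M` has at most one nonzero term.
      ≡⟨ ∑-cong (λ M → trans (ind-cong ((size M ℕ.≟ k) ×-dec FP.all? (F? M ∘ π))
           (T? π ×-dec FP.all? (λ i → M i BoolP.≟ does (S? (π zero) i))) (to M) (from M))
           (ind-× (T? π) (FP.all? (λ i → M i BoolP.≟ does (S? (π zero) i))))) (funs bools n) ⟩
    ∑ (funs bools n) (λ M → ind (T? π) * ind (FP.all? (λ i → M i BoolP.≟ does (S? (π zero) i))))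
      ≡⟨ ∑-*ˡ (ind (T? π)) (funs bools n) _ ⟩
    ind (T? π) * ∑ (funs bools n) (λ M → ind (FP.all? (λ i → M i BoolP.≟ does (S? (π zero) i))))
      ≡⟨ cong (ind (T? π) *_) (once-funs BoolP._≟_ bools once-bool n (λ i → does (S? (π zero) i))) ⟩
    ind (T? π) * 1
      ≡⟨ ℕP.*-identityʳ _ ⟩
    ind (T? π) ∎)
    where
    T : Set
    T = (∀ a → E (π a) × countFin (S? (π a)) ≡ k) × (∀ a b i → (S (π a) i → S (π b) i) × (S (π b) i → S (π a) i))
    to : ∀ M → size M ≡ k × (∀ a → E (π a) × IsIndicator (S (π a)) M) → T × (∀ i → M i ≡ does (S? (π zero) i))
    to M (sz , h) =
      ( (λ a → proj₁ (h a) , trans (size-count (S? (π a)) M (indicator⇒does (S? (π a)) (proj₂ (h a)))) sz)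
      , (λ a b i → (proj₂ (proj₂ (h b) i) ∘ proj₁ (proj₂ (h a) i)) , (proj₂ (proj₂ (h a) i) ∘ proj₁ (proj₂ (h b) i))))
      , indicator⇒does (S? (π zero)) (proj₂ (h zero))
    from : ∀ M → T × (∀ i → M i ≡ does (S? (π zero) i)) → size M ≡ k × (∀ a → E (π a) × IsIndicator (S (π a)) M)
    from M ((e , same) , M≗) =
      trans (sym (size-count (S? (π zero)) M M≗)) (proj₂ (e zero)) ,
      λ a → proj₁ (e a) , λ i →
        (λ p → proj₁ (does⇒indicator (S? (π zero)) M≗ i) (proj₁ (same a zero i) p)) ,
        (λ q → proj₂ (same a zero i) (proj₂ (does⇒indicator (S? (π zero)) M≗ i) q))

-- Set partitions

-- Admissible values x of the map sending i to the minimum of its block, when the set of block minima is M.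
Admissible : (Fin n → Bool) → Fin n → Fin n → Set
Admissible M i x = if M i then x ≡ i else (x F.< i × M x ≡ true)

admissible? : (M : Fin n → Bool) (i x : Fin n) → Dec (Admissible M i x)
admissible? M i x with M i
... | true  = x FP.≟ i
... | false = (x FP.<? i) ×-dec (M x BoolP.≟ true)

admissible-cases : (M : Fin n → Bool) {i x : Fin n} → Admissible M i x →
  (M i ≡ true × x ≡ i) ⊎ (M i ≡ false × x F.< i × M x ≡ true)
admissible-cases M {i} a with M i
... | true  = inj₁ (refl , a)
... | false = inj₂ (refl , a)


∑-below : (M : Fin n → Bool) (i : Fin n) →
  ∑ (allFin n) (λ x → ind ((x FP.<? i) ×-dec (M x BoolP.≟ true))) ≡ below M i
∑-below {suc n} M zero    = trans (∑-cong (λ x → ind-no ((x FP.<? zero {n}) ×-dec (M x BoolP.≟ true)) (ℕP.n≮0 ∘ proj₁)) (allFin (suc n)))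
  (∑-zero (allFin (suc n)))
∑-below {suc n} M (suc i) = trans (∑-allFin-suc {n} (λ x → ind ((x FP.<? suc i) ×-dec (M x BoolP.≟ true)))) (cong₂ _+_ first
  (trans (∑-cong (λ x → ind-cong ((suc x FP.<? suc i) ×-dec (M (suc x) BoolP.≟ true)) ((x FP.<? i) ×-dec (M (suc x) BoolP.≟ true))
     (λ { (s≤s p , q) → p , q }) (λ { (p , q) → s≤s p , q })) (allFin n)) (∑-below (M ∘ suc) i)))
  where
  first : ind ((zero {n} FP.<? suc i) ×-dec (M zero BoolP.≟ true)) ≡ (if M zero then 1 else 0)
  first with M zero
  ... | true  = refl
  ... | false = refl

∑-admissible : (M : Fin n → Bool) (i : Fin n) →
  ∑ (allFin n) (λ x → ind (admissible? M i x)) ≡ (if M i then 1 else below M i)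
∑-admissible {n} M i with M i
... | true  = once-allFin n i
... | false = ∑-below M i

least : {P : Fin n → Set} → Decidable P → ∀ i → P i → ∃ λ j → P j × (∀ l → P l → j F.≤ l)
least {suc n} P? i p with P? zero
... | yes p₀ = zero , p₀ , λ _ _ → z≤n
least {suc n} P? zero    p | no ¬p₀ = contradiction p ¬p₀
least {suc n} P? (suc i) p | no ¬p₀ with least (P? ∘ suc) i p
... | j , pj , min = suc j , pj , λ { zero p₀ → contradiction p₀ ¬p₀ ; (suc l) pl → s≤s (min l pl) }

¬true⇒false : {b : Bool} → ¬ b ≡ true → b ≡ false
¬true⇒false {true}  h = contradiction refl h
¬true⇒false {false} h = refl

does-true : {P : Set} (P? : Dec P) → does P? ≡ true → P
does-true (yes p) _ = p

true-does : {P : Set} (P? : Dec P) → P → does P? ≡ true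
true-does (yes _) _ = refl
true-does (no ¬p) p = contradiction p ¬p

bool-ext : {a b : Bool} → (a ≡ true → b ≡ true) → (b ≡ true → a ≡ true) → a ≡ b
bool-ext {true}  {b}     f g = sym (f refl)
bool-ext {false} {true}  f g = g refl
bool-ext {false} {false} f g = refl

module _ (M : Fin n → Bool) where

  private
    kernel : (Fin n → Fin n) → Rel n
    kernel r i j = does (r i FP.≟ r j)

    adm-≤ : {i x : Fin n} → Admissible M i x → x F.≤ i
    adm-≤ a with admissible-cases M a
    ... | inj₁ (_ , refl)    = ℕP.≤-refl
    ... | inj₂ (_ , x<i , _) = ℕP.<⇒≤ x<i

    adm-fix : {i x : Fin n} → Admissible M i x → M i ≡ true → x ≡ i
    adm-fix a m with admissible-cases M a
    ... | inj₁ (_ , e)      = e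
    ... | inj₂ (m′ , _ , _) = contradiction (trans (sym m) m′) λ ()

    mk-true : {i x : Fin n} → M i ≡ true → x ≡ i → Admissible M i x
    mk-true m e rewrite m = e

    mk-false : {i x : Fin n} → M i ≡ false → x F.< i → M x ≡ true → Admissible M i x
    mk-false m l e rewrite m = l , e

    Good : Rel n → Set
    Good R = IsEquivRel R × IsIndicator (BlockMin R) M

    -- An admissible `r` never raises an element, fixes `M` and has all its values in `M`. So each
    -- class of its kernel contains exactly one element of `M`, the common value of `r`, and this is
    -- the minimum of the class.
    kernel-good : ∀ {R} {r : Fin n → Fin n} → (∀ i → Admissible M i (r i)) → (∀ i j → R i j ≡ kernel r i j) → Good R
    kernel-good {R} {r} adm R≗ =
      ( (λ i → from refl)
      , (λ i j p → from (sym (to p)))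
      , (λ i j l p q → from (trans (to p) (to q))))
      , λ i →
        (λ bm → min⇒ i bm (M i) refl) ,
        (λ m j j<i → ¬true⇒false (λ Rji → ℕP.<⇒≢ (ℕP.≤-<-trans (adm-≤ (adm j)) j<i)
          (cong toℕ (trans (to Rji) (adm-fix (adm i) m)))))
      where
      to : ∀ {i j} → R i j ≡ true → r i ≡ r j
      to {i} {j} p = does-true (r i FP.≟ r j) (trans (sym (R≗ i j)) p)
      from : ∀ {i j} → r i ≡ r j → R i j ≡ true
      from {i} {j} e = trans (R≗ i j) (true-does (r i FP.≟ r j) e)
      min⇒ : ∀ i → BlockMin R i → ∀ b → M i ≡ b → M i ≡ true
      min⇒ i bm true  eq = eq
      min⇒ i bm false eq with admissible-cases M (adm i)
      ... | inj₁ (m , _)       = m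
      ... | inj₂ (_ , ri<i , m) = contradiction
        (trans (sym (from (adm-fix (adm (r i)) m))) (bm (r i) ri<i)) λ ()

    -- The preimage is the map `r₀` to the least element of each block. It is unique: i and `r₀ i`
    -- are related, so r i = r (r₀ i), and an admissible map fixes `r₀ i` because it lies in `M`.
    good-kernel : ∀ {R} → Good R → ∃ λ r₀ → ∀ r →
      ((∀ i → Admissible M i (r i)) → (∀ i j → kernel r i j ≡ R i j) → ∀ i → r i ≡ r₀ i) ×
      ((∀ i → r i ≡ r₀ i) → (∀ i → Admissible M i (r i)) × (∀ i j → kernel r i j ≡ R i j))
    good-kernel {R} ((rfl , symm , trns) , isMin) = r₀ , λ r → unique r , exists r
      where
      L : ∀ i → ∃ λ j → R j i ≡ true × (∀ l → R l i ≡ true → j F.≤ l)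
      L i = least (λ j → R j i BoolP.≟ true) i (rfl i)
      r₀ : Fin n → Fin n
      r₀ i = proj₁ (L i)
      rel : ∀ i → R (r₀ i) i ≡ true
      rel i = proj₁ (proj₂ (L i))
      min : ∀ i l → R l i ≡ true → r₀ i F.≤ l
      min i = proj₂ (proj₂ (L i))
      r₀∈ : ∀ i → M (r₀ i) ≡ true
      r₀∈ i = proj₁ (isMin (r₀ i)) λ j j<r → ¬true⇒false λ Rjr →
        ℕP.<⇒≱ j<r (min i j (trns j (r₀ i) i Rjr (rel i)))
      r₀-fix : ∀ i → M i ≡ true → r₀ i ≡ i
      r₀-fix i m with ℕP.m≤n⇒m<n∨m≡n (min i i (rfl i))
      ... | inj₂ e = FP.toℕ-injective e
      ... | inj₁ l = contradiction (trans (sym (rel i)) (proj₂ (isMin i) m (r₀ i) l)) λ ()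
      r₀-adm : ∀ i b → M i ≡ b → Admissible M i (r₀ i)
      r₀-adm i true  m = mk-true m (r₀-fix i m)
      r₀-adm i false m with ℕP.m≤n⇒m<n∨m≡n (min i i (rfl i))
      ... | inj₁ l = mk-false m l (r₀∈ i)
      ... | inj₂ e = contradiction (trans (sym m) (trans (cong M (sym (FP.toℕ-injective e))) (r₀∈ i))) λ ()
      r₀-rel : ∀ i j → R i j ≡ true → r₀ i ≡ r₀ j
      r₀-rel i j Rij = FP.≤-antisym
        (min i (r₀ j) (trns (r₀ j) j i (rel j) (symm i j Rij)))
        (min j (r₀ i) (trns (r₀ i) i j (rel i) Rij))
      unique : ∀ r → (∀ i → Admissible M i (r i)) → (∀ i j → kernel r i j ≡ R i j) → ∀ i → r i ≡ r₀ i
      unique r adm k≗ i = trans (does-true (r i FP.≟ r (r₀ i)) (trans (k≗ i (r₀ i)) (symm (r₀ i) i (rel i))))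
        (adm-fix (adm (r₀ i)) (r₀∈ i))
      exists : ∀ r → (∀ i → r i ≡ r₀ i) → (∀ i → Admissible M i (r i)) × (∀ i j → kernel r i j ≡ R i j)
      exists r r≗ =
        (λ i → subst (Admissible M i) (sym (r≗ i)) (r₀-adm i (M i) refl)) ,
        λ i j → bool-ext
          (λ d → let e = trans (sym (r≗ i)) (trans (does-true (r i FP.≟ r j) d) (r≗ j)) in
                 trns i (r₀ i) j (symm (r₀ i) i (rel i)) (subst (λ z → R z j ≡ true) (sym e) (rel j)))
          (λ Rij → true-does (r i FP.≟ r j) (trans (r≗ i) (trans (r₀-rel i j Rij) (sym (r≗ j)))))

  count-rels : ∑ (allRels n) (λ R → ind (isEquivRel? R ×-dec isIndicator? (blockMin? R) M))
    ≡ ∏ (λ i → if M i then 1 else below M i)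
  count-rels = begin
    ∑ (allRels n) (λ R → ind (isEquivRel? R ×-dec isIndicator? (blockMin? R) M))
      ≡⟨ ∑-map (λ f i j → f i j) rows (λ R → ind (isEquivRel? R ×-dec isIndicator? (blockMin? R) M)) ⟩
    ∑ rows (λ R → ind (isEquivRel? R ×-dec isIndicator? (blockMin? R) M))
      ≡⟨ ∑-bijection (λ R R′ → FP.all? λ i → FP.all? λ j → R i j BoolP.≟ R′ i j)
           (λ r r′ → FP.all? λ i → r i FP.≟ r′ i)
           rows (funs (allFin n) n)
           (once-funs (λ f g → FP.all? λ j → f j BoolP.≟ g j) (funs bools n) (once-funs BoolP._≟_ bools once-bool n) n)
           (once-funs FP._≟_ (allFin n) (once-allFin n) n)
           (λ R → isEquivRel? R ×-dec isIndicator? (blockMin? R) M)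
           (λ r → FP.all? λ i → admissible? M i (r i)) kernel
           (λ e i j → sym (e i j)) (λ e i j → sym (e i j))
           kernel-good good-kernel ⟩
    ∑ (funs (allFin n) n) (λ r → ind (FP.all? λ i → admissible? M i (r i)))
      ≡⟨ ∑-cong (λ r → ind-all (λ i → admissible? M i (r i))) (funs (allFin n) n) ⟩
    ∑ (funs (allFin n) n) (λ r → ∏ (λ i → ind (admissible? M i (r i))))
      ≡⟨ ∑-funs-∏ (allFin n) (λ i x → ind (admissible? M i x)) ⟩
    ∏ (λ i → ∑ (allFin n) (λ x → ind (admissible? M i x)))
      ≡⟨ ∏-cong (∑-admissible M) ⟩
    ∏ (λ i → if M i then 1 else below M i) ∎
    where
    rows : List (Rel n)
    rows = funs (funs bools n) n

numPartitionTuples-hom : ∀ t → 1 ≤ t → ∀ n k → numPartitionTuples t n k ≡ hom t 0 n k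
numPartitionTuples-hom (suc t) _ n k = begin
  numPartitionTuples (suc t) n k
    ≡⟨ count-tuples t k (allRels n) isEquivRel? blockMin? (partitionTuple? (suc t) n k) ⟩
  ∑ (funs bools n) (λ M → ind (size M ℕ.≟ k) *
      ∑ (allRels n) (λ R → ind (isEquivRel? R ×-dec isIndicator? (blockMin? R) M)) ^ suc t)
    ≡⟨ ∑-cong (λ M → cong (ind (size M ℕ.≟ k) *_) (trans (cong (_^ suc t) (count-rels M)) (∏-^ (λ i → if M i then 1 else below M i) (suc t)))) (funs bools n) ⟩
  ∑ (funs bools n) (λ M → ind (size M ℕ.≟ k) * ∏ (λ i → (if M i then 1 else below M i) ^ suc t))
    ≡⟨ ∑-subsets-below (suc t) 0 n k ⟩
  hom (suc t) 0 n k ∎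

-- Permutations

Inj : (Fin n → Fin n) → Set
Inj σ = ∀ i j → σ i ≡ σ j → i ≡ j

-- If a value were missed, `punchOut` would squeeze the map into an injection from n + 1 elements to
-- n.
inj⇒perm : {σ : Fin n → Fin n} → Inj σ → IsPerm σ
inj⇒perm {σ = σ} inj = inj , surj inj
  where
  surj : ∀ {n} {σ : Fin n → Fin n} → Inj σ → ∀ j → ∃ λ i → σ i ≡ j
  surj {suc n} {σ} inj j with FP.any? (λ i → σ i FP.≟ j)
  ... | yes h = h
  ... | no ¬h = contradiction
    (FP.injective⇒≤ {f = λ i → F.punchOut (avoid i)} (λ {x} {y} e → inj x y (FP.punchOut-injective (avoid x) (avoid y) e)))
    ℕP.1+n≰n
    where
    avoid : ∀ i → j ≢ σ i
    avoid i e = ¬h (i , sym e)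

iter-+ : (σ : Fin n → Fin n) (a b : ℕ) (i : Fin n) → iter σ (a + b) i ≡ iter σ a (iter σ b i)
iter-+ σ zero    b i = refl
iter-+ σ (suc a) b i = cong σ (iter-+ σ a b i)

iter-inj : {σ : Fin n → Fin n} → Inj σ → ∀ m {i j} → iter σ m i ≡ iter σ m j → i ≡ j
iter-inj inj zero    e = e
iter-inj inj (suc m) e = iter-inj inj m (inj _ _ e)

-- Two of the n + 1 iterates with exponents 0, ..., n coincide, and injectivity cancels the smaller
-- exponent. The bound by n matters since `CycleMin` inspects only the exponents below n.
period : {σ : Fin n → Fin n} → Inj σ → ∀ i → ∃ λ p → suc p ≤ n × iter σ (suc p) i ≡ i
period {n} {σ} inj i with FP.pigeonhole (ℕP.n<1+n n) (λ m → iter σ (toℕ m) i)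
... | a , b , a<b , e with ℕP.m≤n⇒∃[o]m+o≡n a<b
...   | d , eq = d , bound , sym (iter-inj inj (toℕ a) (trans e (trans (cong (λ m → iter σ m i) (sym eq′)) (iter-+ σ (toℕ a) (suc d) i))))
  where
  eq′ : toℕ a + suc d ≡ toℕ b
  eq′ = trans (ℕP.+-suc (toℕ a) d) eq
  bound : suc d ≤ n
  bound = ℕP.≤-trans (ℕP.m≤n+m (suc d) (toℕ a)) (subst (_≤ n) (sym eq′) (ℕ.s≤s⁻¹ (FP.toℕ<n b)))

-- Free of the bound on exponents that `CycleMin` takes from n. An insertion changes n and may
-- lengthen an orbit, so the unbounded form is the one that can be carried across it.
OrbitMin : (Fin n → Fin n) → Fin n → Set
OrbitMin σ i = ∀ m → i F.≤ iter σ m i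

cycleMin⇒orbitMin : {σ : Fin n → Fin n} → Inj σ → ∀ {i} → CycleMin σ i → OrbitMin σ i
cycleMin⇒orbitMin {n} {σ} inj {i} cm m with period inj i
... | p , p<n , per = subst (i F.≤_) (sym reduce) (subst (λ k → i F.≤ iter σ k i) (FP.toℕ-fromℕ< r<n) (cm (F.fromℕ< r<n)))
  where
  r<n : m % suc p < n
  r<n = ℕP.<-≤-trans (m%n<n m (suc p)) p<n
  multiples : ∀ q → iter σ (q * suc p) i ≡ i
  multiples zero    = refl
  multiples (suc q) = trans (iter-+ σ (suc p) (q * suc p) i) (trans (cong (iter σ (suc p)) (multiples q)) per)
  reduce : iter σ m i ≡ iter σ (m % suc p) i
  reduce = trans (cong (λ k → iter σ k i) (m≡m%n+[m/n]*n m (suc p)))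
    (trans (iter-+ σ (m % suc p) (m / suc p * suc p) i) (cong (iter σ (m % suc p)) (multiples (m / suc p))))

-- τ arises from σ by inserting the largest element into a cycle just before b
-- (as a fixed point when b is the largest element itself).
data Step (σ : Fin n → Fin n) (b : Fin (suc n)) (τ : Fin (suc n) → Fin (suc n)) (j : Fin n) : Set where
  keep   : τ (inject₁ j) ≡ inject₁ (σ j) → inject₁ (σ j) ≢ b → Step σ b τ j
  detour : τ (inject₁ j) ≡ fromℕ n → inject₁ (σ j) ≡ b → Step σ b τ j

Extends : (Fin n → Fin n) → Fin (suc n) → (Fin (suc n) → Fin (suc n)) → Set
Extends {n} σ b τ = τ (fromℕ n) ≡ b × (∀ j → Step σ b τ j)

last≢inject : {i : Fin n} → fromℕ n ≢ inject₁ i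
last≢inject = FP.fromℕ≢inject₁

by-view : {P : Fin (suc n) → Set} → P (fromℕ n) → (∀ j → P (inject₁ j)) → ∀ i → P i
by-view pl pi i with view i
... | ‵fromℕ     = pl
... | ‵inject₁ j = pi j

insert : (Fin n → Fin n) → Fin (suc n) → Fin (suc n) → Fin (suc n)
insert {n} σ b = by-view b (λ j → if does (inject₁ (σ j) FP.≟ b) then fromℕ n else inject₁ (σ j))

insert-last : (σ : Fin n → Fin n) (b : Fin (suc n)) → insert σ b (fromℕ n) ≡ b
insert-last {n} σ b rewrite view-fromℕ n = refl

insert-inject : (σ : Fin n → Fin n) (b : Fin (suc n)) (j : Fin n) →
  insert σ b (inject₁ j) ≡ (if does (inject₁ (σ j) FP.≟ b) then fromℕ n else inject₁ (σ j))
insert-inject σ b j rewrite view-inject₁ j = refl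

insert-extends : (σ : Fin n → Fin n) (b : Fin (suc n)) → Extends σ b (insert σ b)
insert-extends {n} σ b = insert-last σ b , λ j → step j (inject₁ (σ j) FP.≟ b) (insert-inject σ b j)
  where
  step : ∀ j (d : Dec (inject₁ (σ j) ≡ b)) → insert σ b (inject₁ j) ≡ (if does d then fromℕ n else inject₁ (σ j)) → Step σ b (insert σ b) j
  step j (yes e) eq = detour eq e
  step j (no ¬e) eq = keep eq ¬e

extends-cong : {σ σ′ : Fin n → Fin n} {b : Fin (suc n)} {τ τ′ : Fin (suc n) → Fin (suc n)} →
  σ ≗ σ′ → τ ≗ τ′ → Extends σ b τ → Extends σ′ b τ′
extends-cong {n} {σ} {σ′} {b} {τ} {τ′} σ≗ τ≗ (l , st) = trans (sym (τ≗ _)) l , λ j → go j (st j)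
  where
  go : ∀ j → Step σ b τ j → Step σ′ b τ′ j
  go j (keep e ne)  = keep (trans (sym (τ≗ _)) (trans e (cong inject₁ (σ≗ j)))) (subst (λ x → inject₁ x ≢ b) (σ≗ j) ne)
  go j (detour e f) = detour (trans (sym (τ≗ _)) e) (trans (cong inject₁ (sym (σ≗ j))) f)

extends-functional : {σ : Fin n → Fin n} {b : Fin (suc n)} {τ τ′ : Fin (suc n) → Fin (suc n)} →
  Extends σ b τ → Extends σ b τ′ → τ ≗ τ′
extends-functional {n} {σ} {b} {τ} {τ′} (l , st) (l′ , st′) = by-view (trans l (sym l′)) λ j → go j (st j) (st′ j)
  where
  go : ∀ j → Step σ b τ j → Step σ b τ′ j → τ (inject₁ j) ≡ τ′ (inject₁ j)
  go j (keep e _)   (keep e′ _)   = trans e (sym e′)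
  go j (keep _ ne)  (detour _ f)  = contradiction f ne
  go j (detour _ f) (keep _ ne)   = contradiction f ne
  go j (detour e _) (detour e′ _) = trans e (sym e′)

module _ {σ : Fin n → Fin n} {b : Fin (suc n)} {τ : Fin (suc n) → Fin (suc n)} (ext : Extends σ b τ) where

  private
    step : ∀ j → Step σ b τ j
    step = proj₂ ext

    ends : τ (fromℕ n) ≡ b
    ends = proj₁ ext

  extends-injective : {σ′ : Fin n → Fin n} {b′ : Fin (suc n)} → Extends σ′ b′ τ → (σ ≗ σ′) × b ≡ b′
  extends-injective {σ′} {b′} (l′ , st′) = (λ j → go j (step j) (st′ j)) , b≡
    where
    b≡ : b ≡ b′
    b≡ = trans (sym ends) l′
    go : ∀ j → Step σ b τ j → Step σ′ b′ τ j → σ j ≡ σ′ j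
    go j (keep e _)   (keep e′ _)   = FP.inject₁-injective (trans (sym e) e′)
    go j (keep e _)   (detour e′ _) = contradiction (trans (sym e′) e) last≢inject
    go j (detour e _) (keep e′ _)   = contradiction (trans (sym e) e′) last≢inject
    go j (detour _ f) (detour _ f′) = FP.inject₁-injective (trans f (trans b≡ (sym f′)))

  extends-inj⁺ : Inj σ → Inj τ
  extends-inj⁺ inj = by-view (by-view (λ _ → refl) λ j e → contradiction e (mixed j (step j)))
    (λ i → by-view (λ e → contradiction (sym e) (mixed i (step i))) λ j e → cong inject₁ (go i j (step i) (step j) e))
    where
    mixed : ∀ j → Step σ b τ j → τ (fromℕ n) ≢ τ (inject₁ j)
    mixed j (keep e ne)  eq = ne (trans (sym e) (trans (sym eq) ends))
    mixed j (detour e f) eq = last≢inject (trans (sym e) (trans (sym eq) (trans ends (sym f))))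
    go : ∀ i j → Step σ b τ i → Step σ b τ j → τ (inject₁ i) ≡ τ (inject₁ j) → i ≡ j
    go i j (keep e _)   (keep e′ _)   eq = inj i j (FP.inject₁-injective (trans (sym e) (trans eq e′)))
    go i j (keep e _)   (detour e′ _) eq = contradiction (trans (sym e′) (trans (sym eq) e)) last≢inject
    go i j (detour e _) (keep e′ _)   eq = contradiction (trans (sym e) (trans eq e′)) last≢inject
    go i j (detour _ f) (detour _ f′) eq = inj i j (FP.inject₁-injective (trans f (sym f′)))

  extends-inj⁻ : Inj τ → Inj σ
  extends-inj⁻ inj i j eq = FP.inject₁-injective (inj _ _ (go (step i) (step j)))
    where
    go : Step σ b τ i → Step σ b τ j → τ (inject₁ i) ≡ τ (inject₁ j)
    go (keep e _)   (keep e′ _)   = trans e (trans (cong inject₁ eq) (sym e′))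
    go (keep _ ne)  (detour _ f)  = contradiction (trans (cong inject₁ eq) f) ne
    go (detour _ f) (keep _ ne)   = contradiction (trans (cong inject₁ (sym eq)) f) ne
    go (detour e _) (detour e′ _) = trans e (sym e′)

  orbit⁺ : ∀ i m → ∃ λ m′ → iter τ m′ (inject₁ i) ≡ inject₁ (iter σ m i)
  orbit⁺ i zero    = 0 , refl
  orbit⁺ i (suc m) with orbit⁺ i m
  ... | m′ , e with step (iter σ m i)
  ...   | keep e′ _   = suc m′ , trans (cong τ e) e′
  ...   | detour e′ f = suc (suc m′) , trans (cong τ (trans (cong τ e) e′)) (trans ends (sym f))

  -- The orbits differ only by visits to the largest element. The second alternative also records
  -- where `b` lies on the old orbit, because the next step lands there.
  orbit⁻ : ∀ i m → (∃ λ m′ → iter τ m (inject₁ i) ≡ inject₁ (iter σ m′ i))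
                 ⊎ (iter τ m (inject₁ i) ≡ fromℕ n × ∃ λ m′ → b ≡ inject₁ (iter σ m′ i))
  orbit⁻ i zero    = inj₁ (0 , refl)
  orbit⁻ i (suc m) with orbit⁻ i m
  ... | inj₂ (e , m′ , f) = inj₁ (m′ , trans (cong τ e) (trans ends f))
  ... | inj₁ (m′ , e) with step (iter σ m′ i)
  ...   | keep e′ _   = inj₁ (suc m′ , trans (cong τ e) e′)
  ...   | detour e′ f = inj₂ (trans (cong τ e) e′ , suc m′ , sym f)

  -- The only new element an orbit can meet is the largest one, which undercuts no minimum.
  orbitMin⁺ : ∀ i → OrbitMin σ i → OrbitMin τ (inject₁ i)
  orbitMin⁺ i om m with orbit⁻ i m
  ... | inj₁ (m′ , e) rewrite e | FP.toℕ-inject₁ i | FP.toℕ-inject₁ (iter σ m′ i) = om m′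
  ... | inj₂ (e , _)  rewrite e = FP.≤fromℕ (inject₁ i)

  orbitMin⁻ : ∀ i → OrbitMin τ (inject₁ i) → OrbitMin σ i
  orbitMin⁻ i om m with orbit⁺ i m
  ... | m′ , e = subst₂ _≤_ (FP.toℕ-inject₁ i) (trans (cong toℕ e) (FP.toℕ-inject₁ _)) (om m′)

  orbitMin-last⁺ : b ≡ fromℕ n → OrbitMin τ (fromℕ n)
  orbitMin-last⁺ e m = ℕP.≤-reflexive (cong toℕ (sym (fixed m)))
    where
    fixed : ∀ m → iter τ m (fromℕ n) ≡ fromℕ n
    fixed zero    = refl
    fixed (suc m) = trans (cong τ (fixed m)) (trans ends e)

  orbitMin-last⁻ : OrbitMin τ (fromℕ n) → b ≡ fromℕ n
  orbitMin-last⁻ om = FP.≤-antisym (FP.≤fromℕ b) (subst (fromℕ n F.≤_) ends (om 1))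

last⊎inject : (x : Fin (suc n)) → x ≡ fromℕ n ⊎ ∃ λ k → x ≡ inject₁ k
last⊎inject = by-view (inj₁ refl) (λ j → inj₂ (j , refl))

remove-last : {τ : Fin (suc n) → Fin (suc n)} → Inj τ → ∃₂ λ σ b → Extends σ b τ
remove-last {n} {τ} inj = (λ j → proj₁ (σ j)) , τ (fromℕ n) , refl , λ j → proj₂ (σ j) _ refl
  where
  -- `Step` mentions a whole function but depends only on its value at `j`. Quantifying over `σ′`
  -- lets this value be chosen before the function that collects the values exists.
  σ : ∀ j → ∃ λ k → ∀ (σ′ : Fin n → Fin n) → σ′ j ≡ k → Step σ′ (τ (fromℕ n)) τ j
  σ j with last⊎inject (τ (inject₁ j))
  ... | inj₂ (k , e) = k , λ σ′ eq → keep (trans e (cong inject₁ (sym eq)))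
                         (λ f → last≢inject (inj _ _ (trans (sym f) (trans (cong inject₁ eq) (sym e)))))
  ... | inj₁ e with last⊎inject (τ (fromℕ n))
  ...   | inj₁ e′       = contradiction (inj _ _ (trans e′ (sym e))) last≢inject
  ...   | inj₂ (k , e′) = k , λ σ′ eq → detour e (trans (cong inject₁ eq) (sym e′))

∑-not-last : ∀ n → ∑ (allFin (suc n)) (λ b → ind (¬? (b FP.≟ fromℕ n))) ≡ n
∑-not-last zero    = refl
∑-not-last (suc n) = trans (∑-allFin-suc {suc n} (λ b → ind (¬? (b FP.≟ fromℕ (suc n))))) (cong suc (trans
  (∑-cong (λ b → ind-cong (¬? (suc b FP.≟ suc (fromℕ n))) (¬? (b FP.≟ fromℕ n))
    (λ h e → h (cong suc e)) (λ h e → h (FP.suc-injective e))) (allFin (suc n)))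
  (∑-not-last n)))

GoodPerm : (Fin n → Bool) → (Fin n → Fin n) → Set
GoodPerm M σ = IsPerm σ × IsIndicator (CycleMin σ) M

goodPerm? : (M : Fin n → Bool) → Decidable (GoodPerm M)
goodPerm? M σ = isPerm? σ ×-dec isIndicator? (cycleMin? σ) M

-- The inserted largest element leaves the other cycle minima alone and is itself a minimum only as
-- a fixed point. So `M` restricts to `M ∘ inject₁`, and the place `b` is forced if the largest
-- element is in `M`, while otherwise it is any of the n smaller elements.
count-perms : ∀ n (M : Fin n → Bool) →
  ∑ (funs (allFin n) n) (λ σ → ind (goodPerm? M σ)) ≡ ∏ (λ i → if M i then 1 else toℕ i)
count-perms zero    M = ∑-cong (λ σ → ind-yes (goodPerm? M σ) (((λ ()) , λ ()) , λ ())) (funs (allFin 0) 0)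
count-perms (suc n) M = begin
  ∑ (funs (allFin (suc n)) (suc n)) (λ τ → ind (goodPerm? M τ))
    ≡⟨ ∑-bijection (λ f g → FP.all? λ i → f i FP.≟ g i)
         (λ p q → (FP.all? λ i → proj₁ p i FP.≟ proj₁ q i) ×-dec (proj₂ p FP.≟ proj₂ q))
         (funs (allFin (suc n)) (suc n)) (cartesianProduct (funs (allFin n) n) (allFin (suc n)))
         (once-funs FP._≟_ (allFin (suc n)) (once-allFin (suc n)) (suc n))
         (once-× (λ f g → FP.all? λ i → f i FP.≟ g i) FP._≟_ (funs (allFin n) n) (allFin (suc n))
           (once-funs FP._≟_ (allFin n) (once-allFin n) n) (once-allFin (suc n)))
         (goodPerm? M) (λ p → goodPerm? M′ (proj₁ p) ×-dec last? (proj₂ p)) (λ p → insert (proj₁ p) (proj₂ p))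
         (λ e i → sym (e i)) (λ e i → sym (e i))
         (λ { {τ} {σ , b} (g , h) e → good⁺ (extends-cong (λ _ → refl) (λ i → sym (e i)) (insert-extends σ b)) g h })
         inverse ⟩
  ∑ (cartesianProduct (funs (allFin n) n) (allFin (suc n))) (λ p → ind (goodPerm? M′ (proj₁ p) ×-dec last? (proj₂ p)))
    ≡⟨ ∑-cartesianProduct (funs (allFin n) n) (allFin (suc n)) _ ⟩
  ∑ (funs (allFin n) n) (λ σ → ∑ (allFin (suc n)) (λ b → ind (goodPerm? M′ σ ×-dec last? b)))
    ≡⟨ ∑-cong (λ σ → trans (∑-cong (λ b → ind-× (goodPerm? M′ σ) (last? b)) (allFin (suc n)))
         (∑-*ˡ (ind (goodPerm? M′ σ)) (allFin (suc n)) _)) (funs (allFin n) n) ⟩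
  ∑ (funs (allFin n) n) (λ σ → ind (goodPerm? M′ σ) * ∑ (allFin (suc n)) (λ b → ind (last? b)))
    ≡⟨ ∑-*ʳ _ (funs (allFin n) n) _ ⟩
  ∑ (funs (allFin n) n) (λ σ → ind (goodPerm? M′ σ)) * ∑ (allFin (suc n)) (λ b → ind (last? b))
    ≡⟨ cong₂ _*_ (trans (count-perms n M′) (∏-cong (λ i → cong (λ z → if M′ i then 1 else z) (sym (FP.toℕ-inject₁ i)))))
         (trans (∑-last (M (fromℕ n)) refl) (cong (λ z → if M (fromℕ n) then 1 else z) (sym (FP.toℕ-fromℕ n)))) ⟩
  ∏ (λ i → if M (inject₁ i) then 1 else toℕ (inject₁ i)) * (if M (fromℕ n) then 1 else toℕ (fromℕ n))
    ≡⟨ sym (∏-last (λ i → if M i then 1 else toℕ i)) ⟩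
  ∏ (λ i → if M i then 1 else toℕ i) ∎
  where
  M′ : Fin n → Bool
  M′ = M ∘ inject₁
  Last : Fin (suc n) → Set
  Last b = (b ≡ fromℕ n → M (fromℕ n) ≡ true) × (M (fromℕ n) ≡ true → b ≡ fromℕ n)
  last? : Decidable Last
  last? b = ((b FP.≟ fromℕ n) →-dec (M (fromℕ n) BoolP.≟ true)) ×-dec ((M (fromℕ n) BoolP.≟ true) →-dec (b FP.≟ fromℕ n))
  ∑-last : ∀ m → M (fromℕ n) ≡ m → ∑ (allFin (suc n)) (λ b → ind (last? b)) ≡ (if m then 1 else n)
  ∑-last true  eq = trans (∑-cong (λ b → ind-cong (last? b) (b FP.≟ fromℕ n)
    (λ h → proj₂ h eq) (λ e → (λ _ → eq) , (λ _ → e))) (allFin (suc n))) (once-allFin (suc n) (fromℕ n))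
  ∑-last false eq = trans (∑-cong (λ b → ind-cong (last? b) (¬? (b FP.≟ fromℕ n))
    (λ h e → contradiction (trans (sym eq) (proj₁ h e)) λ ())
    (λ ne → (λ e → contradiction e ne) , (λ m → contradiction (trans (sym eq) m) λ ()))) (allFin (suc n))) (∑-not-last n)
  good⁺ : ∀ {σ b τ} → Extends σ b τ → GoodPerm M′ σ → Last b → GoodPerm M τ
  good⁺ {σ} {b} {τ} ext ((inj , _) , cm) (l₁ , l₂) = inj⇒perm injτ , by-view
    ( (λ c → l₁ (orbitMin-last⁻ ext (cycleMin⇒orbitMin injτ c)))
    , (λ m i → orbitMin-last⁺ ext (l₂ m) (toℕ i)))
    (λ j →
      (λ c → proj₁ (cm j) (λ m → orbitMin⁻ ext j (cycleMin⇒orbitMin injτ c) (toℕ m))) ,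
      (λ m i → orbitMin⁺ ext j (cycleMin⇒orbitMin inj (proj₂ (cm j) m)) (toℕ i)))
    where
    injτ : Inj τ
    injτ = extends-inj⁺ ext inj
  good⁻ : ∀ {σ b τ} → Extends σ b τ → GoodPerm M τ → GoodPerm M′ σ × Last b
  good⁻ {σ} {b} {τ} ext ((inj , _) , cm) =
    (inj⇒perm injσ , λ j →
      (λ c → proj₁ (cm (inject₁ j)) (λ m → orbitMin⁺ ext j (cycleMin⇒orbitMin injσ c) (toℕ m))) ,
      (λ m i → orbitMin⁻ ext j (cycleMin⇒orbitMin inj (proj₂ (cm (inject₁ j)) m)) (toℕ i))) ,
    (λ e → proj₁ (cm (fromℕ n)) (λ m → orbitMin-last⁺ ext e (toℕ m))) ,
    (λ m → orbitMin-last⁻ ext (cycleMin⇒orbitMin inj (proj₂ (cm (fromℕ n)) m)))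
    where
    injσ : Inj σ
    injσ = extends-inj⁻ ext inj
  inverse : ∀ {τ} → GoodPerm M τ → ∃ λ y₀ → ∀ y →
    (GoodPerm M′ (proj₁ y) × Last (proj₂ y) → (∀ i → insert (proj₁ y) (proj₂ y) i ≡ τ i) → (∀ i → proj₁ y i ≡ proj₁ y₀ i) × proj₂ y ≡ proj₂ y₀) ×
    ((∀ i → proj₁ y i ≡ proj₁ y₀ i) × proj₂ y ≡ proj₂ y₀ → (GoodPerm M′ (proj₁ y) × Last (proj₂ y)) × (∀ i → insert (proj₁ y) (proj₂ y) i ≡ τ i))
  inverse {τ} g with remove-last (proj₁ (proj₁ g))
  ... | σ₀ , b₀ , ext₀ = (σ₀ , b₀) , λ { (σ , b) →
    (λ _ e → extends-injective (extends-cong (λ _ → refl) e (insert-extends σ b)) ext₀) ,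
    (λ { (σ≗ , refl) →
      let ext = extends-cong (λ i → sym (σ≗ i)) (λ _ → refl) ext₀ in
      good⁻ ext g , extends-functional (insert-extends σ b) ext }) }

numPermTuples-elem : ∀ t → 1 ≤ t → ∀ n k → numPermTuples t n k ≡ elem t 0 n k
numPermTuples-elem (suc t) _ n k = begin
  numPermTuples (suc t) n k
    ≡⟨ count-tuples t k (funs (allFin n) n) isPerm? cycleMin? (permTuple? (suc t) n k) ⟩
  ∑ (funs bools n) (λ M → ind (size M ℕ.≟ k) * ∑ (funs (allFin n) n) (λ σ → ind (goodPerm? M σ)) ^ suc t)
    ≡⟨ ∑-cong (λ M → cong (ind (size M ℕ.≟ k) *_) (trans (cong (_^ suc t) (count-perms n M))
         (∏-^ (λ i → if M i then 1 else toℕ i) (suc t)))) (funs bools n) ⟩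
  ∑ (funs bools n) (λ M → ind (size M ℕ.≟ k) * ∏ (λ i → (if M i then 1 else toℕ i) ^ suc t))
    ≡⟨ ∑-subsets-index (suc t) 0 n k ⟩
  elem (suc t) 0 n k ∎

-- Words and increasing sequences

∑-upTo-suc : ∀ N (f : ℕ → ℕ) → ∑ (upTo (suc N)) f ≡ f 0 + ∑ (upTo N) (f ∘ suc)
∑-upTo-suc N f = cong (λ l → f 0 + sum l) (trans (ListP.map-applyUpTo suc f N) (sym (ListP.map-applyUpTo id (f ∘ suc) N)))

∑-upTo-last : ∀ N (f : ℕ → ℕ) → ∑ (upTo (suc N)) f ≡ ∑ (upTo N) f + f N
∑-upTo-last zero    f = ℕP.+-comm (f 0) 0
∑-upTo-last (suc N) f = begin
  ∑ (upTo (suc (suc N))) f                    ≡⟨ ∑-upTo-suc (suc N) f ⟩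
  f 0 + ∑ (upTo (suc N)) (f ∘ suc)            ≡⟨ cong (f 0 +_) (∑-upTo-last N (f ∘ suc)) ⟩
  f 0 + (∑ (upTo N) (f ∘ suc) + f (suc N))    ≡⟨ sym (ℕP.+-assoc (f 0) _ _) ⟩
  f 0 + ∑ (upTo N) (f ∘ suc) + f (suc N)      ≡⟨ cong (_+ f (suc N)) (sym (∑-upTo-suc N f)) ⟩
  ∑ (upTo (suc N)) f + f (suc N) ∎

∑-upTo-cong : ∀ N {f g : ℕ → ℕ} → (∀ x → x < N → f x ≡ g x) → ∑ (upTo N) f ≡ ∑ (upTo N) g
∑-upTo-cong zero    h = refl
∑-upTo-cong (suc N) {f} {g} h = trans (∑-upTo-suc N f) (trans
  (cong₂ _+_ (h 0 (s≤s z≤n)) (∑-upTo-cong N (λ x x<N → h (suc x) (s≤s x<N)))) (sym (∑-upTo-suc N g)))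

∑-upTo-pick : ∀ N a (φ : ℕ → ℕ) → a < N → ∑ (upTo N) (λ x → ind (x ℕ.≟ a) * φ x) ≡ φ a
∑-upTo-pick (suc N) zero φ _ = trans (∑-upTo-suc N (λ x → ind (x ℕ.≟ 0) * φ x))
  (trans (cong (φ 0 + 0 +_) (∑-zero (upTo N))) (trans (ℕP.+-identityʳ _) (ℕP.+-identityʳ _)))
∑-upTo-pick (suc N) (suc a) φ (s≤s a<N) =
  trans (∑-upTo-suc N (λ x → ind (x ℕ.≟ suc a) * φ x)) (∑-upTo-pick N a (φ ∘ suc) a<N)

∑-allFin-upTo : ∀ N (f : ℕ → ℕ) → ∑ (allFin N) (f ∘ toℕ) ≡ ∑ (upTo N) f
∑-allFin-upTo zero    f = refl
∑-allFin-upTo (suc N) f = trans (∑-allFin-suc {N} (f ∘ toℕ))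
  (trans (cong (f 0 +_) (∑-allFin-upTo N (f ∘ suc))) (sym (∑-upTo-suc N f)))

words : ℕ → ℕ → List (List ℕ)
words N zero    = [ [] ]
words N (suc K) = concatMap (λ a → map (a ∷_) (words N K)) (upTo N)

toWord : ∀ {K N} → (Fin K → Fin N) → List ℕ
toWord w = tabulate (toℕ ∘ w)

∑-words-suc : ∀ N K (G : List ℕ → ℕ) →
  ∑ (words N (suc K)) G ≡ ∑ (upTo N) (λ a → ∑ (words N K) (λ l → G (a ∷ l)))
∑-words-suc N K G = trans (∑-concatMap _ (upTo N) G) (∑-cong (λ a → ∑-map (a ∷_) (words N K) G) (upTo N))

∑-funs-words : ∀ N K (G : List ℕ → ℕ) → ∑ (funs (allFin N) K) (G ∘ toWord) ≡ ∑ (words N K) G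
∑-funs-words N zero    G = refl
∑-funs-words N (suc K) G = begin
  ∑ (funs (allFin N) (suc K)) (G ∘ toWord)
    ≡⟨ ∑-funs-suc (allFin N) (G ∘ toWord) (λ f≗g → cong G (ListP.tabulate-cong (λ i → cong toℕ (f≗g i)))) ⟩
  ∑ (allFin N) (λ a → ∑ (funs (allFin N) K) (λ f → G (toℕ a ∷ toWord f)))
    ≡⟨ ∑-cong (λ a → ∑-funs-words N K (λ l → G (toℕ a ∷ l))) (allFin N) ⟩
  ∑ (allFin N) (λ a → ∑ (words N K) (λ l → G (toℕ a ∷ l)))
    ≡⟨ ∑-allFin-upTo N (λ a → ∑ (words N K) (λ l → G (a ∷ l))) ⟩
  ∑ (upTo N) (λ a → ∑ (words N K) (λ l → G (a ∷ l)))
    ≡⟨ sym (∑-words-suc N K G) ⟩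
  ∑ (words N (suc K)) G ∎

∑-words-cong : ∀ N K {f g : List ℕ → ℕ} → (∀ l → length l ≡ K → All (_< N) l → f l ≡ g l) →
  ∑ (words N K) f ≡ ∑ (words N K) g
∑-words-cong N zero    h = cong (_+ 0) (h [] refl [])
∑-words-cong N (suc K) {f} {g} h = trans (∑-words-suc N K f) (trans
  (∑-upTo-cong N (λ a a<N → ∑-words-cong N K (λ l len l<N → h (a ∷ l) (cong suc len) (a<N ∷ l<N))))
  (sym (∑-words-suc N K g)))

-- next = id describes weakly increasing words, next = suc strictly increasing ones.
module Chains (next weight : ℕ → ℕ) where

  Chain : ℕ → List ℕ → Set
  Chain a []      = ⊤
  Chain a (x ∷ l) = a ≤ x × Chain (next x) l

  chain? : ∀ a l → Dec (Chain a l)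
  chain? a []      = yes tt
  chain? a (x ∷ l) = (a ℕ.≤? x) ×-dec chain? (next x) l

  weights : List ℕ → ℕ
  weights l = product (map weight l)

  chainSum : (N a n : ℕ) → ℕ
  chainSum N a n = ∑ (words N n) (λ l → ind (chain? a l) * weights l)

  private
    φ : (N n x : ℕ) → ℕ
    φ N n x = weight x * chainSum N (next x) n

    expand : ∀ N a n → chainSum N a (suc n) ≡ ∑ (upTo N) (λ x → ind (a ℕ.≤? x) * φ N n x)
    expand N a n = trans (∑-words-suc N n _) (∑-cong (λ x → begin
      ∑ (words N n) (λ l → ind ((a ℕ.≤? x) ×-dec chain? (next x) l) * (weight x * weights l))
        ≡⟨ ∑-cong (λ l → trans (cong (_* (weight x * weights l)) (ind-× (a ℕ.≤? x) (chain? (next x) l)))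
             (regroup (ind (a ℕ.≤? x)) (ind (chain? (next x) l)) (weight x) (weights l))) (words N n) ⟩
      ∑ (words N n) (λ l → (ind (a ℕ.≤? x) * weight x) * (ind (chain? (next x) l) * weights l))
        ≡⟨ ∑-*ˡ (ind (a ℕ.≤? x) * weight x) (words N n) _ ⟩
      (ind (a ℕ.≤? x) * weight x) * chainSum N (next x) n
        ≡⟨ ℕP.*-assoc (ind (a ℕ.≤? x)) (weight x) _ ⟩
      ind (a ℕ.≤? x) * φ N n x ∎) (upTo N))
      where
      regroup : ∀ p q w v → (p * q) * (w * v) ≡ (p * w) * (q * v)
      regroup = solve-∀

    ind-≤-split : ∀ a x → ind (a ℕ.≤? x) ≡ ind (x ℕ.≟ a) + ind (suc a ℕ.≤? x)
    ind-≤-split a x = go (x ℕ.≟ a)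
      where
      go : Dec (x ≡ a) → ind (a ℕ.≤? x) ≡ ind (x ℕ.≟ a) + ind (suc a ℕ.≤? x)
      go (yes refl) = trans (ind-yes (x ℕ.≤? x) ℕP.≤-refl)
        (sym (cong₂ _+_ (ind-yes (x ℕ.≟ x) refl) (ind-no (suc x ℕ.≤? x) ℕP.1+n≰n)))
      go (no x≢a) = trans (ind-cong (a ℕ.≤? x) (suc a ℕ.≤? x) (λ p → ℕP.≤∧≢⇒< p (λ e → x≢a (sym e))) ℕP.<⇒≤)
        (sym (cong (_+ ind (suc a ℕ.≤? x)) (ind-no (x ℕ.≟ a) x≢a)))

  chainSum-empty : ∀ N n → chainSum N N (suc n) ≡ 0
  chainSum-empty N n = trans (expand N N n) (trans
    (∑-upTo-cong N (λ x x<N → cong (_* φ N n x) (ind-no (N ℕ.≤? x) (ℕP.<⇒≱ x<N)))) (∑-zero (upTo N)))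

  -- The first letter is either `a` itself or bounded below by a + 1.
  chainSum-suc : ∀ N a n → a < N →
    chainSum N a (suc n) ≡ weight a * chainSum N (next a) n + chainSum N (suc a) (suc n)
  chainSum-suc N a n a<N = begin
    chainSum N a (suc n)
      ≡⟨ expand N a n ⟩
    ∑ (upTo N) (λ x → ind (a ℕ.≤? x) * φ N n x)
      ≡⟨ ∑-cong (λ x → trans (cong (_* φ N n x) (ind-≤-split a x)) (ℕP.*-distribʳ-+ (φ N n x) (ind (x ℕ.≟ a)) _)) (upTo N) ⟩
    ∑ (upTo N) (λ x → ind (x ℕ.≟ a) * φ N n x + ind (suc a ℕ.≤? x) * φ N n x)
      ≡⟨ ∑-+ (upTo N) _ _ ⟩
    ∑ (upTo N) (λ x → ind (x ℕ.≟ a) * φ N n x) + ∑ (upTo N) (λ x → ind (suc a ℕ.≤? x) * φ N n x)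
      ≡⟨ cong₂ _+_ (∑-upTo-pick N a (φ N n) a<N) (sym (expand N (suc a) n)) ⟩
    φ N n a + chainSum N (suc a) (suc n) ∎

  sum-chains : {N n : ℕ} {P : (Fin n → Fin N) → Set} (P? : Decidable P) (a : ℕ) →
    (∀ f → (P f → Chain a (toWord f)) × (Chain a (toWord f) → P f)) →
    ∑ (filter P? (funs (allFin N) n)) (λ f → product (map (weight ∘ toℕ ∘ f) (allFin n))) ≡ chainSum N a n
  sum-chains {N} {n} P? a h = begin
    ∑ (filter P? (funs (allFin N) n)) (λ f → product (map (weight ∘ toℕ ∘ f) (allFin n)))
      ≡⟨ ∑-filter P? (funs (allFin N) n) _ ⟩
    ∑ (funs (allFin N) n) (λ f → ind (P? f) * product (map (weight ∘ toℕ ∘ f) (allFin n)))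
      ≡⟨ ∑-cong (λ f → cong₂ (λ b l → b * product l) (ind-cong (P? f) (chain? a (toWord f)) (proj₁ (h f)) (proj₂ (h f)))
           (trans (ListP.map-tabulate id (weight ∘ toℕ ∘ f)) (sym (ListP.map-tabulate (toℕ ∘ f) weight)))) (funs (allFin N) n) ⟩
    ∑ (funs (allFin N) n) (λ f → ind (chain? a (toWord f)) * weights (toWord f))
      ≡⟨ ∑-funs-words N n (λ l → ind (chain? a l) * weights l) ⟩
    chainSum N a n ∎

module Weak (t : ℕ) where
  open Chains id (λ x → suc x ^ t)

  chain⁺ : ∀ {n N} a (f : Fin n → Fin N) → (∀ i → a ≤ toℕ (f i)) → WeakIncr f → Chain a (toWord f)
  chain⁺ {zero}  a f lb inc = tt
  chain⁺ {suc n} a f lb inc = lb zero , chain⁺ _ (f ∘ suc) (λ i → inc zero (suc i) z≤n) (λ i j i≤j → inc (suc i) (suc j) (s≤s i≤j))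

  chain⁻ : ∀ {n N} a (f : Fin n → Fin N) → Chain a (toWord f) → (∀ i → a ≤ toℕ (f i)) × WeakIncr f
  chain⁻ {zero}  a f c = (λ ()) , λ ()
  chain⁻ {suc n} a f (p , c) with chain⁻ _ (f ∘ suc) c
  ... | lb , inc =
    (λ { zero → p ; (suc i) → ℕP.≤-trans p (lb i) }) ,
    (λ { zero zero _ → ℕP.≤-refl ; zero (suc j) _ → lb j ; (suc i) (suc j) (s≤s i≤j) → inc i j i≤j })

  -- The letters a, ..., a + d carry the weights (a+1)ᵗ, ..., (a+d+1)ᵗ, hence the offset `suc a`.
  -- Using the letter `a` keeps it available and lowers the degree; giving it up removes the first
  -- variable.
  chainSum-hom : ∀ a n d → chainSum (suc (a + d)) a n ≡ hom t (suc a) (n + d) d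
  chainSum-hom a zero    d       = sym (hom-diag t (suc a) d)
  chainSum-hom a (suc n) zero    = begin
    chainSum (suc (a + 0)) a (suc n)
      ≡⟨ chainSum-suc (suc (a + 0)) a n (s≤s (ℕP.m≤m+n a 0)) ⟩
    suc a ^ t * chainSum (suc (a + 0)) a n + chainSum (suc (a + 0)) (suc a) (suc n)
      ≡⟨ cong₂ (λ x y → suc a ^ t * x + y) (chainSum-hom a n 0)
           (trans (cong (λ z → chainSum (suc z) (suc a) (suc n)) (ℕP.+-identityʳ a)) (chainSum-empty (suc a) n)) ⟩
    suc a ^ t * hom t (suc a) (n + 0) 0 + 0
      ≡⟨ ℕP.+-identityʳ _ ⟩
    hom t (suc a) (suc n + 0) 0 ∎
  chainSum-hom a (suc n) (suc d) = begin
    chainSum (suc (a + suc d)) a (suc n)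
      ≡⟨ chainSum-suc (suc (a + suc d)) a n (s≤s (ℕP.m≤m+n a (suc d))) ⟩
    suc a ^ t * chainSum (suc (a + suc d)) a n + chainSum (suc (a + suc d)) (suc a) (suc n)
      ≡⟨ cong₂ (λ x y → suc a ^ t * x + y) (chainSum-hom a n (suc d))
           (trans (cong (λ z → chainSum (suc z) (suc a) (suc n)) (ℕP.+-suc a d))
             (trans (chainSum-hom (suc a) (suc n) d) (cong (λ z → hom t (suc (suc a)) z d) (sym (ℕP.+-suc n d))))) ⟩
    suc a ^ t * hom t (suc a) (n + suc d) (suc d) + hom t (suc (suc a)) (n + suc d) d
      ≡⟨ ℕP.+-comm (suc a ^ t * hom t (suc a) (n + suc d) (suc d)) _ ⟩
    hom t (suc a) (suc n + suc d) (suc d) ∎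

  weakSum-hom : 1 ≤ t → ∀ n k → weakSum t n (suc k) ≡ hom t 0 (n + suc k) (suc k)
  weakSum-hom 1≤t n k = begin
    weakSum t n (suc k)
      ≡⟨ sum-chains (weakIncr? {n} {suc k}) 0 (λ f → chain⁺ 0 f (λ _ → z≤n) , proj₂ ∘ chain⁻ 0 f) ⟩
    chainSum (suc k) 0 n             ≡⟨ chainSum-hom 0 n k ⟩
    hom t 1 (n + k) k                ≡⟨ sym (hom-shift t 1≤t (n + k) k) ⟩
    hom t 0 (suc (n + k)) (suc k)    ≡⟨ cong (λ z → hom t 0 z (suc k)) (sym (ℕP.+-suc n k)) ⟩
    hom t 0 (n + suc k) (suc k) ∎

module Strict (t : ℕ) where
  open Chains suc (_^ t)

  chain⁺ : ∀ {n N} a (f : Fin n → Fin N) → (∀ i → a ≤ toℕ (f i)) → (∀ i j → i F.< j → f i F.< f j) → Chain a (toWord f)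
  chain⁺ {zero}  a f lb inc = tt
  chain⁺ {suc n} a f lb inc = lb zero , chain⁺ _ (f ∘ suc) (λ i → inc zero (suc i) (s≤s z≤n)) (λ i j i<j → inc (suc i) (suc j) (s≤s i<j))

  chain⁻ : ∀ {n N} a (f : Fin n → Fin N) → Chain a (toWord f) → (∀ i → a ≤ toℕ (f i)) × (∀ i j → i F.< j → f i F.< f j)
  chain⁻ {zero}  a f c = (λ ()) , λ ()
  chain⁻ {suc n} a f (p , c) with chain⁻ _ (f ∘ suc) c
  ... | lb , inc =
    (λ { zero → p ; (suc i) → ℕP.≤-trans p (ℕP.<⇒≤ (lb i)) }) ,
    (λ { zero (suc j) _ → lb j ; (suc i) (suc j) (s≤s i<j) → inc i j i<j })

  -- The letters are a, ..., a + d - 1. A used letter is no longer available, so both summands of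
  -- `chainSum-suc` move on to a + 1, as in the recursion of `elemDeg`.
  chainSum-elemDeg : ∀ a d n → chainSum (a + d) a n ≡ elemDeg t a d n
  chainSum-elemDeg a d       zero    = refl
  chainSum-elemDeg a zero    (suc n) = trans (cong (λ z → chainSum z a (suc n)) (ℕP.+-identityʳ a)) (chainSum-empty a n)
  chainSum-elemDeg a (suc d) (suc n) = begin
    chainSum (a + suc d) a (suc n)
      ≡⟨ chainSum-suc (a + suc d) a n (subst (a <_) (sym (ℕP.+-suc a d)) (s≤s (ℕP.m≤m+n a d))) ⟩
    a ^ t * chainSum (a + suc d) (suc a) n + chainSum (a + suc d) (suc a) (suc n)
      ≡⟨ cong (λ z → a ^ t * chainSum z (suc a) n + chainSum z (suc a) (suc n)) (ℕP.+-suc a d) ⟩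
    a ^ t * chainSum (suc a + d) (suc a) n + chainSum (suc a + d) (suc a) (suc n)
      ≡⟨ cong₂ (λ x y → a ^ t * x + y) (chainSum-elemDeg (suc a) d n) (chainSum-elemDeg (suc a) d (suc n)) ⟩
    a ^ t * elemDeg t (suc a) d n + elemDeg t (suc a) d (suc n)
      ≡⟨ ℕP.+-comm (a ^ t * elemDeg t (suc a) d n) _ ⟩
    elemDeg t a (suc d) (suc n) ∎

  strictSum-elemDeg : 1 ≤ t → ∀ n k → strictSum t (suc n) k ≡ elemDeg t 0 (suc n) k
  strictSum-elemDeg 1≤t n k = begin
    strictSum t (suc n) k
      ≡⟨ sum-chains (strictIncrPos? {k} {suc n}) 1 (λ f → (λ { (lb , inc) → chain⁺ 1 f lb inc }) , chain⁻ 1 f) ⟩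
    chainSum (suc n) 1 k      ≡⟨ chainSum-elemDeg 1 n k ⟩
    elemDeg t 1 n k           ≡⟨ sym (elemDeg-shift t 1≤t n k) ⟩
    elemDeg t 0 (suc n) k ∎

-- Stirling permutations

occ : ℕ → List ℕ → ℕ
occ x []      = 0
occ x (a ∷ l) = ind (a ℕ.≟ x) + occ x l

-- Between the letter a in front and any later a there is no letter smaller than a.
Guarded : ℕ → List ℕ → Set
Guarded a []      = ⊤
Guarded a (b ∷ l) = (1 ≤ occ a l → a ≤ b) × Guarded a l

Stirling : List ℕ → Set
Stirling []      = ⊤
Stirling (a ∷ l) = Guarded a l × Stirling l

des : List ℕ → ℕ
des []          = 0
des (a ∷ [])    = 1
des (a ∷ b ∷ l) = ind (b ℕ.<? a) + des (b ∷ l)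

guarded? : ∀ a l → Dec (Guarded a l)
guarded? a []      = yes tt
guarded? a (b ∷ l) = ((1 ℕ.≤? occ a l) →-dec (a ℕ.≤? b)) ×-dec guarded? a l

stirling? : ∀ l → Dec (Stirling l)
stirling? []      = yes tt
stirling? (a ∷ l) = guarded? a l ×-dec stirling? l

Valid : ℕ → (ℕ → ℕ) → List ℕ → Set
Valid N κ l = (∀ {j} → j < N → occ j l ≡ κ j) × Stirling l

valid? : ∀ N κ l → Dec (Valid N κ l)
valid? N κ l = ℕP.allUpTo? (λ j → occ j l ℕ.≟ κ j) N ×-dec stirling? l

-- Weighting by an arbitrary function of the number of descents replaces the individual numbers
-- `A ks i`; choosing `W` yields either Stirling polynomial.
stirlingSum : (N K : ℕ) (κ W : ℕ → ℕ) → ℕ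
stirlingSum N K κ W = ∑ (words N K) (λ l → ind (valid? N κ l) * W (des l))

des≤length : ∀ l → des l ≤ length l
des≤length []          = z≤n
des≤length (a ∷ [])    = s≤s z≤n
des≤length (a ∷ b ∷ l) = ℕP.+-mono-≤ (ind≤1 (b ℕ.<? a)) (des≤length (b ∷ l))

1≤des : ∀ l → 1 ≤ length l → 1 ≤ des l
1≤des (a ∷ [])    _ = s≤s z≤n
1≤des (a ∷ b ∷ l) _ = ℕP.≤-trans (1≤des (b ∷ l) (s≤s z≤n)) (ℕP.m≤n+m _ (ind (b ℕ.<? a)))

occ-++ : ∀ x l m → occ x (l ++ m) ≡ occ x l + occ x m
occ-++ x []      m = refl
occ-++ x (a ∷ l) m = trans (cong (ind (a ℕ.≟ x) +_) (occ-++ x l m)) (sym (ℕP.+-assoc (ind (a ℕ.≟ x)) _ _))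

occ-all< : ∀ {N} l → All (_< N) l → occ N l ≡ 0
occ-all< []      []        = refl
occ-all< {N} (a ∷ l) (p ∷ ps) = cong₂ _+_ (ind-no (a ℕ.≟ N) (ℕP.<⇒≢ p)) (occ-all< l ps)

occ-head : ∀ a l → occ a (a ∷ l) ≡ suc (occ a l)
occ-head a l = cong (_+ occ a l) (ind-yes (a ℕ.≟ a) refl)

occ-skip : ∀ {x a} l → a ≢ x → occ x (a ∷ l) ≡ occ x l
occ-skip {x} {a} l a≢x = cong (_+ occ x l) (ind-no (a ℕ.≟ x) a≢x)

occ-replicate : ∀ r N → occ N (replicate r N) ≡ r
occ-replicate zero    N = refl
occ-replicate (suc r) N = trans (occ-head N (replicate r N)) (cong suc (occ-replicate r N))

occ-replicate-≢ : ∀ r {x N} → N ≢ x → occ x (replicate r N) ≡ 0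
occ-replicate-≢ zero    ne = refl
occ-replicate-≢ (suc r) {N = N} ne = trans (occ-skip (replicate r N) ne) (occ-replicate-≢ r ne)

gaps : List ℕ → List ℕ → List (List ℕ)
gaps w []      = [ w ]
gaps w (a ∷ l) = (w ++ a ∷ l) ∷ map (a ∷_) (gaps w l)

module Insertion (N : ℕ) where

  -- Run r l: l consists of r letters N followed by smaller ones;
  -- Block r l: the letters N in l form a single factor of length r + 1.
  Run : ℕ → List ℕ → Set
  Run zero    []      = ⊤
  Run zero    (a ∷ l) = a < N × Run zero l
  Run (suc r) []      = ⊥
  Run (suc r) (a ∷ l) = a ≡ N × Run r l

  Block : ℕ → List ℕ → Set
  Block r []      = ⊥
  Block r (a ∷ l) = (a < N × Block r l) ⊎ (a ≡ N × Run r l)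

  run? : ∀ r l → Dec (Run r l)
  run? zero    []      = yes tt
  run? zero    (a ∷ l) = (a ℕ.<? N) ×-dec run? zero l
  run? (suc r) []      = no λ ()
  run? (suc r) (a ∷ l) = (a ℕ.≟ N) ×-dec run? r l

  block? : ∀ r l → Dec (Block r l)
  block? r []      = no λ ()
  block? r (a ∷ l) = ((a ℕ.<? N) ×-dec block? r l) ⊎-dec ((a ℕ.≟ N) ×-dec run? r l)

  run-length : ∀ r l → Run r l → r ≤ length l
  run-length zero    l       _       = z≤n
  run-length (suc r) (a ∷ l) (_ , p) = s≤s (run-length r l p)

  block-length : ∀ r l → Block r l → r < length l
  block-length r (a ∷ l) (inj₁ (_ , p)) = ℕP.m<n⇒m<1+n (block-length r l p)
  block-length r (a ∷ l) (inj₂ (_ , p)) = s≤s (run-length r l p)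

  private
    ∑-first : ∀ K (G : List ℕ → ℕ) → ∑ (words (suc N) (suc K)) G ≡
      ∑ (upTo N) (λ a → ∑ (words (suc N) K) (λ l → G (a ∷ l))) + ∑ (words (suc N) K) (λ l → G (N ∷ l))
    ∑-first K G = trans (∑-words-suc (suc N) K G) (∑-upTo-last N _)

  ∑-run : ∀ r K (G : List ℕ → ℕ) →
    ∑ (words (suc N) (r + K)) (λ l → ind (run? r l) * G l) ≡ ∑ (words N K) (λ v → G (replicate r N ++ v))
  ∑-run zero zero    G = ℕP.+-identityʳ _
  ∑-run zero (suc K) G = begin
    ∑ (words (suc N) (suc K)) (λ l → ind (run? 0 l) * G l)
      ≡⟨ ∑-first K _ ⟩
    ∑ (upTo N) (λ a → ∑ (words (suc N) K) (λ l → ind (run? 0 (a ∷ l)) * G (a ∷ l)))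
      + ∑ (words (suc N) K) (λ l → ind (run? 0 (N ∷ l)) * G (N ∷ l))
      ≡⟨ cong₂ _+_
           (∑-upTo-cong N (λ a a<N → trans (∑-cong (λ l → cong (_* G (a ∷ l))
             (ind-cong (run? 0 (a ∷ l)) (run? 0 l) proj₂ (a<N ,_))) (words (suc N) K)) (∑-run zero K (λ l → G (a ∷ l)))))
           (trans (∑-cong (λ l → cong (_* G (N ∷ l)) (ind-no (run? 0 (N ∷ l)) (ℕP.<-irrefl refl ∘ proj₁))) (words (suc N) K))
             (∑-zero (words (suc N) K))) ⟩
    ∑ (upTo N) (λ a → ∑ (words N K) (λ v → G (a ∷ v))) + 0
      ≡⟨ ℕP.+-identityʳ _ ⟩
    ∑ (upTo N) (λ a → ∑ (words N K) (λ v → G (a ∷ v)))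
      ≡⟨ sym (∑-words-suc N K G) ⟩
    ∑ (words N (suc K)) G ∎
  ∑-run (suc r) K G = begin
    ∑ (words (suc N) (suc r + K)) (λ l → ind (run? (suc r) l) * G l)
      ≡⟨ ∑-first (r + K) _ ⟩
    ∑ (upTo N) (λ a → ∑ (words (suc N) (r + K)) (λ l → ind (run? (suc r) (a ∷ l)) * G (a ∷ l)))
      + ∑ (words (suc N) (r + K)) (λ l → ind (run? (suc r) (N ∷ l)) * G (N ∷ l))
      ≡⟨ cong₂ _+_
           (trans (∑-upTo-cong N (λ a a<N → trans (∑-cong (λ l → cong (_* G (a ∷ l))
             (ind-no (run? (suc r) (a ∷ l)) (ℕP.<⇒≢ a<N ∘ proj₁))) (words (suc N) (r + K))) (∑-zero (words (suc N) (r + K)))))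
             (∑-zero (upTo N)))
           (∑-cong (λ l → cong (_* G (N ∷ l)) (ind-cong (run? (suc r) (N ∷ l)) (run? r l) proj₂ (refl ,_))) (words (suc N) (r + K))) ⟩
    ∑ (words (suc N) (r + K)) (λ l → ind (run? r l) * G (N ∷ l))
      ≡⟨ ∑-run r K (λ l → G (N ∷ l)) ⟩
    ∑ (words N K) (λ v → G (replicate (suc r) N ++ v)) ∎

  -- A word whose letters `N` form one block arises from exactly one word of smaller letters and one
  -- gap. The induction looks at the first letter: if it is `N`, the block stands in the first gap;
  -- otherwise the gap lies further to the right.
  ∑-block : ∀ r K (G : List ℕ → ℕ) →
    ∑ (words (suc N) (suc r + K)) (λ l → ind (block? r l) * G l)
      ≡ ∑ (words N K) (λ l → ∑ (gaps (replicate (suc r) N) l) G)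
  ∑-block r K G = begin
    ∑ (words (suc N) (suc r + K)) (λ l → ind (block? r l) * G l)
      ≡⟨ ∑-first (r + K) _ ⟩
    ∑ (upTo N) (λ a → ∑ (words (suc N) (r + K)) (λ l → ind (block? r (a ∷ l)) * G (a ∷ l)))
      + ∑ (words (suc N) (r + K)) (λ l → ind (block? r (N ∷ l)) * G (N ∷ l))
      ≡⟨ cong₂ _+_
           (∑-upTo-cong N (λ a a<N → ∑-cong (λ l → cong (_* G (a ∷ l)) (ind-cong (block? r (a ∷ l)) (block? r l)
             [ proj₂ , (λ { (a≡N , _) → contradiction a≡N (ℕP.<⇒≢ a<N) }) ]′ (λ p → inj₁ (a<N , p)))) (words (suc N) (r + K))))
           (trans (∑-cong (λ l → cong (_* G (N ∷ l)) (ind-cong (block? r (N ∷ l)) (run? r l)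
             [ (λ { (N<N , _) → contradiction N<N (ℕP.<-irrefl refl) }) , proj₂ ]′ (λ p → inj₂ (refl , p)))) (words (suc N) (r + K)))
             (∑-run r K (λ l → G (N ∷ l)))) ⟩
    ∑ (upTo N) (λ a → ∑ (words (suc N) (r + K)) (λ l → ind (block? r l) * G (a ∷ l)))
      + ∑ (words N K) (λ v → G (replicate (suc r) N ++ v))
      ≡⟨ rest K ⟩
    ∑ (words N K) (λ l → ∑ (gaps (replicate (suc r) N) l) G) ∎
    where
    rest : ∀ K → ∑ (upTo N) (λ a → ∑ (words (suc N) (r + K)) (λ l → ind (block? r l) * G (a ∷ l)))
      + ∑ (words N K) (λ v → G (replicate (suc r) N ++ v)) ≡ ∑ (words N K) (λ l → ∑ (gaps (replicate (suc r) N) l) G)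
    -- With K = 0 only r letters follow a smaller first letter, too few for a block of length r + 1,
    -- so that sum vanishes.
    rest zero = cong₂ _+_ (trans (∑-cong (λ a → trans (∑-words-cong (suc N) (r + 0) (λ l len _ → cong (_* G (a ∷ l))
        (ind-no (block? r l) (λ p → ℕP.<-irrefl (sym (trans len (ℕP.+-identityʳ r))) (block-length r l p)))))
        (∑-zero (words (suc N) (r + 0)))) (upTo N)) (∑-zero (upTo N)))
      (trans (cong (λ l → G l + 0) (ListP.++-identityʳ (replicate (suc r) N))) (sym (ℕP.+-identityʳ _)))
    rest (suc K) = begin
      ∑ (upTo N) (λ a → ∑ (words (suc N) (r + suc K)) (λ l → ind (block? r l) * G (a ∷ l)))
        + ∑ (words N (suc K)) (λ v → G (replicate (suc r) N ++ v))
        ≡⟨ cong₂ _+_ (∑-cong (λ a → trans (cong (λ z → ∑ (words (suc N) z) (λ l → ind (block? r l) * G (a ∷ l))) (ℕP.+-suc r K))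
             (∑-block r K (λ l → G (a ∷ l)))) (upTo N)) (∑-words-suc N K _) ⟩
      ∑ (upTo N) (λ a → ∑ (words N K) (λ l → ∑ (gaps (replicate (suc r) N) l) (λ l′ → G (a ∷ l′))))
        + ∑ (upTo N) (λ a → ∑ (words N K) (λ l → G (replicate (suc r) N ++ a ∷ l)))
        ≡⟨ ℕP.+-comm (∑ (upTo N) (λ a → ∑ (words N K) (λ l → ∑ (gaps (replicate (suc r) N) l) (λ l′ → G (a ∷ l′))))) _ ⟩
      _ ≡⟨ sym (∑-+ (upTo N) _ _) ⟩
      _ ≡⟨ ∑-cong (λ a → trans (sym (∑-+ (words N K) _ _)) (∑-cong (λ l → cong (G (replicate (suc r) N ++ a ∷ l) +_)
             (sym (∑-map (a ∷_) (gaps (replicate (suc r) N) l) G))) (words N K))) (upTo N) ⟩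
      ∑ (upTo N) (λ a → ∑ (words N K) (λ l → ∑ (gaps (replicate (suc r) N) (a ∷ l)) G))
        ≡⟨ sym (∑-words-suc N K (λ l → ∑ (gaps (replicate (suc r) N) l) G)) ⟩
      ∑ (words N (suc K)) (λ l → ∑ (gaps (replicate (suc r) N) l) G) ∎

  guarded⇒run : ∀ r l → Guarded N l → occ N l ≡ r → All (_< suc N) l → Run r l
  guarded⇒run zero    []      g o _ = tt
  guarded⇒run zero    (a ∷ l) (g , gs) o (p ∷ ps) with a ℕ.≟ N
  ... | yes refl = contradiction (trans (sym (occ-head a l)) o) λ ()
  ... | no ne    = ℕP.≤∧≢⇒< (ℕ.s≤s⁻¹ p) ne , guarded⇒run zero l gs (trans (sym (occ-skip l ne)) o) ps
  guarded⇒run (suc r) (a ∷ l) (g , gs) o (p ∷ ps) with a ℕ.≟ N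
  ... | yes refl = refl , guarded⇒run r l gs (ℕP.suc-injective (trans (sym (occ-head a l)) o)) ps
  ... | no ne    = contradiction
    (ℕP.≤-antisym (ℕ.s≤s⁻¹ p) (g (subst (1 ≤_) (trans (sym o) (occ-skip l ne)) (s≤s z≤n)))) ne

  -- A letter between two copies of the largest letter `N` must be at least `N`, hence equal to it;
  -- so the copies are adjacent.
  stirling⇒block : ∀ r l → Stirling l → occ N l ≡ suc r → All (_< suc N) l → Block r l
  stirling⇒block r (a ∷ l) (g , st) o (p ∷ ps) with a ℕ.≟ N
  ... | yes refl = inj₂ (refl , guarded⇒run r l g (ℕP.suc-injective (trans (sym (occ-head a l)) o)) ps)
  ... | no ne    = inj₁ (ℕP.≤∧≢⇒< (ℕ.s≤s⁻¹ p) ne , stirling⇒block r l st (trans (sym (occ-skip l ne)) o) ps)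

  module _ (r : ℕ) where

    private
      blk : List ℕ
      blk = replicate (suc r) N

    -- The facts about an insertion that survive when a smaller letter is put in front of both
    -- words, so that one induction along the gaps proves them together. For a letter below `N` the
    -- inserted letters are never too small and do not change its occurrences.
    record Similar (l l′ : List ℕ) : Set where
      field
        occs      : ∀ j → occ j l′ ≡ occ j blk + occ j l
        guarded⁺  : ∀ {a} → a < N → Guarded a l → Guarded a l′
        guarded⁻  : ∀ {a} → a < N → Guarded a l′ → Guarded a l
        stirling⁺ : Stirling l → Stirling l′
        stirling⁻ : Stirling l′ → Stirling l

    occ-small : ∀ {a} → a < N → occ a blk ≡ 0
    occ-small a<N = occ-replicate-≢ (suc r) (λ e → ℕP.<⇒≢ a<N (sym e))

    private
      prefix-guarded⁺ : ∀ k {a} m → a < N → Guarded a m → Guarded a (replicate k N ++ m)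
      prefix-guarded⁺ zero    m a<N g = g
      prefix-guarded⁺ (suc k) m a<N g = (λ _ → ℕP.<⇒≤ a<N) , prefix-guarded⁺ k m a<N g

      prefix-guarded⁻ : ∀ k {a} m → Guarded a (replicate k N ++ m) → Guarded a m
      prefix-guarded⁻ zero    m g       = g
      prefix-guarded⁻ (suc k) m (_ , g) = prefix-guarded⁻ k m g

      tail-guarded : ∀ m → All (_< N) m → Guarded N m
      tail-guarded []      []       = tt
      tail-guarded (b ∷ m) (p ∷ ps) = (λ o → contradiction (subst (1 ≤_) (occ-all< m ps) o) λ ()) , tail-guarded m ps

      prefix-guarded-N : ∀ k m → All (_< N) m → Guarded N (replicate k N ++ m)
      prefix-guarded-N zero    m ps = tail-guarded m ps
      prefix-guarded-N (suc k) m ps = (λ _ → ℕP.≤-refl) , prefix-guarded-N k m ps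

      prefix-stirling⁺ : ∀ k m → All (_< N) m → Stirling m → Stirling (replicate k N ++ m)
      prefix-stirling⁺ zero    m ps st = st
      prefix-stirling⁺ (suc k) m ps st = prefix-guarded-N k m ps , prefix-stirling⁺ k m ps st

      prefix-stirling⁻ : ∀ k m → Stirling (replicate k N ++ m) → Stirling m
      prefix-stirling⁻ zero    m st       = st
      prefix-stirling⁻ (suc k) m (_ , st) = prefix-stirling⁻ k m st

      prefix-similar : ∀ m → All (_< N) m → Similar m (blk ++ m)
      prefix-similar m ps = record
        { occs      = λ j → occ-++ j blk m
        ; guarded⁺  = prefix-guarded⁺ (suc r) m
        ; guarded⁻  = λ _ → prefix-guarded⁻ (suc r) m
        ; stirling⁺ = prefix-stirling⁺ (suc r) m ps
        ; stirling⁻ = prefix-stirling⁻ (suc r) m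
        }

      cons-similar : ∀ {a l l′} → a < N → Similar l l′ → Similar (a ∷ l) (a ∷ l′)
      cons-similar {a} {l} {l′} a<N s = record
        { occs      = λ j → trans (cong (ind (a ℕ.≟ j) +_) (occs j)) (exch (ind (a ℕ.≟ j)) (occ j blk) (occ j l))
        ; guarded⁺  = λ c<N (g , gs) → (λ o → g (subst (1 ≤_) (same c<N) o)) , guarded⁺ c<N gs
        ; guarded⁻  = λ c<N (g , gs) → (λ o → g (subst (1 ≤_) (sym (same c<N)) o)) , guarded⁻ c<N gs
        ; stirling⁺ = λ (g , st) → guarded⁺ a<N g , stirling⁺ st
        ; stirling⁻ = λ (g , st) → guarded⁻ a<N g , stirling⁻ st
        }
        where
        open Similar s
        exch : ∀ x y z → x + (y + z) ≡ y + (x + z)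
        exch = solve-∀
        same : ∀ {c} → c < N → occ c l′ ≡ occ c l
        same {c} c<N = trans (occs c) (cong (_+ occ c l) (occ-small c<N))

    gaps-similar : ∀ l → All (_< N) l → All (Similar l) (gaps blk l)
    gaps-similar []      []       = subst (Similar []) (ListP.++-identityʳ blk) (prefix-similar [] []) ∷ []
    gaps-similar (a ∷ l) (p ∷ ps) = prefix-similar (a ∷ l) (p ∷ ps) ∷ AllP.map⁺ (All.map (cons-similar p) (gaps-similar l ps))

    private
      N≮ : ∀ {a} → a < N → ind (N ℕ.<? a) ≡ 0
      N≮ a<N = ind-no (N ℕ.<? _) (ℕP.<-asym a<N)

    des-prefix : ∀ {a} k l → a < N → des (replicate (suc k) N ++ a ∷ l) ≡ suc (des (a ∷ l))
    des-prefix {a} zero    l a<N = cong (_+ des (a ∷ l)) (ind-yes (a ℕ.<? N) a<N)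
    des-prefix     (suc k) l a<N = cong₂ _+_ (ind-no (N ℕ.<? N) (ℕP.<-irrefl refl)) (des-prefix k l a<N)

    des-blk : ∀ k → des (replicate (suc k) N) ≡ 1
    des-blk zero    = refl
    des-blk (suc k) = cong₂ _+_ (ind-no (N ℕ.<? N) (ℕP.<-irrefl refl)) (des-blk k)

    private
      ascent-step : ∀ {d L} (x y : ℕ) → d ≤ L → x + (d * y + (L ∸ d) * x) ≡ d * y + (suc L ∸ d) * x
      ascent-step {d} {L} x y d≤L rewrite ℕP.+-∸-assoc 1 d≤L = rearrange x (d * y) ((L ∸ d) * x)
        where
        rearrange : ∀ a b c → a + (b + c) ≡ b + (a + c)
        rearrange = solve-∀

    -- Inserting the block at a descent preserves the number of descents, at any other place it adds one.
    ∑-gaps-inner : ∀ a l (W : ℕ → ℕ) → a < N → All (_< N) l →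
      ∑ (gaps blk l) (λ l′ → W (des (a ∷ l′)))
        ≡ des (a ∷ l) * W (des (a ∷ l)) + (length (a ∷ l) ∸ des (a ∷ l)) * W (suc (des (a ∷ l)))
    ∑-gaps-inner a [] W a<N [] = trans (cong (λ z → W z + 0) (cong₂ _+_ (N≮ a<N) (des-blk r)))
      (sym (trans (ℕP.+-identityʳ _) refl))
    ∑-gaps-inner a (b ∷ l) W a<N (b<N ∷ ps) = begin
      W (des (a ∷ blk ++ b ∷ l)) + ∑ (map (b ∷_) (gaps blk l)) (λ l′ → W (des (a ∷ l′)))
        ≡⟨ cong₂ _+_ (cong W (cong₂ _+_ (N≮ a<N) (des-prefix r l b<N))) (∑-map (b ∷_) (gaps blk l) _) ⟩
      W (suc d) + ∑ (gaps blk l) (λ l′ → W (e + des (b ∷ l′)))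
        ≡⟨ cong (W (suc d) +_) (∑-gaps-inner b l (λ z → W (e + z)) b<N ps) ⟩
      W (suc d) + (d * W (e + d) + (L ∸ d) * W (e + suc d))
        ≡⟨ finish (b ℕ.<? a) ⟩
      (e + d) * W (e + d) + (suc L ∸ (e + d)) * W (suc (e + d)) ∎
      where
      e d L : ℕ
      e = ind (b ℕ.<? a)
      d = des (b ∷ l)
      L = length (b ∷ l)
      finish : (D : Dec (b < a)) → W (suc d) + (d * W (ind D + d) + (L ∸ d) * W (ind D + suc d))
        ≡ (ind D + d) * W (ind D + d) + (suc L ∸ (ind D + d)) * W (suc (ind D + d))
      -- If b < a, the gap between a and b is a descent and its term joins the first group; in the
      -- other case it joins the second group, whose size grows by one.
      finish (yes _) = sym (ℕP.+-assoc (W (suc d)) (d * W (suc d)) _)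
      finish (no _)  = ascent-step {d} {L} (W (suc d)) (W d) (des≤length (b ∷ l))

    -- Besides one gap after each letter there is the gap in front, where the block always adds a
    -- descent; hence `suc (length l)` gaps in all.
    ∑-gaps : ∀ l (W : ℕ → ℕ) → All (_< N) l →
      ∑ (gaps blk l) (W ∘ des) ≡ des l * W (des l) + (suc (length l) ∸ des l) * W (suc (des l))
    ∑-gaps []      W []       = cong (λ z → W z + 0) (des-blk r)
    ∑-gaps (a ∷ l) W (p ∷ ps) = trans
      (cong₂ _+_ (cong W (des-prefix r l p)) (trans (∑-map (a ∷_) (gaps blk l) _) (∑-gaps-inner a l W p ps)))
      (ascent-step {des (a ∷ l)} {length (a ∷ l)} (W (suc (des (a ∷ l)))) (W (des (a ∷ l))) (des≤length (a ∷ l)))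

    valid-gap : ∀ {κ κ′ : ℕ → ℕ} → (∀ {j} → j < N → κ′ j ≡ κ j) → κ′ N ≡ suc r → ∀ {l l′} → All (_< N) l → Similar l l′ →
      ind (valid? (suc N) κ′ l′) ≡ ind (valid? N κ l)
    valid-gap {κ} {κ′} κ< κN {l} {l′} ps s = ind-cong (valid? (suc N) κ′ l′) (valid? N κ l)
      (λ (o , st) → (λ {j} j<N → trans (sym (same j<N)) (trans (o (ℕP.m<n⇒m<1+n j<N)) (κ< j<N))) , stirling⁻ st)
      (λ (o , st) → (λ {j} j<1+N → up o j (ℕP.m≤n⇒m<n∨m≡n (ℕ.s≤s⁻¹ j<1+N))) , stirling⁺ st)
      where
      open Similar s
      same : ∀ {j} → j < N → occ j l′ ≡ occ j l
      same {j} j<N = trans (occs j) (cong (_+ occ j l) (occ-small j<N))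
      up : (∀ {j} → j < N → occ j l ≡ κ j) → ∀ j → j < N ⊎ j ≡ N → occ j l′ ≡ κ′ j
      up o j (inj₁ j<N)  = trans (same j<N) (trans (o j<N) (sym (κ< j<N)))
      up o j (inj₂ refl) = trans (occs N) (trans (cong₂ _+_ (occ-replicate (suc r) N) (occ-all< l ps))
        (trans (ℕP.+-identityʳ _) (sym κN)))

    -- The Eulerian-type recursion in dual form: it transforms the weight instead of relating
    -- numbers of words. The multiplicity `suc r` enters only through the length of the words, since
    -- a whole block affects descents like a single letter.
    stirlingSum-insert : ∀ K (κ κ′ W : ℕ → ℕ) → (∀ {j} → j < N → κ′ j ≡ κ j) → κ′ N ≡ suc r →
      stirlingSum (suc N) (suc r + K) κ′ W ≡ stirlingSum N K κ (λ d → d * W d + (suc K ∸ d) * W (suc d))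
    stirlingSum-insert K κ κ′ W κ< κN = begin
      ∑ (words (suc N) (suc r + K)) G
        -- A valid word has its largest letters in one block, so restricting the sum by `block?`
        -- loses nothing.
        ≡⟨ ∑-words-cong (suc N) (suc r + K) (λ l _ ps → onBlock l ps) ⟩
      ∑ (words (suc N) (suc r + K)) (λ l → ind (block? r l) * G l)
        ≡⟨ ∑-block r K G ⟩
      ∑ (words N K) (λ l → ∑ (gaps blk l) G)
        ≡⟨ ∑-words-cong N K (λ l len ps → begin
             ∑ (gaps blk l) G
               ≡⟨ ∑-cong-All (All.map (λ {l′} s → cong (_* W (des l′)) (valid-gap κ< κN ps s)) (gaps-similar l ps)) ⟩
             ∑ (gaps blk l) (λ l′ → ind (valid? N κ l) * W (des l′))
               ≡⟨ ∑-*ˡ (ind (valid? N κ l)) (gaps blk l) (W ∘ des) ⟩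
             ind (valid? N κ l) * ∑ (gaps blk l) (W ∘ des)
               ≡⟨ cong (ind (valid? N κ l) *_) (trans (∑-gaps l W ps)
                    (cong (λ z → des l * W (des l) + (suc z ∸ des l) * W (suc (des l))) len)) ⟩
             ind (valid? N κ l) * (des l * W (des l) + (suc K ∸ des l) * W (suc (des l))) ∎) ⟩
      stirlingSum N K κ (λ d → d * W d + (suc K ∸ d) * W (suc d)) ∎
      where
      G : List ℕ → ℕ
      G l = ind (valid? (suc N) κ′ l) * W (des l)
      onBlock : ∀ l → All (_< suc N) l → G l ≡ ind (block? r l) * G l
      onBlock l ps = go (valid? (suc N) κ′ l)
        where
        go : (D : Dec (Valid (suc N) κ′ l)) → ind D * W (des l) ≡ ind (block? r l) * (ind D * W (des l))
        go (no _)         = sym (ℕP.*-zeroʳ (ind (block? r l)))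
        go (yes (o , st)) = sym (trans (cong (_* (1 * W (des l)))
          (ind-yes (block? r l) (stirling⇒block r l st (trans (o (ℕP.n<1+n N)) κN) ps))) (ℕP.*-identityˡ _))

-- Coefficients of xⁱ / (1 − x)ᴷ⁺¹

coefX-suc : ∀ K i m → coefX K (suc i) (suc m) ≡ coefX K i m
coefX-suc K zero    m = refl
coefX-suc K (suc i) m = refl

nC0≡1 : ∀ n → n C 0 ≡ 1
nC0≡1 n = trans (nCk≡nC[n∸k] {0} {n} z≤n) (nCn≡1 n)

absorption : ∀ n k → suc k * (suc n C suc k) ≡ suc n * (n C k)
absorption zero    zero    = refl
absorption zero    (suc k) = trans (cong (suc (suc k) *_) (k>n⇒nCk≡0 (s≤s (s≤s (z≤n {k})))))
  (trans (ℕP.*-zeroʳ (suc (suc k))) (sym (trans (ℕP.+-identityʳ _) (k>n⇒nCk≡0 (s≤s (z≤n {k}))))))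
absorption (suc n) zero    = trans (ℕP.+-identityʳ _) (trans (nC1≡n (suc (suc n)))
  (sym (trans (cong (suc (suc n) *_) (nC0≡1 (suc n))) (ℕP.*-identityʳ _))))
absorption (suc n) (suc k) = begin
  suc (suc k) * (suc (suc n) C suc (suc k))
    ≡⟨ cong (suc (suc k) *_) (sym (nCk+nC[k+1]≡[n+1]C[k+1] (suc n) (suc k))) ⟩
  suc (suc k) * (suc n C suc k + suc n C suc (suc k))
    ≡⟨ split (suc k) (suc n C suc k) (suc n C suc (suc k)) ⟩
  suc n C suc k + (suc k * (suc n C suc k) + suc (suc k) * (suc n C suc (suc k)))
    ≡⟨ cong₂ (λ x y → suc n C suc k + (x + y)) (absorption n k) (absorption n (suc k)) ⟩
  suc n C suc k + (suc n * (n C k) + suc n * (n C suc k))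
    ≡⟨ cong (suc n C suc k +_) (trans (sym (ℕP.*-distribˡ-+ (suc n) (n C k) _))
         (cong (suc n *_) (nCk+nC[k+1]≡[n+1]C[k+1] n k))) ⟩
  suc (suc n) * (suc n C suc k) ∎
  where
  split : ∀ a x y → suc a * (x + y) ≡ x + (a * x + suc a * y)
  split = solve-∀

-- After adding (K+1) C(j+K, K) to both sides, Pascal's rule turns the left one into the left side
-- of `absorption`.
next-C : ∀ j K → suc K * ((j + K) C suc K) ≡ j * ((j + K) C K)
next-C j K = ℕP.+-cancelˡ-≡ (suc K * ((j + K) C K)) _ _ (begin
  suc K * ((j + K) C K) + suc K * ((j + K) C suc K)
    ≡⟨ sym (ℕP.*-distribˡ-+ (suc K) ((j + K) C K) _) ⟩
  suc K * ((j + K) C K + (j + K) C suc K)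
    ≡⟨ cong (suc K *_) (nCk+nC[k+1]≡[n+1]C[k+1] (j + K) K) ⟩
  suc K * (suc (j + K) C suc K)
    ≡⟨ absorption (j + K) K ⟩
  suc (j + K) * ((j + K) C K)
    ≡⟨ regroup j K ((j + K) C K) ⟩
  suc K * ((j + K) C K) + j * ((j + K) C K) ∎)
  where
  regroup : ∀ j K x → suc (j + K) * x ≡ suc K * x + j * x
  regroup = solve-∀

coefX-+ : ∀ K i j → coefX K i (i + j) ≡ (j + K) C K
coefX-+ K zero    j = refl
coefX-+ K (suc i) j = trans (coefX-suc K i (i + j)) (coefX-+ K i j)

-- For j = 0 the exponent exceeds the index by one; the default value 0 of `coefX` then agrees with
-- the binomial coefficient C(K, K+1).
coefX-suc-+ : ∀ K i j → coefX (suc K) (suc i) (i + j) ≡ (j + K) C suc K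
coefX-suc-+ K zero    zero    = sym (k>n⇒nCk≡0 (ℕP.n<1+n K))
coefX-suc-+ K zero    (suc j) = cong (_C suc K) (ℕP.+-suc j K)
coefX-suc-+ K (suc i) j       = trans (coefX-suc (suc K) (suc i) (i + j)) (coefX-suc-+ K i j)

coefX-above : ∀ K {i m} → m < i → coefX K i m ≡ 0
coefX-above K {suc i} {zero}  _         = refl
coefX-above K {suc i} {suc m} (s≤s m<i) = trans (coefX-suc K i m) (coefX-above K m<i)

-- Coefficientwise form of x d/dx (xⁱ / (1−x)ᴷ⁺¹) = (i xⁱ + (K+1−i) xⁱ⁺¹) / (1−x)ᴷ⁺².
coefX-derivative : ∀ K i m → i ≤ suc K →
  i * coefX (suc K) i m + (suc K ∸ i) * coefX (suc K) (suc i) m ≡ m * coefX K i m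
coefX-derivative K i m i≤ with ℕP.≤-<-connex i m
... | inj₂ m<i = trans
  (cong₂ (λ x y → i * x + (suc K ∸ i) * y) (coefX-above (suc K) m<i) (coefX-above (suc K) (ℕP.m<n⇒m<1+n m<i)))
  (trans (cong₂ _+_ (ℕP.*-zeroʳ i) (ℕP.*-zeroʳ (suc K ∸ i))) (sym (trans (cong (m *_) (coefX-above K m<i)) (ℕP.*-zeroʳ m))))
... | inj₁ i≤m with ℕP.m≤n⇒∃[o]m+o≡n i≤m
...   | j , refl = begin
  i * coefX (suc K) i (i + j) + (suc K ∸ i) * coefX (suc K) (suc i) (i + j)
    ≡⟨ cong₂ (λ x y → i * x + (suc K ∸ i) * y)
         (trans (coefX-+ (suc K) i j) (trans (cong (_C suc K) (ℕP.+-suc j K)) (sym (nCk+nC[k+1]≡[n+1]C[k+1] (j + K) K))))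
         (coefX-suc-+ K i j) ⟩
  i * (x + y) + (suc K ∸ i) * y        ≡⟨ regroup i (suc K ∸ i) x y ⟩
  i * x + (i + (suc K ∸ i)) * y        ≡⟨ cong (λ z → i * x + z * y) (ℕP.m+[n∸m]≡n i≤) ⟩
  i * x + suc K * y                    ≡⟨ cong (i * x +_) (next-C j K) ⟩
  i * x + j * x                        ≡⟨ sym (ℕP.*-distribʳ-+ x i j) ⟩
  (i + j) * x                          ≡⟨ cong ((i + j) *_) (sym (coefX-+ K i j)) ⟩
  (i + j) * coefX K i (i + j) ∎
  where
  x y : ℕ
  x = (j + K) C K
  y = (j + K) C suc K
  regroup : ∀ i q x y → i * (x + y) + q * y ≡ i * x + (i + q) * y
  regroup = solve-∀

-- Multiplying xⁱ / (1-x)ᴷ⁺² by 1 - x lowers the power of the denominator by one; on coefficients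
-- this is a first difference.
coefX-difference : ∀ K i m → coefX (suc K) i (suc m) ≡ coefX (suc K) i m + coefX K i (suc m)
coefX-difference K zero    m       = begin
  (suc m + suc K) C suc K                      ≡⟨ cong (λ z → suc z C suc K) (ℕP.+-suc m K) ⟩
  suc (suc (m + K)) C suc K                    ≡⟨ sym (nCk+nC[k+1]≡[n+1]C[k+1] (suc (m + K)) K) ⟩
  suc (m + K) C K + suc (m + K) C suc K        ≡⟨ ℕP.+-comm (suc (m + K) C K) _ ⟩
  suc (m + K) C suc K + suc (m + K) C K        ≡⟨ cong (λ z → z C suc K + suc (m + K) C K) (sym (ℕP.+-suc m K)) ⟩
  (m + suc K) C suc K + (suc m + K) C K ∎
coefX-difference K (suc zero)    zero    = trans (nCn≡1 (suc K)) (sym (nCn≡1 K))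
coefX-difference K (suc (suc i)) zero    = refl
coefX-difference K (suc i)       (suc m) = trans (coefX-suc (suc K) i (suc m)) (trans (coefX-difference K i m)
  (sym (cong₂ _+_ (coefX-suc (suc K) i m) (coefX-suc K i (suc m)))))

-- Words as functions on positions and as lists

count-occ : ∀ {K N} (w : Fin K → Fin N) (j : Fin N) → countFin (λ p → w p FP.≟ j) ≡ occ (toℕ j) (toWord w)
count-occ w j = trans (countL-∑ (λ p → w p FP.≟ j) (allFin _)) (go w)
  where
  go : ∀ {K} (w : Fin K → Fin _) → ∑ (allFin K) (λ p → ind (w p FP.≟ j)) ≡ occ (toℕ j) (toWord w)
  go {zero}  w = refl
  go {suc K} w = trans (∑-allFin-suc {K} (λ p → ind (w p FP.≟ j)))
    (cong₂ _+_ (ind-cong (w zero FP.≟ j) (toℕ (w zero) ℕ.≟ toℕ j) (cong toℕ) FP.toℕ-injective) (go (w ∘ suc)))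

occ⁺ : ∀ {K N} (v : Fin K → Fin N) j → 1 ≤ occ (toℕ (v j)) (toWord v)
occ⁺ v zero    = subst (1 ≤_) (sym (occ-head (toℕ (v zero)) (toWord (v ∘ suc)))) (s≤s z≤n)
occ⁺ v (suc j) = ℕP.≤-trans (occ⁺ (v ∘ suc) j) (ℕP.m≤n+m _ (ind (toℕ (v zero) ℕ.≟ toℕ (v (suc j)))))

occ⁻ : ∀ {K N} (v : Fin K → Fin N) a → 1 ≤ occ a (toWord v) → ∃ λ j → a ≡ toℕ (v j)
occ⁻ {suc K} v a o with toℕ (v zero) ℕ.≟ a
... | yes e = zero , sym e
... | no ne with occ⁻ (v ∘ suc) a (subst (1 ≤_) (occ-skip (toWord (v ∘ suc)) ne) o)
...   | j , e = suc j , e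

guarded⁺ : ∀ {K N} (v : Fin K → Fin N) a → (∀ r j → r F.< j → a ≡ toℕ (v j) → a ≤ toℕ (v r)) → Guarded a (toWord v)
guarded⁺ {zero}  v a h = tt
guarded⁺ {suc K} v a h =
  (λ o → let (j , e) = occ⁻ (v ∘ suc) a o in h zero (suc j) (s≤s z≤n) e) ,
  guarded⁺ (v ∘ suc) a (λ r j r<j e → h (suc r) (suc j) (s≤s r<j) e)

guarded⁻ : ∀ {K N} (v : Fin K → Fin N) a → Guarded a (toWord v) → ∀ r j → r F.< j → a ≡ toℕ (v j) → a ≤ toℕ (v r)
guarded⁻ v _ (g , gs) zero    (suc j) _         refl = g (occ⁺ (v ∘ suc) j)
guarded⁻ v a (g , gs) (suc r) (suc j) (s≤s r<j) e    = guarded⁻ (v ∘ suc) a gs r j r<j e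

stirling⁺ : ∀ {K N} (w : Fin K → Fin N) → (∀ i r j → i F.< r → r F.< j → w i ≡ w j → w i F.≤ w r) → Stirling (toWord w)
stirling⁺ {zero}  w h = tt
stirling⁺ {suc K} w h =
  guarded⁺ (w ∘ suc) (toℕ (w zero)) (λ r j r<j e → h zero (suc r) (suc j) (s≤s z≤n) (s≤s r<j) (FP.toℕ-injective e)) ,
  stirling⁺ (w ∘ suc) (λ i r j i<r r<j → h (suc i) (suc r) (suc j) (s≤s i<r) (s≤s r<j))

stirling⁻ : ∀ {K N} (w : Fin K → Fin N) → Stirling (toWord w) → ∀ i r j → i F.< r → r F.< j → w i ≡ w j → w i F.≤ w r
stirling⁻ w (g , st) zero    (suc r) (suc j) _         (s≤s r<j) e = guarded⁻ (w ∘ suc) (toℕ (w zero)) g r j r<j (cong toℕ e)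
stirling⁻ w (g , st) (suc i) (suc r) (suc j) (s≤s i<r) (s≤s r<j) e = stirling⁻ (w ∘ suc) st i r j i<r r<j e

coeff-lookup : ∀ ks (j : Fin (length ks)) → coeff ks (toℕ j) ≡ lookup ks j
coeff-lookup (k ∷ ks) zero    = refl
coeff-lookup (k ∷ ks) (suc j) = coeff-lookup ks j

validWord? : ∀ ks l → Dec (Valid (length ks) (coeff ks) l)
validWord? ks = valid? (length ks) (coeff ks)

ind-stirling : ∀ ks (w : Word ks) → ind (isStirlingPerm? ks w) ≡ ind (validWord? ks (toWord w))
ind-stirling ks w = ind-cong (isStirlingPerm? ks w) (validWord? ks (toWord w))
  (λ (c , st) → (λ {j} j<N → subst (λ z → occ z (toWord w) ≡ coeff ks z) (FP.toℕ-fromℕ< j<N) (to c (F.fromℕ< j<N))) , stirling⁺ w st)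
  (λ (o , st) → (λ j → trans (count-occ w j) (trans (o (FP.toℕ<n j)) (coeff-lookup ks j))) , stirling⁻ w st)
  where
  to : (∀ j → countFin (λ p → w p FP.≟ j) ≡ lookup ks j) → ∀ j → occ (toℕ j) (toWord w) ≡ coeff ks (toℕ j)
  to c j = trans (sym (count-occ w j)) (trans (c j) (sym (coeff-lookup ks j)))

-- `Descent` with length and alphabet detached from a tuple, so that an induction can pass to the
-- tail of a word.
DescentAt : ∀ {K N} → (Fin K → Fin N) → Fin K → Set
DescentAt {K} w p = (suc (toℕ p) ≡ K) ⊎ (∃ λ q → (toℕ q ≡ suc (toℕ p)) × (w q F.< w p))

descentAt? : ∀ {K N} (w : Fin K → Fin N) → Decidable (DescentAt w)
descentAt? {K} w p = (suc (toℕ p) ℕ.≟ K) ⊎-dec FP.any? (λ q → (toℕ q ℕ.≟ suc (toℕ p)) ×-dec (w q FP.<? w p))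

∑-descents : ∀ {K N} (w : Fin K → Fin N) → ∑ (allFin K) (λ p → ind (descentAt? w p)) ≡ des (toWord w)
∑-descents {zero}        w = refl
∑-descents {suc zero}    w = trans (ℕP.+-identityʳ _) (ind-yes (descentAt? w zero) (inj₁ refl))
∑-descents {suc (suc K)} w = trans (∑-allFin-suc {suc K} (λ p → ind (descentAt? w p))) (cong₂ _+_
  (ind-cong (descentAt? w zero) (toℕ (w (suc zero)) ℕ.<? toℕ (w zero)) first (λ lt → inj₂ (suc zero , refl , lt)))
  (trans (∑-cong (λ p → ind-cong (descentAt? w (suc p)) (descentAt? (w ∘ suc) p) down up) (allFin (suc K))) (∑-descents (w ∘ suc))))
  where
  first : DescentAt w zero → w (suc zero) F.< w zero
  first (inj₁ ())
  first (inj₂ (suc zero , _ , lt)) = lt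
  first (inj₂ (suc (suc _) , () , _))
  down : ∀ {p} → DescentAt w (suc p) → DescentAt (w ∘ suc) p
  down (inj₁ e)                = inj₁ (ℕP.suc-injective e)
  down (inj₂ (suc q , e , lt)) = inj₂ (q , ℕP.suc-injective e , lt)
  up : ∀ {p} → DescentAt (w ∘ suc) p → DescentAt w (suc p)
  up (inj₁ e)            = inj₁ (cong suc e)
  up (inj₂ (q , e , lt)) = inj₂ (suc q , cong suc e , lt)

numDescents-des : ∀ ks (w : Word ks) → numDescents ks w ≡ des (toWord w)
numDescents-des ks w = trans (countL-∑ (descent? ks w) (allFin (sum ks))) (∑-descents w)

A-words : ∀ ks i → A ks i ≡ ∑ (words (length ks) (sum ks)) (λ l → ind (validWord? ks l) * ind (des l ℕ.≟ i))
A-words ks i = begin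
  A ks i
    ≡⟨ countL-∑ (λ w → isStirlingPerm? ks w ×-dec (numDescents ks w ℕ.≟ i)) (funs (allFin (length ks)) (sum ks)) ⟩
  ∑ (funs (allFin (length ks)) (sum ks)) (λ w → ind (isStirlingPerm? ks w ×-dec (numDescents ks w ℕ.≟ i)))
    ≡⟨ ∑-cong (λ w → trans (ind-× (isStirlingPerm? ks w) (numDescents ks w ℕ.≟ i))
         (cong₂ (λ x d → x * ind (d ℕ.≟ i)) (ind-stirling ks w) (numDescents-des ks w))) (funs (allFin (length ks)) (sum ks)) ⟩
  ∑ (funs (allFin (length ks)) (sum ks)) (λ w → ind (validWord? ks (toWord w)) * ind (des (toWord w) ℕ.≟ i))
    ≡⟨ ∑-funs-words (length ks) (sum ks) (λ l → ind (validWord? ks l) * ind (des l ℕ.≟ i)) ⟩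
  ∑ (words (length ks) (sum ks)) (λ l → ind (validWord? ks l) * ind (des l ℕ.≟ i)) ∎

-- A bound on the number of descents

∑-mono : {f g : X → ℕ} → (∀ x → f x ≤ g x) → ∀ xs → ∑ xs f ≤ ∑ xs g
∑-mono h []       = z≤n
∑-mono h (x ∷ xs) = ℕP.+-mono-≤ (h x) (∑-mono h xs)

∑-const-1 : (xs : List X) → ∑ xs (λ _ → 1) ≡ length xs
∑-const-1 []       = refl
∑-const-1 (x ∷ xs) = cong suc (∑-const-1 xs)

module _ (N : ℕ) where

  distinct : List ℕ → ℕ
  distinct l = ∑ (upTo N) (λ j → ind (1 ℕ.≤? occ j l))

  distinct≤ : ∀ l → distinct l ≤ N
  distinct≤ l = ℕP.≤-trans (∑-mono (λ j → ind≤1 (1 ℕ.≤? occ j l)) (upTo N))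
    (ℕP.≤-reflexive (trans (∑-const-1 (upTo N)) (ListP.length-upTo N)))

  distinct-cons : ∀ a l → distinct l ≤ distinct (a ∷ l)
  distinct-cons a l = ∑-mono (λ j → mono j (1 ℕ.≤? occ j l)) (upTo N)
    where
    mono : ∀ j (D : Dec (1 ≤ occ j l)) → ind D ≤ ind (1 ℕ.≤? occ j (a ∷ l))
    mono j (no _)  = z≤n
    mono j (yes p) = ℕP.≤-reflexive (sym (ind-yes (1 ℕ.≤? occ j (a ∷ l)) (ℕP.≤-trans p (ℕP.m≤n+m _ (ind (a ℕ.≟ j))))))

  distinct-new : ∀ a l → a < N → occ a l ≡ 0 → distinct (a ∷ l) ≡ suc (distinct l)
  distinct-new a l a<N o = begin
    distinct (a ∷ l)
      ≡⟨ ∑-cong (λ j → split j (j ℕ.≟ a)) (upTo N) ⟩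
    ∑ (upTo N) (λ j → ind (j ℕ.≟ a) * 1 + ind (1 ℕ.≤? occ j l))
      ≡⟨ ∑-+ (upTo N) (λ j → ind (j ℕ.≟ a) * 1) _ ⟩
    ∑ (upTo N) (λ j → ind (j ℕ.≟ a) * 1) + distinct l
      ≡⟨ cong (_+ distinct l) (∑-upTo-pick N a (λ _ → 1) a<N) ⟩
    suc (distinct l) ∎
    where
    split : ∀ j → Dec (j ≡ a) → ind (1 ℕ.≤? occ j (a ∷ l)) ≡ ind (j ℕ.≟ a) * 1 + ind (1 ℕ.≤? occ j l)
    split j (yes refl) = trans (ind-yes (1 ℕ.≤? occ a (a ∷ l)) (subst (1 ≤_) (sym (occ-head a l)) (s≤s z≤n)))
      (sym (cong₂ _+_ (cong (_* 1) (ind-yes (a ℕ.≟ a) refl)) (ind-no (1 ℕ.≤? occ a l) (λ p → contradiction (subst (1 ≤_) o p) λ ()))))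
    split j (no ne) = trans (cong (λ z → ind (1 ℕ.≤? z)) (occ-skip l (λ e → ne (sym e))))
      (sym (cong (_+ ind (1 ℕ.≤? occ j l)) (cong (_* 1) (ind-no (j ℕ.≟ a) ne))))

  -- A descent can only occur at the last occurrence of a letter.
  des≤distinct : ∀ l → Stirling l → All (_< N) l → des l ≤ distinct l
  des≤distinct []          st ps = z≤n
  des≤distinct (a ∷ [])    st (p ∷ ps) = subst (1 ≤_) (sym (distinct-new a [] p refl)) (s≤s z≤n)
  des≤distinct (a ∷ b ∷ l) ((g , _) , st) (p ∷ ps) = go (b ℕ.<? a)
    where
    go : (D : Dec (b < a)) → ind D + des (b ∷ l) ≤ distinct (a ∷ b ∷ l)
    go (no _)    = ℕP.≤-trans (des≤distinct (b ∷ l) st ps) (distinct-cons a (b ∷ l))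
    go (yes b<a) = subst (suc (des (b ∷ l)) ≤_) (sym (distinct-new a (b ∷ l) p absent)) (s≤s (des≤distinct (b ∷ l) st ps))
      where
      absent : occ a (b ∷ l) ≡ 0
      absent = trans (occ-skip l (ℕP.<⇒≢ b<a)) (ℕP.n<1⇒n≡0 (ℕP.≰⇒> (λ o → ℕP.<⇒≱ b<a (g o))))

  -- The sums that define both Stirling polynomials run over N values of the number of descents;
  -- this bound shows that they miss no word.
  des≤letters : ∀ l → Stirling l → All (_< N) l → des l ≤ N
  des≤letters l st ps = ℕP.≤-trans (des≤distinct l st ps) (distinct≤ l)

-- Stirling polynomials as weighted sums over words

wordSum : List ℕ → (ℕ → ℕ) → ℕ
wordSum ks = stirlingSum (length ks) (sum ks) (coeff ks)

∑-applyUpTo : ∀ (g : ℕ → ℕ) N (h : ℕ → ℕ) → ∑ (applyUpTo g N) h ≡ ∑ (upTo N) (h ∘ g)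
∑-applyUpTo g N h = cong sum (trans (ListP.map-applyUpTo g h N) (sym (ListP.map-applyUpTo id (h ∘ g) N)))

-- Both polynomials group the words by descents, in opposite orders. The last hypothesis asks that
-- `g` take each value d from 1 to N at exactly one index, with `h` there equal to the weight of d;
-- exchanging the sums then dissolves the grouping. Positivity of the length excludes d = 0.
∑-A : ∀ ks → 1 ≤ sum ks → (g h W : ℕ → ℕ) →
  (∀ d → 1 ≤ d → d ≤ length ks → ∃ λ a → a < length ks × h a ≡ W d × (∀ x → x < length ks → (d ≡ g x → x ≡ a) × (x ≡ a → d ≡ g x))) →
  ∑ (upTo (length ks)) (λ x → A ks (g x) * h x) ≡ wordSum ks W
∑-A ks pos g h W pick = begin
  ∑ (upTo N) (λ x → A ks (g x) * h x)
    ≡⟨ ∑-cong (λ x → trans (cong (_* h x) (A-words ks (g x))) (sym (∑-*ʳ (h x) (words N K) _))) (upTo N) ⟩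
  ∑ (upTo N) (λ x → ∑ (words N K) (λ l → ind (validWord? ks l) * ind (des l ℕ.≟ g x) * h x))
    ≡⟨ ∑-swap (upTo N) (words N K) _ ⟩
  ∑ (words N K) (λ l → ∑ (upTo N) (λ x → ind (validWord? ks l) * ind (des l ℕ.≟ g x) * h x))
    ≡⟨ ∑-words-cong N K (λ l len ps → trans
         (∑-cong (λ x → ℕP.*-assoc (ind (validWord? ks l)) _ (h x)) (upTo N))
         (trans (∑-*ˡ (ind (validWord? ks l)) (upTo N) _)
         (ind-*-cong (validWord? ks l) (λ (_ , st) → select (des l) (1≤des l (subst (1 ≤_) (sym len) pos)) (des≤letters N l st ps))))) ⟩
  wordSum ks W ∎
  where
  N K : ℕ
  N = length ks
  K = sum ks
  select : ∀ d → 1 ≤ d → d ≤ N → ∑ (upTo N) (λ x → ind (d ℕ.≟ g x) * h x) ≡ W d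
  select d 1≤d d≤N with pick d 1≤d d≤N
  ... | a , a<N , ha , iff = trans
    (∑-upTo-cong N (λ x x<N → cong (_* h x) (ind-cong (d ℕ.≟ g x) (x ℕ.≟ a) (proj₁ (iff x x<N)) (proj₂ (iff x x<N)))))
    (trans (∑-upTo-pick N a h a<N) ha)

length≤sum : ∀ ks → All (1 ≤_) ks → length ks ≤ sum ks
length≤sum []       []       = z≤n
length≤sum (k ∷ ks) (p ∷ ps) = ℕP.+-mono-≤ p (length≤sum ks ps)

-- A word with d descents contributes the exponent d to B and the exponent K + 1 - d to b. The
-- subtraction never truncates, as d ≤ K.
polyB polyb : List ℕ → ℕ → ℕ
polyB ks m = wordSum ks (λ d → coefX (sum ks) d m)
polyb ks m = wordSum ks (λ d → coefX (sum ks) (suc (sum ks) ∸ d) m)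

B-polyB : ∀ ks → All (1 ≤_) ks → ∀ m → B ks m ≡ polyB ks m
B-polyB []          _  m = sym (trans (ℕP.+-identityʳ _) (trans (ℕP.+-identityʳ _) (nC0≡1 (m + 0))))
B-polyB ks@(_ ∷ _) ps m = trans (∑-applyUpTo suc (length ks) _)
  (∑-A ks (ℕP.≤-trans (s≤s z≤n) (length≤sum ks ps)) suc (λ x → coefX (sum ks) (suc x) m) (λ d → coefX (sum ks) d m)
    λ { (suc d) _ d<N → d , d<N , refl , λ x _ → (λ e → sym (ℕP.suc-injective e)) , (λ e → cong suc (sym e)) })

-- For the empty tuple the empty word has d = 0, hence exponent 1, and the series is x / (1-x). It
-- agrees with the constant 1 only from m = 1 on, which is why m is positive here.
b-polyb : ∀ ks → All (1 ≤_) ks → ∀ m → 1 ≤ m → b ks m ≡ polyb ks m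
b-polyb []         _  (suc m) _ = sym (trans (ℕP.+-identityʳ _) (trans (ℕP.+-identityʳ _) (nC0≡1 (m + 0))))
b-polyb ks@(_ ∷ _) ps m       _ = trans (∑-applyUpTo (λ d → K ∸ N + 1 + d) N _)
  (∑-A ks (ℕP.≤-trans (s≤s z≤n) N≤K) (λ x → K + 1 ∸ (K ∸ N + 1 + x)) (λ x → coefX K (K ∸ N + 1 + x) m)
    (λ d → coefX K (suc K ∸ d) m) pick)
  where
  N K : ℕ
  N = length ks
  K = sum ks
  N≤K : N ≤ K
  N≤K = length≤sum ks ps
  -- The exponent K - N + 1 + x belongs to N - x descents: the sum runs through the numbers of
  -- descents downwards, and the index for d is N - d.
  g-eq : ∀ x → K + 1 ∸ (K ∸ N + 1 + x) ≡ N ∸ x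
  g-eq x = begin
    K + 1 ∸ (K ∸ N + 1 + x)      ≡⟨ sym (ℕP.∸-+-assoc (K + 1) (K ∸ N + 1) x) ⟩
    K + 1 ∸ (K ∸ N + 1) ∸ x      ≡⟨ cong (_∸ x) (cong₂ _∸_ (ℕP.+-comm K 1) (ℕP.+-comm (K ∸ N) 1)) ⟩
    K ∸ (K ∸ N) ∸ x              ≡⟨ cong (_∸ x) (ℕP.m∸[m∸n]≡n N≤K) ⟩
    N ∸ x ∎
  h-eq : ∀ d → d ≤ N → K ∸ N + 1 + (N ∸ d) ≡ suc K ∸ d
  h-eq d d≤N = begin
    K ∸ N + 1 + (N ∸ d)      ≡⟨ cong (_+ (N ∸ d)) (ℕP.+-comm (K ∸ N) 1) ⟩
    suc (K ∸ N + (N ∸ d))    ≡⟨ cong suc (sym (ℕP.+-∸-assoc (K ∸ N) d≤N)) ⟩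
    suc (K ∸ N + N ∸ d)      ≡⟨ cong (λ z → suc (z ∸ d)) (ℕP.m∸n+n≡m N≤K) ⟩
    suc (K ∸ d)              ≡⟨ sym (ℕP.+-∸-assoc 1 (ℕP.≤-trans d≤N N≤K)) ⟩
    suc K ∸ d ∎
  pick : ∀ d → 1 ≤ d → d ≤ N → ∃ λ a → a < N × coefX K (K ∸ N + 1 + a) m ≡ coefX K (suc K ∸ d) m ×
    (∀ x → x < N → (d ≡ K + 1 ∸ (K ∸ N + 1 + x) → x ≡ a) × (x ≡ a → d ≡ K + 1 ∸ (K ∸ N + 1 + x)))
  pick d 1≤d d≤N = N ∸ d , ℕP.∸-monoʳ-< {o = 0} 1≤d d≤N , cong (λ z → coefX K z m) (h-eq d d≤N) , λ x x<N →
    (λ e → trans (sym (ℕP.m∸[m∸n]≡n (ℕP.<⇒≤ x<N))) (cong (N ∸_) (sym (trans e (g-eq x))))) ,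
    (λ e → trans (sym (ℕP.m∸[m∸n]≡n d≤N)) (trans (cong (N ∸_) (sym e)) (sym (g-eq x))))

wordSum-cong : ∀ ks {V W : ℕ → ℕ} → (∀ d → d ≤ sum ks → V d ≡ W d) → wordSum ks V ≡ wordSum ks W
wordSum-cong ks h = ∑-words-cong (length ks) (sum ks) (λ l len _ →
  cong (ind (validWord? ks l) *_) (h (des l) (subst (des l ≤_) len (des≤length l))))

wordSum-+ : ∀ ks (V W : ℕ → ℕ) → wordSum ks (λ d → V d + W d) ≡ wordSum ks V + wordSum ks W
wordSum-+ ks V W = trans
  (∑-cong (λ l → ℕP.*-distribˡ-+ (ind (validWord? ks l)) (V (des l)) (W (des l))) (words (length ks) (sum ks)))
  (∑-+ (words (length ks) (sum ks)) _ _)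

wordSum-* : ∀ ks c (W : ℕ → ℕ) → wordSum ks (λ d → c * W d) ≡ c * wordSum ks W
wordSum-* ks c W = trans
  (∑-cong (λ l → exch (ind (validWord? ks l)) c (W (des l))) (words (length ks) (sum ks)))
  (∑-*ˡ c (words (length ks) (sum ks)) _)
  where
  exch : ∀ a b x → a * (b * x) ≡ b * (a * x)
  exch = solve-∀

wordSum-zero : ∀ ks → wordSum ks (λ _ → 0) ≡ 0
wordSum-zero ks = trans (∑-cong (λ l → ℕP.*-zeroʳ (ind (validWord? ks l))) (words (length ks) (sum ks)))
  (∑-zero (words (length ks) (sum ks)))

coeff-++< : ∀ ks x {j} → j < length ks → coeff (ks ++ [ x ]) j ≡ coeff ks j
coeff-++< (k ∷ ks) x {zero}  _         = refl
coeff-++< (k ∷ ks) x {suc j} (s≤s j<n) = coeff-++< ks x j<n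

coeff-++-last : ∀ ks x → coeff (ks ++ [ x ]) (length ks) ≡ x
coeff-++-last []       x = refl
coeff-++-last (k ∷ ks) x = coeff-++-last ks x

sum-snoc : ∀ ks x → sum (ks ++ [ x ]) ≡ x + sum ks
sum-snoc ks x = trans (sum-++ ks [ x ]) (trans (cong (sum ks +_) (ℕP.+-identityʳ x)) (ℕP.+-comm (sum ks) x))

wordSum-snoc : ∀ ks r (W : ℕ → ℕ) →
  wordSum (ks ++ [ suc r ]) W ≡ wordSum ks (λ d → d * W d + (suc (sum ks) ∸ d) * W (suc d))
wordSum-snoc ks r W = trans
  (cong₂ (λ N K → stirlingSum N K (coeff (ks ++ [ suc r ])) W)
    (trans (ListP.length-++ ks) (ℕP.+-comm (length ks) 1)) (sum-snoc ks (suc r)))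
  (Insertion.stirlingSum-insert (length ks) r (sum ks) (coeff ks) (coeff (ks ++ [ suc r ])) W
    (coeff-++< ks (suc r)) (coeff-++-last ks (suc r)))

-- The same identity coefX-derivative serves both polynomials: at the index i = d for B, at i = K + 1 − d for b.
wordSum-snoc-B : ∀ ks r m → wordSum (ks ++ [ suc r ]) (λ d → coefX (suc (sum ks)) d m) ≡ m * polyB ks m
wordSum-snoc-B ks r m = trans (wordSum-snoc ks r (λ d → coefX (suc (sum ks)) d m)) (trans
  (wordSum-cong ks (λ d d≤K → coefX-derivative (sum ks) d m (ℕP.m≤n⇒m≤1+n d≤K)))
  (wordSum-* ks m (λ d → coefX (sum ks) d m)))

wordSum-snoc-b : ∀ ks r m →
  wordSum (ks ++ [ suc r ]) (λ d → coefX (suc (sum ks)) (suc (suc (sum ks)) ∸ d) m) ≡ m * polyb ks m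
wordSum-snoc-b ks r m = trans (wordSum-snoc ks r (λ d → coefX (suc K) (suc (suc K) ∸ d) m))
  (trans (wordSum-cong ks step) (wordSum-* ks m (λ d → coefX K (suc K ∸ d) m)))
  where
  K : ℕ
  K = sum ks
  step : ∀ d → d ≤ K → d * coefX (suc K) (suc (suc K) ∸ d) m + (suc K ∸ d) * coefX (suc K) (suc K ∸ d) m
    ≡ m * coefX K (suc K ∸ d) m
  step d d≤K = begin
    d * coefX (suc K) (suc (suc K) ∸ d) m + (suc K ∸ d) * coefX (suc K) (suc K ∸ d) m
      ≡⟨ ℕP.+-comm (d * coefX (suc K) (suc (suc K) ∸ d) m) _ ⟩
    (suc K ∸ d) * coefX (suc K) (suc K ∸ d) m + d * coefX (suc K) (suc (suc K) ∸ d) m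
      ≡⟨ cong₂ (λ x y → (suc K ∸ d) * coefX (suc K) (suc K ∸ d) m + x * coefX (suc K) y m)
           (sym (ℕP.m∸[m∸n]≡n d≤1+K)) (ℕP.+-∸-assoc 1 d≤1+K) ⟩
    (suc K ∸ d) * coefX (suc K) (suc K ∸ d) m + (suc K ∸ (suc K ∸ d)) * coefX (suc K) (suc (suc K ∸ d)) m
      ≡⟨ coefX-derivative K (suc K ∸ d) m (ℕP.m∸n≤m (suc K) d) ⟩
    m * coefX K (suc K ∸ d) m ∎
    where
    d≤1+K : d ≤ suc K
    d≤1+K = ℕP.m≤n⇒m≤1+n d≤K

polyB-1 : ∀ ks m → polyB (ks ++ [ 1 ]) m ≡ m * polyB ks m
polyB-1 ks m = trans (cong (λ K → wordSum (ks ++ [ 1 ]) (λ d → coefX K d m)) (sum-snoc ks 1)) (wordSum-snoc-B ks 0 m)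

polyb-1 : ∀ ks m → polyb (ks ++ [ 1 ]) m ≡ m * polyb ks m
polyb-1 ks m = trans (cong (λ K → wordSum (ks ++ [ 1 ]) (λ d → coefX K (suc K ∸ d) m)) (sum-snoc ks 1)) (wordSum-snoc-b ks 0 m)

-- A letter of multiplicity 2 raises K by 2, whereas x d/dx raises the power of the denominator only
-- by 1. The surplus factor 1/(1-x) is removed by the first difference.
polyB-2 : ∀ ks m → polyB (ks ++ [ 2 ]) (suc m) ≡ polyB (ks ++ [ 2 ]) m + suc m * polyB ks (suc m)
polyB-2 ks m = begin
  polyB (ks ++ [ 2 ]) (suc m)
    ≡⟨ cong (λ K → wordSum (ks ++ [ 2 ]) (λ d → coefX K d (suc m))) (sum-snoc ks 2) ⟩
  wordSum (ks ++ [ 2 ]) (λ d → coefX (2 + sum ks) d (suc m))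
    ≡⟨ wordSum-cong (ks ++ [ 2 ]) (λ d _ → coefX-difference (suc (sum ks)) d m) ⟩
  wordSum (ks ++ [ 2 ]) (λ d → coefX (2 + sum ks) d m + coefX (suc (sum ks)) d (suc m))
    ≡⟨ wordSum-+ (ks ++ [ 2 ]) (λ d → coefX (2 + sum ks) d m) (λ d → coefX (suc (sum ks)) d (suc m)) ⟩
  wordSum (ks ++ [ 2 ]) (λ d → coefX (2 + sum ks) d m) + wordSum (ks ++ [ 2 ]) (λ d → coefX (suc (sum ks)) d (suc m))
    ≡⟨ cong₂ _+_ (cong (λ K → wordSum (ks ++ [ 2 ]) (λ d → coefX K d m)) (sym (sum-snoc ks 2))) (wordSum-snoc-B ks 1 (suc m)) ⟩
  polyB (ks ++ [ 2 ]) m + suc m * polyB ks (suc m) ∎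

-- As for B, except that the exponent K + 1 - d also grows with K: after the difference a factor x
-- is left over, and it moves the last term from m + 1 to m.
polyb-2 : ∀ ks m → polyb (ks ++ [ 2 ]) (suc m) ≡ polyb (ks ++ [ 2 ]) m + m * polyb ks m
polyb-2 ks m = begin
  polyb (ks ++ [ 2 ]) (suc m)
    ≡⟨ cong (λ K → wordSum (ks ++ [ 2 ]) (λ d → coefX K (suc K ∸ d) (suc m))) (sum-snoc ks 2) ⟩
  wordSum (ks ++ [ 2 ]) (λ d → coefX K₂ (suc K₂ ∸ d) (suc m))
    ≡⟨ wordSum-cong (ks ++ [ 2 ]) (λ d d≤ → trans (coefX-difference (suc (sum ks)) (suc K₂ ∸ d) m)
         (cong (λ z → coefX K₂ (suc K₂ ∸ d) m + z)
           (trans (cong (λ z → coefX (suc (sum ks)) z (suc m)) (ℕP.+-∸-assoc 1 (subst (d ≤_) (sum-snoc ks 2) d≤)))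
             (coefX-suc (suc (sum ks)) (K₂ ∸ d) m)))) ⟩
  wordSum (ks ++ [ 2 ]) (λ d → coefX K₂ (suc K₂ ∸ d) m + coefX (suc (sum ks)) (K₂ ∸ d) m)
    ≡⟨ wordSum-+ (ks ++ [ 2 ]) (λ d → coefX K₂ (suc K₂ ∸ d) m) (λ d → coefX (suc (sum ks)) (K₂ ∸ d) m) ⟩
  wordSum (ks ++ [ 2 ]) (λ d → coefX K₂ (suc K₂ ∸ d) m) + wordSum (ks ++ [ 2 ]) (λ d → coefX (suc (sum ks)) (K₂ ∸ d) m)
    ≡⟨ cong₂ _+_ (cong (λ K → wordSum (ks ++ [ 2 ]) (λ d → coefX K (suc K ∸ d) m)) (sym (sum-snoc ks 2))) (wordSum-snoc-b ks 1 m) ⟩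
  polyb (ks ++ [ 2 ]) m + m * polyb ks m ∎
  where
  K₂ : ℕ
  K₂ = 2 + sum ks

polyB-2-zero : ∀ ks → polyB (ks ++ [ 2 ]) 0 ≡ 0
polyB-2-zero ks = trans (wordSum-snoc ks 1 (λ d → coefX (sum (ks ++ [ 2 ])) d 0)) (trans (wordSum-cong ks (λ d _ → vanish d)) (wordSum-zero ks))
  where
  vanish : ∀ d → d * coefX (sum (ks ++ [ 2 ])) d 0 + (suc (sum ks) ∸ d) * coefX (sum (ks ++ [ 2 ])) (suc d) 0 ≡ 0
  vanish zero    = ℕP.*-zeroʳ (sum ks)
  vanish (suc d) = cong₂ _+_ (ℕP.*-zeroʳ (suc d)) (ℕP.*-zeroʳ (sum ks ∸ d))

polyb-zero : ∀ ks → polyb ks 0 ≡ 0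
polyb-zero ks = trans (wordSum-cong ks (λ d d≤K → cong (λ z → coefX (sum ks) z 0) (ℕP.+-∸-assoc 1 d≤K))) (wordSum-zero ks)

poly-ones : (p : List ℕ → ℕ → ℕ) → (∀ ks m → p (ks ++ [ 1 ]) m ≡ m * p ks m) →
  ∀ j ks m → p (ks ++ replicate j 1) m ≡ m ^ j * p ks m
poly-ones p p-1 zero    ks m = trans (cong (λ l → p l m) (ListP.++-identityʳ ks)) (sym (ℕP.+-identityʳ _))
poly-ones p p-1 (suc j) ks m = begin
  p (ks ++ 1 ∷ replicate j 1) m          ≡⟨ cong (λ l → p l m) (sym (ListP.++-assoc ks [ 1 ] (replicate j 1))) ⟩
  p ((ks ++ [ 1 ]) ++ replicate j 1) m   ≡⟨ poly-ones p p-1 j (ks ++ [ 1 ]) m ⟩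
  m ^ j * p (ks ++ [ 1 ]) m              ≡⟨ cong (m ^ j *_) (p-1 ks m) ⟩
  m ^ j * (m * p ks m)                   ≡⟨ exch (m ^ j) m (p ks m) ⟩
  m * m ^ j * p ks m ∎
  where
  exch : ∀ a b x → a * (b * x) ≡ b * a * x
  exch = solve-∀

-- `tn` adds blocks in front, but insertion concerns the largest letter, whose multiplicity is the
-- last entry of the tuple.
tn-snoc : ∀ t n → tn (suc t) (suc n) ≡ (tn (suc t) n ++ replicate t 1) ++ [ 2 ]
tn-snoc t n = trans (go n) (sym (ListP.++-assoc (tn (suc t) n) (replicate t 1) [ 2 ]))
  where
  blk : List ℕ
  blk = replicate t 1 ++ [ 2 ]
  go : ∀ n → tn (suc t) (suc n) ≡ tn (suc t) n ++ blk
  go zero    = ListP.++-identityʳ blk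
  go (suc n) = trans (cong (blk ++_) (go n)) (sym (ListP.++-assoc blk (tn (suc t) n) blk))

tn-positive : ∀ t n → All (1 ≤_) (tn t n)
tn-positive t zero    = []
tn-positive t (suc n) = AllP.++⁺ (AllP.++⁺ (AllP.replicate⁺ (t ∸ 1) (s≤s z≤n)) (s≤s z≤n ∷ [])) (tn-positive t n)

-- The t ones of a block give the factor mᵗ, its 2 one more factor m and a first difference: B(m) -
-- B(m-1) is m to the power t + 1 times the value at m with one block less. This is `hom-last` for c
-- = 0, with last variable m.
polyB-hom : ∀ t n m → polyB (tn (suc t) n) m ≡ hom (suc t) 0 (n + m) m
polyB-hom t zero    m       = trans (sym (B-polyB [] [] m)) (sym (hom-diag (suc t) 0 m))
polyB-hom t (suc n) zero    = trans (cong (λ l → polyB l 0) (tn-snoc t n)) (polyB-2-zero (tn (suc t) n ++ replicate t 1))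
polyB-hom t (suc n) (suc m) = begin
  polyB (tn (suc t) (suc n)) (suc m)
    ≡⟨ cong (λ l → polyB l (suc m)) (tn-snoc t n) ⟩
  polyB ((tn (suc t) n ++ replicate t 1) ++ [ 2 ]) (suc m)
    ≡⟨ polyB-2 (tn (suc t) n ++ replicate t 1) m ⟩
  polyB ((tn (suc t) n ++ replicate t 1) ++ [ 2 ]) m + suc m * polyB (tn (suc t) n ++ replicate t 1) (suc m)
    ≡⟨ cong₂ (λ x y → x + suc m * y) (trans (cong (λ l → polyB l m) (sym (tn-snoc t n))) (polyB-hom t (suc n) m))
         (trans (poly-ones polyB polyB-1 t (tn (suc t) n) (suc m)) (cong (suc m ^ t *_) (polyB-hom t n (suc m)))) ⟩
  hom (suc t) 0 (suc n + m) m + suc m * (suc m ^ t * hom (suc t) 0 (n + suc m) (suc m))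
    ≡⟨ cong₂ _+_ (cong (λ z → hom (suc t) 0 z m) (sym (ℕP.+-suc n m))) (sym (ℕP.*-assoc (suc m) (suc m ^ t) _)) ⟩
  hom (suc t) 0 (n + suc m) m + suc m ^ suc t * hom (suc t) 0 (n + suc m) (suc m)
    ≡⟨ sym (hom-last (suc t) 0 (n + suc m) m) ⟩
  hom (suc t) 0 (suc n + suc m) (suc m) ∎

polyb-elemDeg : ∀ t n m → 1 ≤ m → polyb (tn (suc t) n) m ≡ elemDeg (suc t) 0 m n
polyb-elemDeg t zero    m 1≤m = sym (b-polyb [] [] m 1≤m)
polyb-elemDeg t (suc n) m _   = go m
  where
  go : ∀ m → polyb (tn (suc t) (suc n)) m ≡ elemDeg (suc t) 0 m (suc n)
  -- The induction hypothesis requires a positive argument. At m = 0, where the recursion `go`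
  -- starts, the factor m makes both sides 0.
  top : ∀ m → m * (m ^ t * polyb (tn (suc t) n) m) ≡ m ^ suc t * elemDeg (suc t) 0 m n
  top zero    = refl
  top (suc m) = trans (sym (ℕP.*-assoc (suc m) (suc m ^ t) _)) (cong (suc m ^ suc t *_) (polyb-elemDeg t n (suc m) (s≤s z≤n)))
  go zero    = polyb-zero (tn (suc t) (suc n))
  go (suc m) = begin
    polyb (tn (suc t) (suc n)) (suc m)
      ≡⟨ cong (λ l → polyb l (suc m)) (tn-snoc t n) ⟩
    polyb ((tn (suc t) n ++ replicate t 1) ++ [ 2 ]) (suc m)
      ≡⟨ polyb-2 (tn (suc t) n ++ replicate t 1) m ⟩
    polyb ((tn (suc t) n ++ replicate t 1) ++ [ 2 ]) m + m * polyb (tn (suc t) n ++ replicate t 1) m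
      ≡⟨ cong₂ (λ x y → x + m * y) (trans (cong (λ l → polyb l m) (sym (tn-snoc t n))) (go m))
           (poly-ones polyb polyb-1 t (tn (suc t) n) m) ⟩
    elemDeg (suc t) 0 m (suc n) + m * (m ^ t * polyb (tn (suc t) n) m)
      ≡⟨ cong (elemDeg (suc t) 0 m (suc n) +_) (top m) ⟩
    elemDeg (suc t) 0 m (suc n) + m ^ suc t * elemDeg (suc t) 0 m n
      ≡⟨ sym (elemDeg-last (suc t) 0 m n) ⟩
    elemDeg (suc t) 0 (suc m) (suc n) ∎

-- The defining identities

open import Data.Integer using (+_)

s-above : ∀ t {n k} → n < k → s t n k ≡ 0
s-above t {zero}  {suc k} _         = refl
s-above t {suc n} {suc k} (s≤s n<k) = trans (s-suc t n k)
  (trans (cong₂ (λ x y → x + n ^ t * y) (s-above t n<k) (s-above t (ℕP.m<n⇒m<1+n n<k))) (ℕP.*-zeroʳ (n ^ t)))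

s-diag : ∀ t n → s t n n ≡ 1
s-diag t zero    = refl
s-diag t (suc n) = trans (s-suc t n n)
  (trans (cong₂ (λ x y → x + n ^ t * y) (s-diag t n) (s-above t (ℕP.n<1+n n))) (cong suc (ℕP.*-zeroʳ (n ^ t))))

sℤ-suc : ∀ t n z → sℤ t (suc n) z ≡ sℤ t n (ℤ.pred z) + n ^ t * sℤ t n z
sℤ-suc t n (+ zero)   = s-zero t n
sℤ-suc t n (+ suc k)  = s-suc t n k
sℤ-suc t n (-[1+ k ]) = sym (ℕP.*-zeroʳ (n ^ t))

-- Indexing by the degree covers negative n - k as well, where both sides are 0, so k and n need not
-- be compared. Raising both keeps their difference, and the recurrence of `s` turns into the
-- last-variable recurrence of `elemDeg`.
sℤ-elemDeg : ∀ t n k → sℤ t n (+ n - + k) ≡ elemDeg t 0 n k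
sℤ-elemDeg t n       zero    = trans (cong (sℤ t n) (ℤP.+-identityʳ (+ n))) (s-diag t n)
sℤ-elemDeg t zero    (suc k) = refl
sℤ-elemDeg t (suc n) (suc k) = begin
  sℤ t (suc n) (+ suc n - + suc k)
    ≡⟨ cong (sℤ t (suc n)) (trans (ℤP.[1+m]⊖[1+n]≡m⊖n n k) (sym (ℤP.m-n≡m⊖n n k))) ⟩
  sℤ t (suc n) (+ n - + k)
    ≡⟨ sℤ-suc t n (+ n - + k) ⟩
  sℤ t n (ℤ.pred (+ n - + k)) + n ^ t * sℤ t n (+ n - + k)
    ≡⟨ cong₂ (λ x y → x + n ^ t * y)
         (trans (cong (sℤ t n) (sym (ℤP.minus-suc (+ n) k))) (sℤ-elemDeg t n (suc k))) (sℤ-elemDeg t n k) ⟩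
  elemDeg t 0 n (suc k) + n ^ t * elemDeg t 0 n k
    ≡⟨ sym (elemDeg-last t 0 n k) ⟩
  elemDeg t 0 (suc n) (suc k) ∎

sumTo : ℕ → (ℕ → ℤ) → ℤ
sumTo zero    f = + 0
sumTo (suc L) f = f 0 ℤ.+ sumTo L (f ∘ suc)

-- The product of x - iᵗ over c ≤ i < c + k. With a free start `c`, what remains after cancelling
-- the first factor has the same shape.
falling : (t c k : ℕ) → ℤ → ℤ
falling t c zero    x = + 1
falling t c (suc k) x = (x - + (c ^ t)) ℤ.* falling t (suc c) k x

sumTo-cong : ∀ L {f g : ℕ → ℤ} → f ≗ g → sumTo L f ≡ sumTo L g
sumTo-cong zero    e = refl
sumTo-cong (suc L) e = cong₂ ℤ._+_ (e 0) (sumTo-cong L (e ∘ suc))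

sumTo-linear : ∀ L a b (f g : ℕ → ℤ) →
  sumTo L (λ k → a ℤ.* f k ℤ.+ b ℤ.* g k) ≡ a ℤ.* sumTo L f ℤ.+ b ℤ.* sumTo L g
sumTo-linear zero    a b f g = sym (cong₂ ℤ._+_ (ℤP.*-zeroʳ a) (ℤP.*-zeroʳ b))
sumTo-linear (suc L) a b f g = trans (cong (λ z → a ℤ.* f 0 ℤ.+ b ℤ.* g 0 ℤ.+ z) (sumTo-linear L a b (f ∘ suc) (g ∘ suc)))
  (regroup a b (f 0) (g 0) (sumTo L (f ∘ suc)) (sumTo L (g ∘ suc)))
  where
  regroup : ∀ a b x y u v → a ℤ.* x ℤ.+ b ℤ.* y ℤ.+ (a ℤ.* u ℤ.+ b ℤ.* v) ≡ a ℤ.* (x ℤ.+ u) ℤ.+ b ℤ.* (y ℤ.+ v)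
  regroup = ℤSolver.solve-∀

sumTo-*ˡ : ∀ L a (f : ℕ → ℤ) → sumTo L (λ k → a ℤ.* f k) ≡ a ℤ.* sumTo L f
sumTo-*ˡ zero    a f = sym (ℤP.*-zeroʳ a)
sumTo-*ˡ (suc L) a f = trans (cong (λ z → a ℤ.* f 0 ℤ.+ z) (sumTo-*ˡ L a (f ∘ suc))) (sym (ℤP.*-distribˡ-+ a (f 0) _))

sumTo-zero : ∀ L → sumTo L (λ _ → + 0) ≡ + 0
sumTo-zero zero    = refl
sumTo-zero (suc L) = trans (ℤP.+-identityˡ _) (sumTo-zero L)

sumℤ-sumTo : ∀ L (f : ℕ → ℤ) → sumℤ (map f (upTo L)) ≡ sumTo L f
sumℤ-sumTo L f = trans (cong sumℤ (ListP.map-applyUpTo id f L)) (go L f)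
  where
  go : ∀ L (f : ℕ → ℤ) → sumℤ (applyUpTo f L) ≡ sumTo L f
  go zero    f = refl
  go (suc L) f = cong (λ z → f 0 ℤ.+ z) (go L (f ∘ suc))

prodℤ-falling : ∀ t k x → prodℤ (map (λ i → x - + (i ^ t)) (upTo k)) ≡ falling t 0 k x
prodℤ-falling t k x = trans (cong prodℤ (ListP.map-applyUpTo id (λ i → x - + (i ^ t)) k)) (go k 0 _ (λ _ → refl))
  where
  go : ∀ k c (f : ℕ → ℤ) → (∀ i → f i ≡ x - + ((c + i) ^ t)) → prodℤ (applyUpTo f k) ≡ falling t c k x
  go zero    c f e = refl
  go (suc k) c f e = cong₂ ℤ._*_ (trans (e 0) (cong (λ z → x - + (z ^ t)) (ℕP.+-identityʳ c)))
    (go k (suc c) (f ∘ suc) (λ i → trans (e (suc i)) (cong (λ z → x - + (z ^ t)) (ℕP.+-suc c i))))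

-- Write x · xⁿ = (x - cᵗ) xⁿ + cᵗ xⁿ and expand the first xⁿ from c + 1 on, the second from c on.
-- The coefficients then add up by the recursion of `hom`. Any length `L` beyond n will do, since
-- the further coefficients vanish.
power-hom : ∀ t n c L x → n < L → sumTo L (λ k → + hom t c n k ℤ.* falling t c k x) ≡ x ℤ.^ n
power-hom t zero    c (suc L) x _ = trans
  (cong (λ z → + 1 ℤ.+ z) (trans (sumTo-cong L (λ k → ℤP.*-zeroˡ (falling t c (suc k) x))) (sumTo-zero L))) refl
power-hom t (suc n) c (suc L) x (s≤s n<L) = begin
  + (c ^ t * hom t c n 0) ℤ.* + 1 ℤ.+ sumTo L (λ k → + hom t c (suc n) (suc k) ℤ.* falling t c (suc k) x)
    ≡⟨ cong₂ (λ u v → u ℤ.* + 1 ℤ.+ v) (ℤP.pos-* (c ^ t) (hom t c n 0))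
         (trans (sumTo-cong L step) (sumTo-linear L (x - q) q _ _)) ⟩
  (q ℤ.* + hom t c n 0) ℤ.* + 1 ℤ.+ ((x - q) ℤ.* sumTo L (λ k → + hom t (suc c) n k ℤ.* falling t (suc c) k x) ℤ.+ q ℤ.* rest)
    ≡⟨ cong (λ z → (q ℤ.* + hom t c n 0) ℤ.* + 1 ℤ.+ ((x - q) ℤ.* z ℤ.+ q ℤ.* rest)) (power-hom t n (suc c) L x n<L) ⟩
  (q ℤ.* + hom t c n 0) ℤ.* + 1 ℤ.+ ((x - q) ℤ.* x ℤ.^ n ℤ.+ q ℤ.* rest)
    ≡⟨ regroup q (+ hom t c n 0) (x - q) (x ℤ.^ n) rest ⟩
  (x - q) ℤ.* x ℤ.^ n ℤ.+ q ℤ.* (+ hom t c n 0 ℤ.* + 1 ℤ.+ rest)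
    ≡⟨ cong (λ z → (x - q) ℤ.* x ℤ.^ n ℤ.+ q ℤ.* z) (power-hom t n c (suc L) x (ℕP.m<n⇒m<1+n n<L)) ⟩
  (x - q) ℤ.* x ℤ.^ n ℤ.+ q ℤ.* x ℤ.^ n
    ≡⟨ collect x q (x ℤ.^ n) ⟩
  x ℤ.* x ℤ.^ n ∎
  where
  q rest : ℤ
  q = + (c ^ t)
  rest = sumTo L (λ k → + hom t c n (suc k) ℤ.* falling t c (suc k) x)
  regroup : ∀ q h y p r → (q ℤ.* h) ℤ.* + 1 ℤ.+ (y ℤ.* p ℤ.+ q ℤ.* r) ≡ y ℤ.* p ℤ.+ q ℤ.* (h ℤ.* + 1 ℤ.+ r)
  regroup = ℤSolver.solve-∀
  collect : ∀ x q p → (x - q) ℤ.* p ℤ.+ q ℤ.* p ≡ x ℤ.* p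
  collect = ℤSolver.solve-∀
  spread : ∀ a q h y f → (a ℤ.+ q ℤ.* h) ℤ.* (y ℤ.* f) ≡ y ℤ.* (a ℤ.* f) ℤ.+ q ℤ.* (h ℤ.* (y ℤ.* f))
  spread = ℤSolver.solve-∀
  step : ∀ k → + hom t c (suc n) (suc k) ℤ.* falling t c (suc k) x
    ≡ (x - q) ℤ.* (+ hom t (suc c) n k ℤ.* falling t (suc c) k x) ℤ.+ q ℤ.* (+ hom t c n (suc k) ℤ.* falling t c (suc k) x)
  step k = trans (cong (λ z → z ℤ.* falling t c (suc k) x)
      (trans (ℤP.pos-+ (hom t (suc c) n k) (c ^ t * hom t c n (suc k)))
        (cong (λ z → + hom t (suc c) n k ℤ.+ z) (ℤP.pos-* (c ^ t) (hom t c n (suc k))))))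
    (spread (+ hom t (suc c) n k) q (+ hom t c n (suc k)) (x - q) (falling t (suc c) k x))

-- Evaluating at cᵗ kills every term but the first; dividing the rest by x − cᵗ ≠ 0 leaves the same problem from c + 1 on.
falling-independent : ∀ t → 1 ≤ t → ∀ L c (D : ℕ → ℤ) →
  (∀ j → c ≤ j → sumTo L (λ k → D k ℤ.* falling t c k (+ (j ^ t))) ≡ + 0) → ∀ k → k < L → D k ≡ + 0
falling-independent t@(suc _) 1≤t (suc L) c D h = λ { zero _ → D0 ; (suc k) (s≤s k<L) → falling-independent t 1≤t L (suc c) (D ∘ suc) h′ k k<L }
  where
  factor : ∀ x → sumTo L (λ k → D (suc k) ℤ.* falling t c (suc k) x)
    ≡ (x - + (c ^ t)) ℤ.* sumTo L (λ k → D (suc k) ℤ.* falling t (suc c) k x)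
  factor x = trans (sumTo-cong L (λ k → exch (D (suc k)) (x - + (c ^ t)) (falling t (suc c) k x))) (sumTo-*ˡ L (x - + (c ^ t)) _)
    where
    exch : ∀ a b y → a ℤ.* (b ℤ.* y) ≡ b ℤ.* (a ℤ.* y)
    exch = ℤSolver.solve-∀
  D0 : D 0 ≡ + 0
  D0 = begin
    D 0
      ≡⟨ sym (trans (ℤP.+-identityʳ _) (ℤP.*-identityʳ (D 0))) ⟩
    D 0 ℤ.* + 1 ℤ.+ + 0
      ≡⟨ cong (λ z → D 0 ℤ.* + 1 ℤ.+ z) (sym (trans (factor (+ (c ^ t)))
           (cong (λ z → z ℤ.* sumTo L (λ k → D (suc k) ℤ.* falling t (suc c) k (+ (c ^ t)))) (ℤP.+-inverseʳ (+ (c ^ t)))))) ⟩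
    D 0 ℤ.* + 1 ℤ.+ sumTo L (λ k → D (suc k) ℤ.* falling t c (suc k) (+ (c ^ t)))
      ≡⟨ h c ℕP.≤-refl ⟩
    + 0 ∎
  h′ : ∀ j → suc c ≤ j → sumTo L (λ k → D (suc k) ℤ.* falling t (suc c) k (+ (j ^ t))) ≡ + 0
  h′ j c<j with ℤP.i*j≡0⇒i≡0∨j≡0 (+ (j ^ t) - + (c ^ t)) product≡0
    where
    product≡0 : (+ (j ^ t) - + (c ^ t)) ℤ.* sumTo L (λ k → D (suc k) ℤ.* falling t (suc c) k (+ (j ^ t))) ≡ + 0
    product≡0 = trans (sym (factor (+ (j ^ t)))) (trans (sym (ℤP.+-identityˡ _))
      (trans (cong (λ z → z ℤ.* + 1 ℤ.+ sumTo L (λ k → D (suc k) ℤ.* falling t c (suc k) (+ (j ^ t)))) (sym D0)) (h j (ℕP.<⇒≤ c<j))))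
  ... | inj₂ e = e
  -- The nodes are distinct: for t ≥ 1 the t-th power is strictly increasing, so c < j excludes jᵗ =
  -- cᵗ.
  ... | inj₁ e = contradiction (ℤP.+-injective (ℤP.i-j≡0⇒i≡j (+ (j ^ t)) (+ (c ^ t)) e))
                   (λ e′ → ℕP.<⇒≢ (ℕP.^-monoˡ-< t c<j) (sym e′))

genStirling-hom : ∀ t → 1 ≤ t → (S : ℕ → ℕ → ℤ) → IsGenStirling2 t S → ∀ n k → k ≤ n → S n k ≡ + hom t 0 n k
genStirling-hom t 1≤t S (expansion , _) n k k≤n =
  ℤP.i-j≡0⇒i≡j (S n k) (+ hom t 0 n k) (falling-independent t 1≤t (suc n) 0 (λ k → S n k - + hom t 0 n k) vanish k (s≤s k≤n))
  where
  vanish : ∀ j → 0 ≤ j → sumTo (suc n) (λ k → (S n k - + hom t 0 n k) ℤ.* falling t 0 k (+ (j ^ t))) ≡ + 0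
  vanish j _ = begin
    sumTo (suc n) (λ k → (S n k - + hom t 0 n k) ℤ.* falling t 0 k x)
      ≡⟨ sumTo-cong (suc n) (λ k → spread (S n k) (+ hom t 0 n k) (falling t 0 k x)) ⟩
    sumTo (suc n) (λ k → + 1 ℤ.* (S n k ℤ.* falling t 0 k x) ℤ.+ ℤ.- (+ 1) ℤ.* (+ hom t 0 n k ℤ.* falling t 0 k x))
      ≡⟨ sumTo-linear (suc n) (+ 1) (ℤ.- (+ 1)) (λ k → S n k ℤ.* falling t 0 k x) (λ k → + hom t 0 n k ℤ.* falling t 0 k x) ⟩
    + 1 ℤ.* sumTo (suc n) (λ k → S n k ℤ.* falling t 0 k x) ℤ.+ ℤ.- (+ 1) ℤ.* sumTo (suc n) (λ k → + hom t 0 n k ℤ.* falling t 0 k x)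
      ≡⟨ cong₂ (λ u v → + 1 ℤ.* u ℤ.+ ℤ.- (+ 1) ℤ.* v) (sym expand) (power-hom t n 0 (suc n) x (ℕP.n<1+n n)) ⟩
    + 1 ℤ.* x ℤ.^ n ℤ.+ ℤ.- (+ 1) ℤ.* x ℤ.^ n
      ≡⟨ cancel (x ℤ.^ n) ⟩
    + 0 ∎
    where
    x : ℤ
    x = + (j ^ t)
    expand : x ℤ.^ n ≡ sumTo (suc n) (λ k → S n k ℤ.* falling t 0 k x)
    expand = trans (expansion n x) (trans (sumℤ-sumTo (suc n) (λ k → S n k ℤ.* prodℤ (map (λ i → x - + (i ^ t)) (upTo k))))
      (sumTo-cong (suc n) (λ k → cong (λ z → S n k ℤ.* z) (prodℤ-falling t k x))))
    spread : ∀ a b f → (a - b) ℤ.* f ≡ + 1 ℤ.* (a ℤ.* f) ℤ.+ ℤ.- (+ 1) ℤ.* (b ℤ.* f)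
    spread = ℤSolver.solve-∀
    cancel : ∀ p → + 1 ℤ.* p ℤ.+ ℤ.- (+ 1) ℤ.* p ≡ + 0
    cancel = ℤSolver.solve-∀

theorem5 : (t : ℕ) → 1 ≤ t → (S : ℕ → ℕ → ℤ) → IsGenStirling2 t S →
    (∀ n k → 1 ≤ k → k ≤ n → S n k ≡ + numPartitionTuples t n k)
    × (∀ n k → 1 ≤ k → k ≤ n → s t n k ≡ numPermTuples t n k)
    × (∀ n m → 1 ≤ m →
         (+ B (tn t n) m ≡ S (n + m) m) × (b (tn t n) m ≡ sℤ t m (+ m - + n)))
    × (∀ n k → 1 ≤ n → 1 ≤ k →
         (S (n + k) k ≡ + weakSum t n k) × (sℤ t n (+ n - + k) ≡ strictSum t n k))
theorem5 t@(suc t′) 1≤t S isS =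
  (λ n k _ k≤n → trans (S≡ n k k≤n) (cong ℤ.+_ (sym (numPartitionTuples-hom t 1≤t n k)))) ,
  (λ n k _ _ → trans (s-elem t n k) (sym (numPermTuples-elem t 1≤t n k))) ,
  (λ n m 1≤m →
    trans (cong ℤ.+_ (trans (B-polyB (tn t n) (tn-positive t n) m) (polyB-hom t′ n m))) (sym (S≡ (n + m) m (ℕP.m≤n+m m n))) ,
    trans (b-polyb (tn t n) (tn-positive t n) m 1≤m) (trans (polyb-elemDeg t′ n m 1≤m) (sym (sℤ-elemDeg t m n)))) ,
  λ { (suc n) (suc k) _ _ →
    trans (S≡ (suc n + suc k) (suc k) (ℕP.m≤n+m (suc k) (suc n))) (cong ℤ.+_ (sym (Weak.weakSum-hom t 1≤t (suc n) k))) ,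
    trans (sℤ-elemDeg t (suc n) (suc k)) (sym (Strict.strictSum-elemDeg t 1≤t n (suc k))) }
  where
  S≡ : ∀ n k → k ≤ n → S n k ≡ + hom t 0 n k
  S≡ = genStirling-hom t 1≤t S isS
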